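{- Fix $\varepsilon>0$ and $\gamma\in(0,1)$, and let $d_N=(1-\gamma)\sqrt{\frac{\log N}{2\log\log N}}$. For a group $G$ of order $N$, an integer $d$ with $2\leqslant d\leqslant d_N$, and $p\leqslant \sqrt[d]{\frac{1-\varepsilon}{2^d}\cdot\frac{\log N}{N^{d-1}}}$, let $\Gamma\in\mathcal{G}(G,p)$. Then with high probability the diameter of $\Gamma$ is greater than $d$; that is, $\Pr(\operatorname{diam}(\Gamma)\leqslant d)\to 0$ as $N\to\infty$, uniformly over all groups $G$ of order $N$, all such $d$ and all such $p$.
   Context: For a group $G$ and a subset $S\subseteq G$, the (undirected) Cayley graph $\Gamma(G;S)$ has vertex set $G$ and an edge between $g\neq h$ iff $g^{ -1}h\in S$ or $h^{ -1}g\in S$ (loops and multiple edges ignored). The model $\mathcal{G}(G,p)$ is the probability space of Cayley graphs $\Gamma(G;S)$ where each element of $G$ is put in $S$ independently with probability $p$. The diameter of a disconnected graph is infinite. "With high probability" means the error probability tends to $0$ as $N\to\infty$, uniformly over the class of groups under consideration. -}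

module Defs where

open import Algebra.Apartness.Bundles using (HeytingField)
open import Algebra.Bundles using (Group; CommutativeRing; Semiring)
import Algebra.Definitions.RawSemiring as RawSemiringDefinitions
import Algebra.Properties.Ring as RingProperties
open import Data.Bool.Base using (if_then_else_)
open import Data.Fin.Base using (Fin; toℕ)
open import Data.Fin.Properties using (any?; all?; inj⇒≟)
open import Data.Fin.Subset using (Subset; inside; outside; _∈_)
open import Data.Fin.Subset.Properties using (_∈?_)
open import Data.List.Base using (List; []; _∷_; _++_; map; filter; foldr)
open import Data.Nat.Base as ℕ using (ℕ; zero; suc; NonZero; _∸_; _!; s≤s; s≤s⁻¹)
open import Data.Nat.Properties using (m^n≢0; _!≢0; anyUpTo?; allUpTo?)
open import Data.Product.Base using (∃-syntax; Σ-syntax; _×_; _,_; proj₁)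
open import Data.Sum.Base using (_⊎_; inj₁; inj₂; [_,_]′)
import Data.Sum.Base as Sum
open import Data.Vec.Base using ([]; _∷_; lookup)
open import Function.Base using (_∘_)
open import Function.Bundles using (Inverse)
open import Function.Properties.Inverse using (Inverse⇒Injection)
open import Level using (_⊔_) renaming (suc to lsuc)
open import Relation.Binary.Core using (Rel)
open import Relation.Binary.Definitions using (Decidable)
open import Relation.Binary.PropositionalEquality as ≡ using (_≡_)
open import Relation.Binary.Structures using (IsStrictPartialOrder)
open import Relation.Nullary using (¬_; ¬?; _×-dec_; _⊎-dec_)
open import Relation.Nullary.Decidable using (map′)
open import Relation.Unary using (Pred) renaming (Decidable to Decidable₁)

-- A Cauchy complete Archimedean ordered field: classically these axioms
-- determine ℝ up to isomorphism, and they are also satisfied by the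
-- constructive Cauchy reals.

record CompleteOrderedField c ℓ₁ ℓ₂ : Set (lsuc (c ⊔ ℓ₁ ⊔ ℓ₂)) where
  field
    heytingField : HeytingField c ℓ₁ ℓ₂

  open HeytingField heytingField public hiding (heytingCommutativeRing)

  commutativeRing : CommutativeRing c ℓ₁
  commutativeRing = record { isCommutativeRing = isCommutativeRing }

  open CommutativeRing commutativeRing public using (ring; semiring)
  open Semiring semiring public using (rawSemiring)
  open RawSemiringDefinitions rawSemiring public
    using (_^_; sum; product) renaming (_×_ to _·_)

  fromℕ : ℕ → Carrier
  fromℕ n = n · 1#

  infix 4 _<_ _≤_
  field
    _<_                    : Rel Carrier ℓ₂
    <-isStrictPartialOrder : IsStrictPartialOrder _≈_ _<_
    #⇒<⊎>                  : ∀ {x y} → x # y → x < y ⊎ y < x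
    <⊎>⇒#                  : ∀ {x y} → x < y ⊎ y < x → x # y
    +-monoˡ-<              : ∀ {x y} z → x < y → x + z < y + z
    *-pos                  : ∀ {x y} → 0# < x → 0# < y → 0# < x * y
    archimedean            : ∀ x → ∃[ n ] x < fromℕ n

  _≤_ : Rel Carrier ℓ₂
  x ≤ y = ¬ (y < x)

  Cauchy : (ℕ → Carrier) → Set (c ⊔ ℓ₂)
  Cauchy s = ∀ e → 0# < e →
    ∃[ n₀ ] ∀ m n → n₀ ℕ.≤ m → n₀ ℕ.≤ n → s m - s n < e

  infix 4 _⟶_
  _⟶_ : (ℕ → Carrier) → Carrier → Set (c ⊔ ℓ₂)
  s ⟶ l = ∀ e → 0# < e →
    ∃[ n₀ ] ∀ n → n₀ ℕ.≤ n → (s n - l < e) × (l - s n < e)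

  field
    complete : ∀ s → Cauchy s → ∃[ l ] s ⟶ l

module RealAnalysis {c ℓ₁ ℓ₂} (ℝ : CompleteOrderedField c ℓ₁ ℓ₂) where
  open CompleteOrderedField ℝ
  open IsStrictPartialOrder <-isStrictPartialOrder
    using (<-respˡ-≈; <-respʳ-≈) renaming (trans to <-trans)

  -- #⇒invertible yields an inverse of y - 0#.
  _/_⟨_⟩ : ∀ x y → y # 0# → Carrier
  x / y ⟨ y#0 ⟩ = x * proj₁ (#⇒invertible y#0)

  0<1 : 0# < 1#
  0<1 = [ 1<0⇒0<1 , (λ 0<1 → 0<1) ]′ (#⇒<⊎> 1#0)
    where
    open RingProperties ring using (-0#≈0#; -1*x≈-x; -‿involutive)

    1-0≈1 : 1# - 0# ≈ 1#
    1-0≈1 = trans (+-congˡ -0#≈0#) (+-identityʳ 1#)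

    1#0 : 1# # 0#
    1#0 = invertible⇒# (1# ,
      trans (*-identityˡ _) 1-0≈1 , trans (*-identityʳ _) 1-0≈1)

    1<0⇒0<1 : 1# < 0# → 0# < 1#
    1<0⇒0<1 1<0 = <-respʳ-≈ (trans (-1*x≈-x (- 1#)) (-‿involutive 1#))
                            (*-pos 0<-1 0<-1)
      where
      0<-1 : 0# < - 1#
      0<-1 = <-respˡ-≈ (-‿inverseʳ 1#)
        (<-respʳ-≈ (+-identityˡ (- 1#)) (+-monoˡ-< (- 1#) 1<0))

  0<fromℕ[1+n] : ∀ n → 0# < fromℕ (suc n)
  0<fromℕ[1+n] zero    = <-respʳ-≈ (sym (+-identityʳ 1#)) 0<1
  0<fromℕ[1+n] (suc n) = <-trans (0<fromℕ[1+n] n)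
    (<-respˡ-≈ (+-identityˡ _) (+-monoˡ-< (fromℕ (suc n)) 0<1))

  fromℕ#0 : ∀ n → .{{NonZero n}} → fromℕ n # 0#
  fromℕ#0 (suc n) = <⊎>⇒# (inj₂ (0<fromℕ[1+n] n))

  infixl 7 _/ℕ_
  _/ℕ_ : Carrier → (n : ℕ) → .{{NonZero n}} → Carrier
  x /ℕ n = x / fromℕ n ⟨ fromℕ#0 n ⟩

  expPartialSum : Carrier → ℕ → Carrier
  expPartialSum y n = sum {n} λ k →
    let instance _ = toℕ k !≢0 in (y ^ toℕ k) /ℕ (toℕ k !)

  -- y = log x, as the solution of exp y = x.
  IsLog : (x y : Carrier) → Set (c ⊔ ℓ₂)
  IsLog x y = expPartialSum y ⟶ x

  -- y is the nonnegative n-th root of x.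
  IsRoot : (n : ℕ) (x y : Carrier) → Set (ℓ₁ ⊔ ℓ₂)
  IsRoot n x y = (0# ≤ y) × (y ^ n ≈ x)

  -- t = (1 - γ) √(log N / (2 log log N))
  IsDegreeThreshold : (γ : Carrier) (N : ℕ) (t : Carrier) → Set (c ⊔ ℓ₁ ⊔ ℓ₂)
  IsDegreeThreshold γ N t =
    ∃[ logN ] ∃[ loglogN ] Σ[ denom#0 ∈ (fromℕ 2 * loglogN) # 0# ] ∃[ s ]
      IsLog (fromℕ N) logN ×
      IsLog logN loglogN ×
      IsRoot 2 (logN / (fromℕ 2 * loglogN) ⟨ denom#0 ⟩) s ×
      t ≈ (1# - γ) * s

  -- r is the d-th root of (1 - ε) / 2ᵈ · log N / Nᵈ⁻¹
  IsProbThreshold : (ε : Carrier) (N : ℕ) → .{{NonZero N}} →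
                    (d : ℕ) (r : Carrier) → Set (c ⊔ ℓ₁ ⊔ ℓ₂)
  IsProbThreshold ε N d r = ∃[ logN ]
    IsLog (fromℕ N) logN ×
    IsRoot d (((1# - ε) /ℕ (2 ℕ.^ d)) * (logN /ℕ (N ℕ.^ (d ∸ 1)))) r
    where instance
      2^d≢0 : NonZero (2 ℕ.^ d)
      2^d≢0 = m^n≢0 2 d
      N^[d-1]≢0 : NonZero (N ℕ.^ (d ∸ 1))
      N^[d-1]≢0 = m^n≢0 N (d ∸ 1)

subsets : ∀ n → List (Subset n)
subsets zero    = [] ∷ []
subsets (suc n) = map (inside ∷_) (subsets n) ++ map (outside ∷_) (subsets n)

module RandomSubset {c ℓ₁ ℓ₂} (ℝ : CompleteOrderedField c ℓ₁ ℓ₂) where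
  open CompleteOrderedField ℝ

  weight : ∀ {n} → Carrier → Subset n → Carrier
  weight {n} p S = product {n} λ i → if lookup S i then p else 1# - p

  Pr : ∀ {n a} {A : Pred (Subset n) a} → Carrier → Decidable₁ A → Carrier
  Pr {n} p A? = foldr _+_ 0# (map (weight p) (filter A? (subsets n)))

module GraphDistance {v e a} {V : Set v} (_≈_ : Rel V e) (_~_ : Rel V a) where

  data Walk : ℕ → Rel V (v ⊔ e ⊔ a) where
    nil  : ∀ {x y} → x ≈ y → Walk zero x y
    cons : ∀ {k x y z} → x ~ y → Walk k y z → Walk (suc k) x z

  IsDistance : V → V → ℕ → Set (v ⊔ e ⊔ a)
  IsDistance x y k = Walk k x y × (∀ {j} → j ℕ.< k → ¬ Walk j x y)

  -- The diameter is at most d. Vertices joined by no walk have no finite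
  -- distance, so this fails for disconnected graphs.
  Diameter≤ : ℕ → Set (v ⊔ e ⊔ a)
  Diameter≤ d = ∀ x y → ∃[ k ] (k ℕ.≤ d × IsDistance x y k)

HasOrder : ∀ {g ℓ} → Group g ℓ → ℕ → Set (g ⊔ ℓ)
HasOrder G N = Inverse (Group.setoid G) (≡.setoid (Fin N))

module Cayley {g ℓ} (G : Group g ℓ) {N : ℕ} (order : HasOrder G N) where
  open Group G
  open Inverse order using (to; from; to-cong; strictlyInverseʳ)

  -- Subsets of G are given through its enumeration by Fin N.
  infix 4 _∈G_
  _∈G_ : Carrier → Subset N → Set
  x ∈G S = to x ∈ S

  Edge : Subset N → Rel Carrier ℓ
  Edge S x y = ¬ (x ≈ y) × (x ⁻¹ ∙ y ∈G S ⊎ y ⁻¹ ∙ x ∈G S)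

  module _ (S : Subset N) where
    open GraphDistance _≈_ (Edge S) public

  _≈?_ : Decidable _≈_
  _≈?_ = inj⇒≟ (Inverse⇒Injection order)

  edge? : ∀ S → Decidable (Edge S)
  edge? S x y =
    ¬? (x ≈? y) ×-dec ((to (x ⁻¹ ∙ y) ∈? S) ⊎-dec (to (y ⁻¹ ∙ x) ∈? S))

  edge-respʳ : ∀ {S x y z} → y ≈ z → Edge S x y → Edge S x z
  edge-respʳ {S} y≈z (x≉y , e) =
    (λ x≈z → x≉y (trans x≈z (sym y≈z))) ,
    Sum.map (≡.subst (_∈ S) (to-cong (∙-congˡ y≈z)))
            (≡.subst (_∈ S) (to-cong (∙-congʳ (⁻¹-cong y≈z)))) e

  edge-respˡ : ∀ {S x y z} → x ≈ y → Edge S x z → Edge S y z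
  edge-respˡ {S} x≈y (x≉z , e) =
    (λ y≈z → x≉z (trans x≈y y≈z)) ,
    Sum.map (≡.subst (_∈ S) (to-cong (∙-congʳ (⁻¹-cong x≈y))))
            (≡.subst (_∈ S) (to-cong (∙-congˡ x≈y))) e

  walk-respˡ : ∀ {S k x y z} → x ≈ y → Walk S k x z → Walk S k y z
  walk-respˡ x≈y (GraphDistance.nil x≈z)    =
    GraphDistance.nil (trans (sym x≈y) x≈z)
  walk-respˡ x≈y (GraphDistance.cons x~w w) =
    GraphDistance.cons (edge-respˡ x≈y x~w) w

  walk-respʳ : ∀ {S k x y z} → y ≈ z → Walk S k x y → Walk S k x z
  walk-respʳ y≈z (GraphDistance.nil x≈y)    = GraphDistance.nil (trans x≈y y≈z)
  walk-respʳ y≈z (GraphDistance.cons x~w w) =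
    GraphDistance.cons x~w (walk-respʳ y≈z w)

  walk? : ∀ S k → Decidable (Walk S k)
  walk? S zero    x y = map′ GraphDistance.nil
    (λ { (GraphDistance.nil x≈y) → x≈y }) (x ≈? y)
  walk? S (suc k) x y = map′
    (λ { (_ , x~z , w) → GraphDistance.cons x~z w })
    (λ { (GraphDistance.cons {y = z} x~z w) → to z ,
         edge-respʳ (sym (strictlyInverseʳ z)) x~z ,
         walk-respˡ (sym (strictlyInverseʳ z)) w })
    (any? λ i → edge? S x (from i) ×-dec walk? S k (from i) y)

  isDistance? : ∀ S x y → Decidable₁ (IsDistance S x y)
  isDistance? S x y k =
    walk? S k x y ×-dec allUpTo? (λ j → ¬? (walk? S j x y)) k

  isDistance-resp : ∀ {S x x′ y y′ k} → x ≈ x′ → y ≈ y′ →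
                    IsDistance S x y k → IsDistance S x′ y′ k
  isDistance-resp x≈x′ y≈y′ (w , shortest) =
    walk-respʳ y≈y′ (walk-respˡ x≈x′ w) ,
    λ j<k w′ → shortest j<k (walk-respʳ (sym y≈y′) (walk-respˡ (sym x≈x′) w′))

  diameter≤? : ∀ d → Decidable₁ (λ S → Diameter≤ S d)
  diameter≤? d S = map′ onG onFin (all? λ i → all? λ j →
    anyUpTo? (isDistance? S (from i) (from j)) (suc d))
    where
    OnFin : Set _
    OnFin = ∀ i j → ∃[ k ] (k ℕ.< suc d × IsDistance S (from i) (from j) k)

    onG : OnFin → Diameter≤ S d
    onG h x y with h (to x) (to y)
    ... | k , k<1+d , dist = k , s≤s⁻¹ k<1+d ,
      isDistance-resp (strictlyInverseʳ x) (strictlyInverseʳ y) dist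

    onFin : Diameter≤ S d → OnFin
    onFin h i j with h (from i) (from j)
    ... | k , k≤d , dist = k , s≤s k≤d , dist

{-# OPTIONS --safe #-}

-- Second moment method. Call a word of length d in the letters s and s⁻¹ generic
-- if its letters are distinct, and degenerate if it is shorter or repeats a letter.
-- Let f x be the indicator that no generic word of value x has all its letters in S.
-- For decreasing events of this kind Harris' inequality gives
-- E (f x) ≥ (1 - pᵈ)ⁿ ≈ N^(ε - 1), n = 2ᵈ Nᵈ⁻¹ being the number of words of value x,
-- and a sharpening of it bounds the correlation of f x and f y by the expected number
-- of pairs of words of values x and y that share a letter. The second of these words
-- either has a letter outside the first, and such pairs are rare for every x and y,
-- or is a rearrangement of it, which happens for few y. Degenerate words reach only few
-- elements in expectation; restricting to the elements x that they rarely reach,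
-- Chebyshev's inequality shows that some x is reached by no word of length at most d.
-- The bound on d enters as (log N)^(d²) ≤ N.

module Submission where

open import Defs
open import Algebra.Bundles using (CommutativeRing; Group)
import Algebra.Properties.CommutativeSemiring.Exp as CommutativeExpProperties
import Algebra.Properties.Group as GroupProperties
import Algebra.Properties.Ring as RingProperties
import Algebra.Properties.Semiring.Exp as ExpProperties
import Algebra.Properties.Semiring.Mult as MultProperties
import Algebra.Solver.Ring as RingSolver
open import Algebra.Solver.Ring.AlmostCommutativeRing
  using (AlmostCommutativeRing; fromCommutativeRing; _-Raw-AlmostCommutative⟶_)
open import Data.Bool.Base using (Bool; true; false; if_then_else_)
open import Data.Bool.Properties using (∨-zeroʳ)
open import Data.Empty using (⊥; ⊥-elim)
open import Data.Fin.Base using (Fin; zero; suc; toℕ)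
open import Data.Fin.Properties using (_≟_; suc-injective)
open import Data.Fin.Subset using (Subset; inside; outside; _∈_; _∉_; _⊆_; _∪_)
  renaming (⊥ to ∅)
open import Data.Fin.Subset.Properties
  using (∪-identityʳ; ∉⊥; s⊆s; out⊆; drop-∷-⊆; _∈?_)
open import Data.Integer.Base as ℤ using (ℤ)
import Data.Integer.Properties as ℤ
open import Data.List.Base
  using (List; []; _∷_; _++_; map; filter; foldr; length; concatMap; allFin; tabulate)
open import Data.List.Membership.Propositional using () renaming (_∈_ to _∈ᴸ_)
open import Data.List.Membership.Propositional.Properties
  using (∈-map⁺; ∈-filter⁺; ∈-++⁺ˡ; ∈-++⁺ʳ; ∈-allFin; ∈-concat⁺′)
open import Data.List.Properties using (length-tabulate)
open import Data.List.Relation.Unary.All as All using (All; []; _∷_)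
import Data.List.Relation.Unary.All.Properties as Allₚ
import Data.List.Relation.Unary.Any as Any
open import Data.Maybe.Base using (Maybe; just; nothing)
open import Data.Nat.Base as ℕ using (ℕ; zero; suc; NonZero; _!)
import Data.Nat.Properties as ℕ
open import Data.Nat.Solver using (module +-*-Solver)
open import Data.Product.Base using (∃-syntax; _×_; _,_; proj₁; proj₂)
open import Data.Sum.Base using (_⊎_; inj₁; inj₂; [_,_]′)
open import Data.Unit.Base using (⊤; tt)
open import Data.Vec.Base using (Vec; []; _∷_; lookup; here; there; _[_]≔_)
open import Function.Base using (_∘_)
open import Function.Bundles using (Inverse)
open import Level using (Level)
open import Relation.Binary.PropositionalEquality as ≡ using (_≡_)
import Relation.Binary.Reasoning.Setoid as SetoidReasoning
open import Relation.Binary.Structures using (IsStrictPartialOrder)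
open import Relation.Nullary using (¬_; Dec; yes; no; ¬?; _×-dec_)
open import Relation.Unary using (Pred) renaming (Decidable to Decidable₁)

-- Two phenomena defeat an estimate uniform in the group elements. In a group of exponent 2 every
-- word s s has the identity as value, so the expected number of degenerate words can only be
-- bounded on average over x; this is why some x are discarded. And words that permute each other's
-- letters occur together, so for such pairs E (f x f y) is merely bounded by E (f x). They are
-- affordable because a word has at most (2d)^d such partners, whereas the sum of the E (f x) is at
-- least of order exp (ε log N / 2); this is where ε is spent. The remaining correlation error is a
-- small multiple of E (f x f y) itself and is absorbed on the left. The order is constructive.
-- Since `≤` is a negation, an inequality may be proved by cases, but a real number cannot be tested
-- against a bound, so selecting the good x takes two thresholds. Logarithms are given only by the
-- relation exp L = N, so their sign and uniqueness have to be proved.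

module OrderedField {c ℓ₁ ℓ₂} (ℝ : CompleteOrderedField c ℓ₁ ℓ₂) where
  open CompleteOrderedField ℝ public hiding (zero)
  open RealAnalysis ℝ public using (0<1; 0<fromℕ[1+n])
  open IsStrictPartialOrder <-isStrictPartialOrder public
    using (<-respˡ-≈; <-respʳ-≈)
    renaming (trans to <-trans; irrefl to <-irrefl; asym to <-asym)
  open RingProperties ring public
    using (-0#≈0#; -‿involutive; -‿distribˡ-*; -‿distribʳ-*; -‿+-comm)
  open CommutativeRing commutativeRing public using (commutativeSemiring)
  open ExpProperties semiring public using (^-congˡ; ^-homo-*; ^-assocʳ)
  open CommutativeExpProperties commutativeSemiring public using (^-distrib-*)
  open MultProperties semiring public using (×-homo-+; ×1-homo-*)

  -- The ring solver with integer coefficients.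

  private
    almostCommutativeRing : AlmostCommutativeRing c ℓ₁
    almostCommutativeRing = fromCommutativeRing commutativeRing

    -- The numeral 1 is sent to `1#` itself and not to `1# + 0#`, so that constants in solver
    -- equations unfold to the expected terms. `fromℕ 2` is `1# + (1# + 0#)`, which is why solver
    -- equations spell it as a nested sum.
    fromℤ : ℤ → Carrier
    fromℤ (ℤ.+ zero)  = 0#
    fromℤ (ℤ.+ suc n) = pos n
      where
      pos : ℕ → Carrier
      pos zero    = 1#
      pos (suc n) = pos n + 1#
    fromℤ ℤ.-[1+ n ] = - fromℤ (ℤ.+ suc n)

    fromℤ-+ : ∀ n → fromℤ (ℤ.+ n) ≈ n · 1#
    fromℤ-+ zero          = refl
    fromℤ-+ (suc zero)    = sym (+-identityʳ 1#)
    fromℤ-+ (suc (suc n)) = trans (+-congʳ (fromℤ-+ (suc n))) (+-comm _ _)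

    fromℤ-suc : ∀ n → fromℤ (ℤ.+ suc n) ≈ fromℤ (ℤ.+ n) + 1#
    fromℤ-suc zero    = sym (+-identityˡ 1#)
    fromℤ-suc (suc n) = refl

    cancel-1 : ∀ a b → a - b ≈ (a + 1#) - (b + 1#)
    cancel-1 a b = sym (begin
      (a + 1#) - (b + 1#)        ≈⟨ +-congˡ (sym (-‿+-comm b 1#)) ⟩
      (a + 1#) + (- b + - 1#)    ≈⟨ +-assoc _ _ _ ⟩
      a + (1# + (- b + - 1#))    ≈⟨ +-congˡ (+-congˡ (+-comm _ _)) ⟩
      a + (1# + (- 1# + - b))    ≈⟨ +-congˡ (sym (+-assoc _ _ _)) ⟩
      a + ((1# + - 1#) + - b)    ≈⟨ +-congˡ (+-congʳ (-‿inverseʳ 1#)) ⟩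
      a + (0# + - b)             ≈⟨ +-congˡ (+-identityˡ _) ⟩
      a - b                      ∎)
      where open SetoidReasoning (CommutativeRing.setoid commutativeRing)

    fromℤ-⊖ : ∀ m n → fromℤ (m ℤ.⊖ n) ≈ fromℤ (ℤ.+ m) - fromℤ (ℤ.+ n)
    fromℤ-⊖ m zero = trans (sym (+-identityʳ _)) (+-congˡ (sym -0#≈0#))
    fromℤ-⊖ zero (suc n) = sym (+-identityˡ _)
    fromℤ-⊖ (suc m) (suc n) =
      trans (reflexive (≡.cong fromℤ (ℤ.[1+m]⊖[1+n]≡m⊖n m n)))
      (trans (fromℤ-⊖ m n)
      (trans (cancel-1 _ _) (+-cong (sym (fromℤ-suc m)) (-‿cong (sym (fromℤ-suc n))))))

    fromℤ-homo-+ : ∀ i j → fromℤ (i ℤ.+ j) ≈ fromℤ i + fromℤ j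
    fromℤ-homo-+ (ℤ.+ m) (ℤ.+ n) =
      trans (fromℤ-+ (m ℕ.+ n)) (trans (×-homo-+ 1# m n)
        (+-cong (sym (fromℤ-+ m)) (sym (fromℤ-+ n))))
    fromℤ-homo-+ (ℤ.+ m) ℤ.-[1+ n ] = fromℤ-⊖ m (suc n)
    fromℤ-homo-+ ℤ.-[1+ m ] (ℤ.+ n) = trans (fromℤ-⊖ n (suc m)) (+-comm _ _)
    fromℤ-homo-+ ℤ.-[1+ m ] ℤ.-[1+ n ] =
      trans (-‿cong (trans (reflexive (≡.cong (λ k → fromℤ (ℤ.+ suc k)) (≡.sym (ℕ.+-suc m n))))
        (fromℤ-homo-+ (ℤ.+ suc m) (ℤ.+ suc n))))
      (sym (-‿+-comm _ _))

    fromℤ-neg : ∀ i → fromℤ (ℤ.- i) ≈ - fromℤ i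
    fromℤ-neg (ℤ.+ zero)  = sym -0#≈0#
    fromℤ-neg (ℤ.+ suc n) = refl
    fromℤ-neg ℤ.-[1+ n ]  = sym (-‿involutive _)

    fromℤ-+* : ∀ m n → fromℤ (ℤ.+ m ℤ.* ℤ.+ n) ≈ fromℤ (ℤ.+ m) * fromℤ (ℤ.+ n)
    fromℤ-+* m n =
      trans (reflexive (≡.cong fromℤ (≡.sym (ℤ.pos-* m n))))
      (trans (fromℤ-+ (m ℕ.* n))
      (trans (×1-homo-* m n) (*-cong (sym (fromℤ-+ m)) (sym (fromℤ-+ n)))))

    fromℤ-homo-* : ∀ i j → fromℤ (i ℤ.* j) ≈ fromℤ i * fromℤ j
    fromℤ-homo-* (ℤ.+ m) (ℤ.+ n) = fromℤ-+* m n
    fromℤ-homo-* (ℤ.+ m) ℤ.-[1+ n ] =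
      trans (reflexive (≡.cong fromℤ (≡.sym (ℤ.neg-distribʳ-* (ℤ.+ m) (ℤ.+ suc n)))))
      (trans (fromℤ-neg (ℤ.+ m ℤ.* ℤ.+ suc n))
      (trans (-‿cong (fromℤ-+* m (suc n))) (-‿distribʳ-* _ _)))
    fromℤ-homo-* ℤ.-[1+ m ] (ℤ.+ n) =
      trans (reflexive (≡.cong fromℤ (≡.sym (ℤ.neg-distribˡ-* (ℤ.+ suc m) (ℤ.+ n)))))
      (trans (fromℤ-neg (ℤ.+ suc m ℤ.* ℤ.+ n))
      (trans (-‿cong (fromℤ-+* (suc m) n)) (-‿distribˡ-* _ _)))
    fromℤ-homo-* ℤ.-[1+ m ] ℤ.-[1+ n ] =
      trans (fromℤ-+* (suc m) (suc n))
      (trans (sym (-‿involutive _))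
      (trans (-‿cong (-‿distribˡ-* _ _)) (-‿distribʳ-* _ _)))

    ℤ-morphism : ℤ.+-*-rawRing -Raw-AlmostCommutative⟶ almostCommutativeRing
    ℤ-morphism = record
      { ⟦_⟧    = fromℤ
      ; +-homo = fromℤ-homo-+
      ; *-homo = fromℤ-homo-*
      ; -‿homo = fromℤ-neg
      ; 0-homo = refl
      ; 1-homo = refl
      }

    _coeff≟_ : ∀ i j → Maybe (fromℤ i ≈ fromℤ j)
    i coeff≟ j with i ℤ.≟ j
    ... | yes ≡.refl = just refl
    ... | no  _      = nothing

  open RingSolver ℤ.+-*-rawRing almostCommutativeRing ℤ-morphism _coeff≟_ public
    using (solve; _:=_; _:+_; _:*_; _:-_; :-_; _:^_; con)

  -- Constructive arithmetic of inequalities.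

  <-cotrans : ∀ {x y} → x < y → ∀ z → x < z ⊎ z < y
  <-cotrans {x} {y} x<y z with #-cotrans (<⊎>⇒# (inj₁ x<y)) z
  ... | inj₁ x#z = [ inj₁ , (λ z<x → inj₂ (<-trans z<x x<y)) ]′ (#⇒<⊎> x#z)
  ... | inj₂ z#y = [ inj₂ , (λ y<z → inj₁ (<-trans x<y y<z)) ]′ (#⇒<⊎> z#y)

  <⇒≤ : ∀ {x y} → x < y → x ≤ y
  <⇒≤ = <-asym

  ≤-reflexive : ∀ {x y} → x ≈ y → x ≤ y
  ≤-reflexive x≈y = <-irrefl (sym x≈y)

  ≤-refl : ∀ {x} → x ≤ x
  ≤-refl = ≤-reflexive refl

  <-≤-trans : ∀ {x y z} → x < y → y ≤ z → x < z
  <-≤-trans {z = z} x<y y≤z = [ (λ x<z → x<z) , (λ z<y → ⊥-elim (y≤z z<y)) ]′ (<-cotrans x<y z)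

  ≤-<-trans : ∀ {x y z} → x ≤ y → y < z → x < z
  ≤-<-trans {x} x≤y y<z = [ (λ y<x → ⊥-elim (x≤y y<x)) , (λ x<z → x<z) ]′ (<-cotrans y<z x)

  ≤-trans : ∀ {x y z} → x ≤ y → y ≤ z → x ≤ z
  ≤-trans x≤y y≤z z<x = y≤z (<-≤-trans z<x x≤y)

  ≤-antisym : ∀ {x y} → x ≤ y → y ≤ x → x ≈ y
  ≤-antisym x≤y y≤x = proj₁ (tight _ _) (λ x#y → [ y≤x , x≤y ]′ (#⇒<⊎> x#y))

  -- The order of `x` and `y` is undecided, but the goal is a negation: from `z < w` the second case
  -- refutes `y < x`, which is exactly the premise of the first case.
  ≤-by-cases : ∀ {w z} x y → (x ≤ y → w ≤ z) → (y ≤ x → w ≤ z) → w ≤ z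
  ≤-by-cases x y f g z<w = f (λ y<x → g (<⇒≤ y<x) z<w) z<w

  ≤-resp : ∀ {x x′ y y′} → x ≈ x′ → y ≈ y′ → x ≤ y → x′ ≤ y′
  ≤-resp x≈x′ y≈y′ x≤y = ≤-trans (≤-reflexive (sym x≈x′)) (≤-trans x≤y (≤-reflexive y≈y′))

  <-resp : ∀ {x x′ y y′} → x ≈ x′ → y ≈ y′ → x < y → x′ < y′
  <-resp x≈x′ y≈y′ x<y = <-respʳ-≈ y≈y′ (<-respˡ-≈ x≈x′ x<y)

  +-cancelʳ-< : ∀ {x y} z → x + z < y + z → x < y
  +-cancelʳ-< {x} {y} z h = <-resp (lemma x) (lemma y) (+-monoˡ-< (- z) h)
    where
    lemma : ∀ x → (x + z) - z ≈ x
    lemma x = solve 2 (λ x z → (x :+ z) :- z := x) refl x z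

  +-monoˡ-≤ : ∀ {x y} z → x ≤ y → x + z ≤ y + z
  +-monoˡ-≤ z x≤y h = x≤y (+-cancelʳ-< z h)

  +-mono-≤ : ∀ {x y u v} → x ≤ y → u ≤ v → x + u ≤ y + v
  +-mono-≤ {x} {y} {u} {v} x≤y u≤v = ≤-trans (+-monoˡ-≤ u x≤y)
    (≤-resp (+-comm _ _) (+-comm _ _) (+-monoˡ-≤ y u≤v))

  +-monoʳ-≤ : ∀ {x y} z → x ≤ y → z + x ≤ z + y
  +-monoʳ-≤ z = +-mono-≤ ≤-refl

  x<y⇒0<y-x : ∀ {x y} → x < y → 0# < y - x
  x<y⇒0<y-x {x} x<y = <-respˡ-≈ (-‿inverseʳ x) (+-monoˡ-< (- x) x<y)

  0<y-x⇒x<y : ∀ {x y} → 0# < y - x → x < y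
  0<y-x⇒x<y {x} {y} h = <-resp (+-identityˡ x)
    (solve 2 (λ x y → (y :- x) :+ x := y) refl x y) (+-monoˡ-< x h)

  x≤y⇒0≤y-x : ∀ {x y} → x ≤ y → 0# ≤ y - x
  x≤y⇒0≤y-x {x} x≤y = ≤-resp (-‿inverseʳ x) refl (+-monoˡ-≤ (- x) x≤y)

  ≤-by : ∀ {x y} d → y ≈ x + d → 0# ≤ d → x ≤ y
  ≤-by {x} d y≈x+d 0≤d = ≤-resp (+-identityʳ x) (sym y≈x+d) (+-monoʳ-≤ x 0≤d)

  +-nonneg : ∀ {x y} → 0# ≤ x → 0# ≤ y → 0# ≤ x + y
  +-nonneg 0≤x 0≤y = ≤-resp (+-identityˡ 0#) refl (+-mono-≤ 0≤x 0≤y)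

  neg-pos : ∀ {x} → x < 0# → 0# < - x
  neg-pos {x} x<0 = <-respʳ-≈ (+-identityˡ (- x)) (x<y⇒0<y-x x<0)

  neg-≤ : ∀ {x y} → x ≤ y → - y ≤ - x
  neg-≤ {x} {y} x≤y = ≤-by (y - x) (solve 2 (λ x y → :- x := :- y :+ (y :- x)) refl x y) (x≤y⇒0≤y-x x≤y)

  neg-nonneg : ∀ {x} → x ≤ 0# → 0# ≤ - x
  neg-nonneg x≤0 = ≤-resp -0#≈0# refl (neg-≤ x≤0)

  private
    x-0≈x : ∀ x → x - 0# ≈ x
    x-0≈x x = solve 1 (λ x → x :- con (ℤ.+ 0) := x) refl x

    *-#0ˡ : ∀ {x y} → x * y # 0# → x # 0#
    *-#0ˡ {x} {y} xy#0 with #⇒invertible xy#0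
    ... | z , zxy≈1 , xyz≈1 = invertible⇒# (y * z ,
      trans (solve 3 (λ x y z → (y :* z) :* (x :- con (ℤ.+ 0)) := z :* (x :* y :- con (ℤ.+ 0))) refl x y z) zxy≈1 ,
      trans (solve 3 (λ x y z → (x :- con (ℤ.+ 0)) :* (y :* z) := (x :* y :- con (ℤ.+ 0)) :* z) refl x y z) xyz≈1)

  -- A negative product is apart from zero, hence invertible, hence so are both factors. Only then
  -- are the signs of the factors decided.
  *-nonneg : ∀ {x y} → 0# ≤ x → 0# ≤ y → 0# ≤ x * y
  *-nonneg {x} {y} 0≤x 0≤y xy<0
    with #⇒<⊎> (*-#0ˡ (<⊎>⇒# (inj₁ xy<0)))
       | #⇒<⊎> (*-#0ˡ (<⊎>⇒# (inj₁ (<-respˡ-≈ (*-comm x y) xy<0))))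
  ... | inj₁ x<0 | _        = 0≤x x<0
  ... | inj₂ _   | inj₁ y<0 = 0≤y y<0
  ... | inj₂ 0<x | inj₂ 0<y = <-asym (*-pos 0<x 0<y) xy<0

  0≤1 : 0# ≤ 1#
  0≤1 = <⇒≤ 0<1

  *-monoˡ-≤ : ∀ {x y z} → 0# ≤ z → x ≤ y → x * z ≤ y * z
  *-monoˡ-≤ {x} {y} {z} 0≤z x≤y = ≤-by ((y - x) * z)
    (solve 3 (λ x y z → y :* z := x :* z :+ (y :- x) :* z) refl x y z)
    (*-nonneg (x≤y⇒0≤y-x x≤y) 0≤z)

  *-monoʳ-≤ : ∀ {x y z} → 0# ≤ z → x ≤ y → z * x ≤ z * y
  *-monoʳ-≤ 0≤z x≤y = ≤-resp (*-comm _ _) (*-comm _ _) (*-monoˡ-≤ 0≤z x≤y)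

  *-mono-≤ : ∀ {x y u v} → 0# ≤ x → 0# ≤ u → x ≤ y → u ≤ v → x * u ≤ y * v
  *-mono-≤ 0≤x 0≤u x≤y u≤v = ≤-trans (*-monoˡ-≤ 0≤u x≤y) (*-monoʳ-≤ (≤-trans 0≤x x≤y) u≤v)

  *-monoˡ-< : ∀ {x y z} → 0# < z → x < y → x * z < y * z
  *-monoˡ-< {x} {y} {z} 0<z x<y = 0<y-x⇒x<y (<-respʳ-≈
    (solve 3 (λ x y z → (y :- x) :* z := y :* z :- x :* z) refl x y z)
    (*-pos (x<y⇒0<y-x x<y) 0<z))

  *-monoʳ-< : ∀ {x y z} → 0# < z → x < y → z * x < z * y
  *-monoʳ-< 0<z x<y = <-resp (*-comm _ _) (*-comm _ _) (*-monoˡ-< 0<z x<y)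

  *-cancelʳ-≤ : ∀ {x y z} → 0# < z → x * z ≤ y * z → x ≤ y
  *-cancelʳ-≤ 0<z h y<x = h (*-monoˡ-< 0<z y<x)

  x²-nonneg : ∀ x → 0# ≤ x * x
  x²-nonneg x = ≤-by-cases 0# x
    (λ 0≤x → *-nonneg 0≤x 0≤x)
    (λ x≤0 → ≤-resp refl (solve 1 (λ x → (:- x) :* (:- x) := x :* x) refl x)
               (*-nonneg (neg-nonneg x≤0) (neg-nonneg x≤0)))

  fromℕ-+ : ∀ m n → fromℕ (m ℕ.+ n) ≈ fromℕ m + fromℕ n
  fromℕ-+ = ×-homo-+ 1#

  fromℕ-* : ∀ m n → fromℕ (m ℕ.* n) ≈ fromℕ m * fromℕ n
  fromℕ-* = ×1-homo-*

  fromℕ-nonneg : ∀ n → 0# ≤ fromℕ n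
  fromℕ-nonneg zero    = ≤-refl
  fromℕ-nonneg (suc n) = <⇒≤ (0<fromℕ[1+n] n)

  fromℕ-mono-≤ : ∀ {m n} → m ℕ.≤ n → fromℕ m ≤ fromℕ n
  fromℕ-mono-≤ {m} {n} m≤n = ≤-by (fromℕ (n ℕ.∸ m))
    (trans (reflexive (≡.cong fromℕ (≡.sym (ℕ.m+[n∸m]≡n m≤n)))) (fromℕ-+ m (n ℕ.∸ m)))
    (fromℕ-nonneg (n ℕ.∸ m))

  fromℕ-mono-< : ∀ {m n} → m ℕ.< n → fromℕ m < fromℕ n
  fromℕ-mono-< {m} {n} m<n = <-≤-trans
    (<-respˡ-≈ (+-identityˡ (fromℕ m)) (+-monoˡ-< (fromℕ m) 0<1)) (fromℕ-mono-≤ m<n)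

  fromℕ-cancel-≤ : ∀ {m n} → fromℕ m ≤ fromℕ n → m ℕ.≤ n
  fromℕ-cancel-≤ {m} {n} h with m ℕ.≤? n
  ... | yes m≤n = m≤n
  ... | no  m≰n = ⊥-elim (h (fromℕ-mono-< (ℕ.≰⇒> m≰n)))

  1≤fromℕ : ∀ {n} → 1 ℕ.≤ n → 1# ≤ fromℕ n
  1≤fromℕ 1≤n = ≤-resp (+-identityʳ 1#) refl (fromℕ-mono-≤ 1≤n)

  fromℕ-^ : ∀ m n → fromℕ (m ℕ.^ n) ≈ fromℕ m ^ n
  fromℕ-^ m zero    = +-identityʳ 1#
  fromℕ-^ m (suc n) = trans (fromℕ-* m (m ℕ.^ n)) (*-congˡ (fromℕ-^ m n))

  ^-nonneg : ∀ {x} n → 0# ≤ x → 0# ≤ x ^ n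
  ^-nonneg zero    0≤x = 0≤1
  ^-nonneg (suc n) 0≤x = *-nonneg 0≤x (^-nonneg n 0≤x)

  ^-pos : ∀ {x} n → 0# < x → 0# < x ^ n
  ^-pos zero    0<x = 0<1
  ^-pos (suc n) 0<x = *-pos 0<x (^-pos n 0<x)

  ^-monoˡ-≤ : ∀ {x y} n → 0# ≤ x → x ≤ y → x ^ n ≤ y ^ n
  ^-monoˡ-≤ zero    0≤x x≤y = ≤-refl
  ^-monoˡ-≤ (suc n) 0≤x x≤y = *-mono-≤ 0≤x (^-nonneg n 0≤x) x≤y (^-monoˡ-≤ n 0≤x x≤y)

  1≤^ : ∀ {x} n → 1# ≤ x → 1# ≤ x ^ n
  1≤^ zero    1≤x = ≤-refl
  1≤^ (suc n) 1≤x = ≤-resp (*-identityˡ 1#) refl (*-mono-≤ 0≤1 0≤1 1≤x (1≤^ n 1≤x))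

  ^-monoʳ-≤ : ∀ {x m n} → 1# ≤ x → m ℕ.≤ n → x ^ m ≤ x ^ n
  ^-monoʳ-≤ {n = n} 1≤x ℕ.z≤n = 1≤^ n 1≤x
  ^-monoʳ-≤ 1≤x (ℕ.s≤s m≤n) = *-monoʳ-≤ (≤-trans 0≤1 1≤x) (^-monoʳ-≤ 1≤x m≤n)

  ^-≤1 : ∀ {x} n → 0# ≤ x → x ≤ 1# → x ^ n ≤ 1#
  ^-≤1 zero    0≤x x≤1 = ≤-refl
  ^-≤1 (suc n) 0≤x x≤1 = ≤-resp refl (*-identityˡ 1#) (*-mono-≤ 0≤x (^-nonneg n 0≤x) x≤1 (^-≤1 n 0≤x x≤1))

  ^-antimonoʳ-≤ : ∀ {x m n} → 0# ≤ x → x ≤ 1# → m ℕ.≤ n → x ^ n ≤ x ^ m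
  ^-antimonoʳ-≤ {n = n} 0≤x x≤1 ℕ.z≤n = ^-≤1 n 0≤x x≤1
  ^-antimonoʳ-≤ 0≤x x≤1 (ℕ.s≤s m≤n) = *-monoʳ-≤ 0≤x (^-antimonoʳ-≤ 0≤x x≤1 m≤n)

  ^-cong : ∀ {x y} n → x ≈ y → x ^ n ≈ y ^ n
  ^-cong n = ^-congˡ n

  ^-monoˡ-< : ∀ {x y} n → 0# ≤ x → x < y → x ^ suc n < y ^ suc n
  ^-monoˡ-< {x} {y} n 0≤x x<y = ≤-<-trans
    (*-monoʳ-≤ 0≤x (^-monoˡ-≤ n 0≤x (<⇒≤ x<y)))
    (*-monoˡ-< (^-pos n (≤-<-trans 0≤x x<y)) x<y)

  ^-cancel-≤ : ∀ {x y} n → 0# ≤ y → x ^ suc n ≤ y ^ suc n → x ≤ y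
  ^-cancel-≤ n 0≤y h y<x = h (^-monoˡ-< n 0≤y y<x)

  -- The inverse of y - 0#, which is the one used by _/_⟨_⟩.
  inverse : ∀ {y} → (y#0 : y # 0#) → y * proj₁ (#⇒invertible y#0) ≈ 1#
  inverse {y} y#0 with #⇒invertible y#0
  ... | z , _ , yz≈1 = trans (*-congʳ (sym (x-0≈x y))) yz≈1

  inverse-pos : ∀ {y z} → 0# < y → y * z ≈ 1# → 0# < z
  inverse-pos {y} {z} 0<y yz≈1 =
    [ (λ z<0 → ⊥-elim (<-asym 0<1
        (<-resp (trans (*-comm z y) yz≈1) (zeroˡ y) (*-monoˡ-< 0<y z<0)))) ,
      (λ 0<z → 0<z) ]′ (#⇒<⊎> (*-#0ˡ {z} {y} zy#0))
    where
    zy#0 : z * y # 0#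
    zy#0 = <⊎>⇒# (inj₂ (<-respʳ-≈ (trans (sym yz≈1) (*-comm y z)) 0<1))

  1/ : ∀ {x} → 0# < x → ∃[ y ] 0# < y × x * y ≈ 1#
  1/ {x} 0<x = _ , inverse-pos 0<x (inverse x#0) , inverse x#0
    where
    x#0 : x # 0#
    x#0 = <⊎>⇒# (inj₂ 0<x)

-- Finite sums over lists, and indicators.

module ListSum {c ℓ₁ ℓ₂} (ℝ : CompleteOrderedField c ℓ₁ ℓ₂) where
  open OrderedField ℝ

  ⟦_⟧ : ∀ {a} {A : Set a} → Dec A → Carrier
  ⟦ yes _ ⟧ = 1#
  ⟦ no  _ ⟧ = 0#

  ⟦⟧-nonneg : ∀ {a} {A : Set a} (A? : Dec A) → 0# ≤ ⟦ A? ⟧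
  ⟦⟧-nonneg (yes _) = 0≤1
  ⟦⟧-nonneg (no  _) = ≤-refl

  ⟦⟧-≤1 : ∀ {a} {A : Set a} (A? : Dec A) → ⟦ A? ⟧ ≤ 1#
  ⟦⟧-≤1 (yes _) = ≤-refl
  ⟦⟧-≤1 (no  _) = 0≤1

  ⟦⟧-mono : ∀ {a b} {A : Set a} {B : Set b} (A? : Dec A) (B? : Dec B) → (A → B) → ⟦ A? ⟧ ≤ ⟦ B? ⟧
  ⟦⟧-mono (no  _) B?      A→B = ⟦⟧-nonneg B?
  ⟦⟧-mono (yes a) (yes _) A→B = ≤-refl
  ⟦⟧-mono (yes a) (no ¬b) A→B = ⊥-elim (¬b (A→B a))

  module _ {a} {A : Set a} where

    Σ : List A → (A → Carrier) → Carrier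
    Σ []       f = 0#
    Σ (x ∷ xs) f = f x + Σ xs f

    Σ-cong : ∀ xs {f g : A → Carrier} → (∀ x → f x ≈ g x) → Σ xs f ≈ Σ xs g
    Σ-cong []       f≈g = refl
    Σ-cong (x ∷ xs) f≈g = +-cong (f≈g x) (Σ-cong xs f≈g)

    Σ-mono : ∀ xs {f g : A → Carrier} → (∀ x → f x ≤ g x) → Σ xs f ≤ Σ xs g
    Σ-mono []       f≤g = ≤-refl
    Σ-mono (x ∷ xs) f≤g = +-mono-≤ (f≤g x) (Σ-mono xs f≤g)

    Σ-nonneg : ∀ xs {f : A → Carrier} → (∀ x → 0# ≤ f x) → 0# ≤ Σ xs f
    Σ-nonneg []       0≤f = ≤-refl
    Σ-nonneg (x ∷ xs) 0≤f = +-nonneg (0≤f x) (Σ-nonneg xs 0≤f)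

    Σ-+ : ∀ xs (f g : A → Carrier) → Σ xs (λ x → f x + g x) ≈ Σ xs f + Σ xs g
    Σ-+ []       f g = sym (+-identityˡ 0#)
    Σ-+ (x ∷ xs) f g = trans (+-congˡ (Σ-+ xs f g))
      (solve 4 (λ a b c d → (a :+ b) :+ (c :+ d) := (a :+ c) :+ (b :+ d)) refl _ _ _ _)

    Σ-*ˡ : ∀ xs k (f : A → Carrier) → Σ xs (λ x → k * f x) ≈ k * Σ xs f
    Σ-*ˡ []       k f = sym (zeroʳ k)
    Σ-*ˡ (x ∷ xs) k f = trans (+-congˡ (Σ-*ˡ xs k f)) (sym (distribˡ k _ _))

    Σ-*ʳ : ∀ xs k (f : A → Carrier) → Σ xs (λ x → f x * k) ≈ Σ xs f * k
    Σ-*ʳ xs k f = trans (Σ-cong xs (λ x → *-comm (f x) k)) (trans (Σ-*ˡ xs k f) (*-comm k _))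

    Σ-zero : ∀ xs → Σ xs (λ _ → 0#) ≈ 0#
    Σ-zero []       = refl
    Σ-zero (x ∷ xs) = trans (+-identityˡ _) (Σ-zero xs)

    Σ-const : ∀ xs k → Σ xs (λ _ → k) ≈ fromℕ (length xs) * k
    Σ-const []       k = sym (zeroˡ k)
    Σ-const (x ∷ xs) k = trans (+-congˡ (Σ-const xs k))
      (solve 2 (λ n k → k :+ n :* k := (con (ℤ.+ 1) :+ n) :* k) refl (fromℕ (length xs)) k)

    Σ-++ : ∀ xs ys (f : A → Carrier) → Σ (xs ++ ys) f ≈ Σ xs f + Σ ys f
    Σ-++ []       ys f = sym (+-identityˡ _)
    Σ-++ (x ∷ xs) ys f = trans (+-congˡ (Σ-++ xs ys f)) (sym (+-assoc _ _ _))

    Σ-filter : ∀ {p} {P : Pred A p} (P? : Decidable₁ P) xs (f : A → Carrier) →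
               Σ (filter P? xs) f ≈ Σ xs (λ x → ⟦ P? x ⟧ * f x)
    Σ-filter P? []       f = refl
    Σ-filter P? (x ∷ xs) f with P? x
    ... | yes _ = +-cong (sym (*-identityˡ _)) (Σ-filter P? xs f)
    ... | no  _ = trans (Σ-filter P? xs f) (trans (sym (+-identityˡ _)) (+-congʳ (sym (zeroˡ _))))

  Σ-map : ∀ {a b} {A : Set a} {B : Set b} (h : A → B) xs (f : B → Carrier) →
          Σ (map h xs) f ≈ Σ xs (f ∘ h)
  Σ-map h []       f = refl
  Σ-map h (x ∷ xs) f = +-congˡ (Σ-map h xs f)

  Σ-swap : ∀ {a b} {A : Set a} {B : Set b} xs ys (f : A → B → Carrier) →
           Σ xs (λ x → Σ ys (f x)) ≈ Σ ys (λ y → Σ xs (λ x → f x y))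
  Σ-swap []       ys f = sym (Σ-zero ys)
  Σ-swap (x ∷ xs) ys f = trans (+-congˡ (Σ-swap xs ys f)) (sym (Σ-+ ys _ _))

  Σ-*-Σ : ∀ {a b} {A : Set a} {B : Set b} xs ys (f : A → Carrier) (g : B → Carrier) →
          Σ xs f * Σ ys g ≈ Σ xs (λ x → Σ ys (λ y → f x * g y))
  Σ-*-Σ xs ys f g = trans (sym (Σ-*ʳ xs _ f)) (Σ-cong xs (λ x → sym (Σ-*ˡ ys (f x) g)))

  Σ-allFin-suc : ∀ {n} (f : Fin (suc n) → Carrier) →
                 Σ (allFin (suc n)) f ≈ f zero + Σ (allFin n) (f ∘ suc)
  Σ-allFin-suc {n} f = +-congˡ (go n (λ i → i))
    where
    go : ∀ m (h : Fin m → Fin n) → Σ (tabulate (suc ∘ h)) f ≈ Σ (tabulate h) (f ∘ suc)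
    go zero    h = refl
    go (suc m) h = +-congˡ (go m (h ∘ suc))

-- Expectation over a random subset.

module Expectation
  {c ℓ₁ ℓ₂} (ℝ : CompleteOrderedField c ℓ₁ ℓ₂)
  (p : CompleteOrderedField.Carrier ℝ)
  where
  open OrderedField ℝ
  open ListSum ℝ
  open RandomSubset ℝ

  q : Carrier
  q = 1# - p

  -- Defined by conditioning on the first coordinate instead of summing over `subsets`: the
  -- correlation inequalities below are inductions of this shape. `Pr≈E` is the link to the
  -- probability in the theorem.
  E : ∀ {n} → (Subset n → Carrier) → Carrier
  E {zero}  f = f []
  E {suc n} f = p * E (λ S → f (inside ∷ S)) + q * E (λ S → f (outside ∷ S))

  E-cong : ∀ {n} {f g : Subset n → Carrier} → (∀ S → f S ≈ g S) → E f ≈ E g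
  E-cong {zero}  f≈g = f≈g []
  E-cong {suc n} f≈g = +-cong (*-congˡ (E-cong {n} (λ S → f≈g _))) (*-congˡ (E-cong {n} (λ S → f≈g _)))

  E-+ : ∀ {n} (f g : Subset n → Carrier) → E (λ S → f S + g S) ≈ E f + E g
  E-+ {zero}  f g = refl
  E-+ {suc n} f g = trans (+-cong (*-congˡ (E-+ {n} _ _)) (*-congˡ (E-+ {n} _ _)))
    (solve 6 (λ p q a b c d → p :* (a :+ b) :+ q :* (c :+ d) := (p :* a :+ q :* c) :+ (p :* b :+ q :* d))
      refl p q _ _ _ _)

  E-*ˡ : ∀ {n} k (f : Subset n → Carrier) → E (λ S → k * f S) ≈ k * E f
  E-*ˡ {zero}  k f = refl
  E-*ˡ {suc n} k f = trans (+-cong (*-congˡ (E-*ˡ {n} k _)) (*-congˡ (E-*ˡ {n} k _)))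
    (solve 5 (λ p q k a b → p :* (k :* a) :+ q :* (k :* b) := k :* (p :* a :+ q :* b)) refl p q k _ _)

  E-const : ∀ n k → E {n} (λ _ → k) ≈ k
  E-const zero    k = refl
  E-const (suc n) k = trans (+-cong (*-congˡ (E-const n k)) (*-congˡ (E-const n k)))
    (solve 2 (λ p k → p :* k :+ (con (ℤ.+ 1) :- p) :* k := k) refl p k)

  E-neg : ∀ {n} (f : Subset n → Carrier) → E (λ S → - f S) ≈ - E f
  E-neg {zero}  f = refl
  E-neg {suc n} f = trans (+-cong (*-congˡ (E-neg {n} _)) (*-congˡ (E-neg {n} _)))
    (solve 4 (λ p q a b → p :* (:- a) :+ q :* (:- b) := :- (p :* a :+ q :* b)) refl p q _ _)

  E-Σ : ∀ {n a} {A : Set a} (xs : List A) (f : A → Subset n → Carrier) →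
        E (λ S → Σ xs (λ x → f x S)) ≈ Σ xs (λ x → E (f x))
  E-Σ {n} []   f = E-const n 0#
  E-Σ {n} (x ∷ xs) f = trans (E-+ {n} _ _) (+-congˡ (E-Σ xs f))

  Pr≈E : ∀ {n a} {A : Pred (Subset n) a} (A? : Decidable₁ A) → Pr p A? ≈ E (λ S → ⟦ A? S ⟧)
  Pr≈E {n} A? = trans (foldr-Σ (filter A? (subsets n)))
    (trans (Σ-filter A? (subsets n) (weight p))
    (trans (Σ-cong (subsets n) (λ S → *-comm _ _)) (sum-subsets n (λ S → ⟦ A? S ⟧))))
    where
    foldr-Σ : ∀ (Ss : List (Subset n)) → foldr _+_ 0# (map (weight p) Ss) ≈ Σ Ss (weight p)
    foldr-Σ []       = refl
    foldr-Σ (S ∷ Ss) = +-congˡ (foldr-Σ Ss)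

    sum-subsets : ∀ n (f : Subset n → Carrier) → Σ (subsets n) (λ S → weight p S * f S) ≈ E f
    sum-subsets zero    f = trans (+-identityʳ _) (*-identityˡ _)
    sum-subsets (suc n) f = trans (Σ-++ (map (inside ∷_) (subsets n)) _ _)
      (+-cong (half inside p (λ S → refl)) (half outside q (λ S → refl)))
      where
      half : ∀ b k → (∀ S → weight p (b ∷ S) ≈ k * weight p S) →
             Σ (map (b ∷_) (subsets n)) (λ S → weight p S * f S) ≈ k * E (λ S → f (b ∷ S))
      half b k h = trans (Σ-map (b ∷_) (subsets n) _)
        (trans (Σ-cong (subsets n) (λ S → trans (*-congʳ (h S)) (*-assoc _ _ _)))
        (trans (Σ-*ˡ (subsets n) k _) (*-congˡ (sum-subsets n (λ S → f (b ∷ S))))))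

-- Harris' inequality and the correlation of avoidance events.

module Correlation
  {c ℓ₁ ℓ₂} (ℝ : CompleteOrderedField c ℓ₁ ℓ₂)
  (p : CompleteOrderedField.Carrier ℝ)
  (0≤p : CompleteOrderedField._≤_ ℝ (CompleteOrderedField.0# ℝ) p)
  (p≤1 : CompleteOrderedField._≤_ ℝ p (CompleteOrderedField.1# ℝ))
  where
  open OrderedField ℝ
  open ListSum ℝ
  open Expectation ℝ p

  0≤q : 0# ≤ q
  0≤q = x≤y⇒0≤y-x p≤1

  E-mono : ∀ {n} {f g : Subset n → Carrier} → (∀ S → f S ≤ g S) → E f ≤ E g
  E-mono {zero}  f≤g = f≤g []
  E-mono {suc n} f≤g = +-mono-≤ (*-monoʳ-≤ 0≤p (E-mono {n} (λ S → f≤g _)))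
                                (*-monoʳ-≤ 0≤q (E-mono {n} (λ S → f≤g _)))

  E-nonneg : ∀ {n} {f : Subset n → Carrier} → (∀ S → 0# ≤ f S) → 0# ≤ E f
  E-nonneg {n} 0≤f = ≤-resp (E-const n 0#) refl (E-mono 0≤f)

  Decreasing : ∀ {n} → (Subset n → Carrier) → Set ℓ₂
  Decreasing f = ∀ {S S′} → S ⊆ S′ → f S′ ≤ f S

  -- Conditioning on the first coordinate, the mean of the products exceeds the product of the means
  -- by `p q (a₀ - a₁) (b₀ - b₁)`, and both differences are nonnegative because `f` and `g`
  -- decrease.
  harris : ∀ {n} {f g : Subset n → Carrier} → Decreasing f → Decreasing g →
           E f * E g ≤ E (λ S → f S * g S)
  harris {zero}          f↓ g↓ = ≤-refl
  harris {suc n} {f} {g} f↓ g↓ = ≤-trans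
    (≤-by (p * q * ((a₀ - a₁) * (b₀ - b₁)))
      (solve 5 (λ p a₁ a₀ b₁ b₀ →
          p :* (a₁ :* b₁) :+ (con (ℤ.+ 1) :- p) :* (a₀ :* b₀) :=
          (p :* a₁ :+ (con (ℤ.+ 1) :- p) :* a₀) :* (p :* b₁ :+ (con (ℤ.+ 1) :- p) :* b₀)
            :+ p :* (con (ℤ.+ 1) :- p) :* ((a₀ :- a₁) :* (b₀ :- b₁)))
        refl p a₁ a₀ b₁ b₀)
      (*-nonneg (*-nonneg 0≤p 0≤q)
        (*-nonneg (x≤y⇒0≤y-x (E-mono {n} (λ S → f↓ (out⊆ (λ x → x)))))
                  (x≤y⇒0≤y-x (E-mono {n} (λ S → g↓ (out⊆ (λ x → x))))))))
    (+-mono-≤ (*-monoʳ-≤ 0≤p (harris {n} (λ h → f↓ (s⊆s h)) (λ h → g↓ (s⊆s h))))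
              (*-monoʳ-≤ 0≤q (harris {n} (λ h → f↓ (s⊆s h)) (λ h → g↓ (s⊆s h)))))
    where
    a₁ = E (λ S → f (inside ∷ S))
    a₀ = E (λ S → f (outside ∷ S))
    b₁ = E (λ S → g (inside ∷ S))
    b₀ = E (λ S → g (outside ∷ S))

  -- The indicator of `A ⊆ S`, made to compute as soon as the first coordinate is known.
  sub : ∀ {n} → Subset n → Subset n → Carrier
  sub []            []            = 1#
  sub (inside  ∷ A) (inside  ∷ S) = sub A S
  sub (inside  ∷ A) (outside ∷ S) = 0#
  sub (outside ∷ A) (_       ∷ S) = sub A S

  sub-nonneg : ∀ {n} (A S : Subset n) → 0# ≤ sub A S
  sub-nonneg []            []            = 0≤1
  sub-nonneg (inside  ∷ A) (inside  ∷ S) = sub-nonneg A S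
  sub-nonneg (inside  ∷ A) (outside ∷ S) = ≤-refl
  sub-nonneg (outside ∷ A) (_       ∷ S) = sub-nonneg A S

  sub-≤1 : ∀ {n} (A S : Subset n) → sub A S ≤ 1#
  sub-≤1 []            []            = ≤-refl
  sub-≤1 (inside  ∷ A) (inside  ∷ S) = sub-≤1 A S
  sub-≤1 (inside  ∷ A) (outside ∷ S) = 0≤1
  sub-≤1 (outside ∷ A) (_       ∷ S) = sub-≤1 A S

  ⊆⇒sub≈1 : ∀ {n} (A S : Subset n) → A ⊆ S → sub A S ≈ 1#
  ⊆⇒sub≈1 []            []            h = refl
  ⊆⇒sub≈1 (inside  ∷ A) (inside  ∷ S) h = ⊆⇒sub≈1 A S (drop-∷-⊆ h)
  ⊆⇒sub≈1 (inside  ∷ A) (outside ∷ S) h with h here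
  ... | ()
  ⊆⇒sub≈1 (outside ∷ A) (_       ∷ S) h = ⊆⇒sub≈1 A S (drop-∷-⊆ h)

  sub-mono : ∀ {n} (A : Subset n) {S S′} → S ⊆ S′ → sub A S ≤ sub A S′
  sub-mono []            {[]}          {[]}           h = ≤-refl
  sub-mono (inside  ∷ A) {inside  ∷ S} {inside  ∷ S′} h = sub-mono A (drop-∷-⊆ h)
  sub-mono (inside  ∷ A) {inside  ∷ S} {outside ∷ S′} h with h here
  ... | ()
  sub-mono (inside  ∷ A) {outside ∷ S} {S′}           h = sub-nonneg (inside ∷ A) S′
  sub-mono (outside ∷ A) {_       ∷ S} {_       ∷ S′} h = sub-mono A (drop-∷-⊆ h)

  π : ∀ {n} → Subset n → Carrier
  π []            = 1#
  π (inside  ∷ A) = p * π A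
  π (outside ∷ A) = π A

  π-nonneg : ∀ {n} (A : Subset n) → 0# ≤ π A
  π-nonneg []            = 0≤1
  π-nonneg (inside  ∷ A) = *-nonneg 0≤p (π-nonneg A)
  π-nonneg (outside ∷ A) = π-nonneg A

  π-≤1 : ∀ {n} (A : Subset n) → π A ≤ 1#
  π-≤1 []            = ≤-refl
  π-≤1 (inside  ∷ A) = ≤-resp refl (*-identityˡ 1#) (*-mono-≤ 0≤p (π-nonneg A) p≤1 (π-≤1 A))
  π-≤1 (outside ∷ A) = π-≤1 A

  E-sub : ∀ {n} (A : Subset n) → E (sub A) ≈ π A
  E-sub []                    = refl
  E-sub {suc n} (inside  ∷ A) = trans (+-cong (*-congˡ (E-sub A)) (trans (*-congˡ (E-const n 0#)) (zeroʳ q)))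
                                      (+-identityʳ _)
  E-sub (outside ∷ A) = trans (+-cong (*-congˡ (E-sub A)) (*-congˡ (E-sub A)))
    (solve 2 (λ p a → p :* a :+ (con (ℤ.+ 1) :- p) :* a := a) refl p (π A))

  -- `π A` is `p` to the power |A|. A union has at most |A| + |B| elements, and `p ≤ 1`.
  π-∪ : ∀ {n} (A B : Subset n) → π A * π B ≤ π (A ∪ B)
  π-∪ []            []            = ≤-reflexive (*-identityˡ 1#)
  π-∪ (inside  ∷ A) (inside  ∷ B) = ≤-trans
    (*-mono-≤ (*-nonneg 0≤p (π-nonneg A)) (*-nonneg 0≤p (π-nonneg B)) ≤-refl
      (≤-resp refl (*-identityˡ _) (*-monoˡ-≤ (π-nonneg B) p≤1)))
    (≤-resp (sym (*-assoc _ _ _)) refl (*-monoʳ-≤ 0≤p (π-∪ A B)))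
  π-∪ (inside  ∷ A) (outside ∷ B) = ≤-resp (sym (*-assoc _ _ _)) refl (*-monoʳ-≤ 0≤p (π-∪ A B))
  π-∪ (outside ∷ A) (inside  ∷ B) = ≤-resp
    (solve 3 (λ a b c → a :* (b :* c) := b :* (a :* c)) refl p (π A) (π B)) refl (*-monoʳ-≤ 0≤p (π-∪ A B))
  π-∪ (outside ∷ A) (outside ∷ B) = π-∪ A B

  -- The indicator that `S` contains no member of `F`; the product form is what lets `harris` peel
  -- off one set at a time.
  avoid : ∀ {n} → List (Subset n) → Subset n → Carrier
  avoid []      S = 1#
  avoid (A ∷ F) S = (1# - sub A S) * avoid F S

  private
    0≤1-sub : ∀ {n} (A S : Subset n) → 0# ≤ 1# - sub A S
    0≤1-sub A S = x≤y⇒0≤y-x (sub-≤1 A S)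

    1-sub≤1 : ∀ {n} (A S : Subset n) → 1# - sub A S ≤ 1#
    1-sub≤1 A S = ≤-by (sub A S) (solve 1 (λ s → con (ℤ.+ 1) := (con (ℤ.+ 1) :- s) :+ s) refl _) (sub-nonneg A S)

    1-sub↓ : ∀ {n} (A : Subset n) → Decreasing (λ S → 1# - sub A S)
    1-sub↓ A h = +-monoʳ-≤ 1# (neg-≤ (sub-mono A h))

  avoid-nonneg : ∀ {n} F (S : Subset n) → 0# ≤ avoid F S
  avoid-nonneg []      S = 0≤1
  avoid-nonneg (A ∷ F) S = *-nonneg (0≤1-sub A S) (avoid-nonneg F S)

  avoid-≤1 : ∀ {n} F (S : Subset n) → avoid F S ≤ 1#
  avoid-≤1 []      S = ≤-refl
  avoid-≤1 (A ∷ F) S = ≤-resp refl (*-identityˡ 1#)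
    (*-mono-≤ (0≤1-sub A S) (avoid-nonneg F S) (1-sub≤1 A S) (avoid-≤1 F S))

  avoid↓ : ∀ {n} (F : List (Subset n)) → Decreasing (avoid F)
  avoid↓ []      h = ≤-refl
  avoid↓ (A ∷ F) h = *-mono-≤ (0≤1-sub A _) (avoid-nonneg F _) (1-sub↓ A h) (avoid↓ F h)

  E-1-sub : ∀ {n} (A : Subset n) → E (λ S → 1# - sub A S) ≈ 1# - π A
  E-1-sub {n} A = trans (E-+ {n} _ _) (+-cong (E-const n 1#) (trans (E-neg {n} _) (-‿cong (E-sub A))))

  E-avoid-≥^ : ∀ {n} {u} → u ≤ 1# → {F : List (Subset n)} → All (λ A → π A ≤ u) F →
               (1# - u) ^ length F ≤ E (avoid F)
  E-avoid-≥^ {n} u≤1 []                  = ≤-reflexive (sym (E-const n 1#))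
  E-avoid-≥^ {n} u≤1 (_∷_ {A} {F} πA≤u h) = ≤-trans
    (*-mono-≤ 0≤1-u (^-nonneg (length F) 0≤1-u)
      (≤-resp refl (sym (E-1-sub A)) (+-monoʳ-≤ 1# (neg-≤ πA≤u))) (E-avoid-≥^ u≤1 h))
    (harris {n} (1-sub↓ A) (avoid↓ F))
    where 0≤1-u = x≤y⇒0≤y-x u≤1

  -- The union bound, pointwise in `S`.
  1≤avoid+Σsub : ∀ {n} F (S : Subset n) → 1# ≤ avoid F S + Σ F (λ A → sub A S)
  1≤avoid+Σsub []      S = ≤-reflexive (sym (+-identityʳ 1#))
  1≤avoid+Σsub (A ∷ F) S = ≤-trans (1≤avoid+Σsub F S)
    (≤-by (sub A S * (1# - avoid F S))
      (solve 3 (λ s a r → (con (ℤ.+ 1) :- s) :* a :+ (s :+ r) := (a :+ r) :+ s :* (con (ℤ.+ 1) :- a))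
        refl (sub A S) (avoid F S) (Σ F (λ A → sub A S)))
      (*-nonneg (sub-nonneg A S) (x≤y⇒0≤y-x (avoid-≤1 F S))))

  1-Σπ≤E-avoid : ∀ {n} (F : List (Subset n)) → 1# - Σ F π ≤ E (avoid F)
  1-Σπ≤E-avoid {n} F = ≤-resp refl
    (solve 2 (λ a s → (a :+ s) :- s := a) refl (E (avoid F)) (Σ F π))
    (+-monoˡ-≤ (- Σ F π) (≤-resp (E-const n 1#)
      (trans (E-+ {n} _ _) (+-congˡ (trans (E-Σ F sub) (Σ-cong F E-sub))))
      (E-mono {n} (1≤avoid+Σsub F))))

  -- The constraints left after the first coordinate is revealed: `tails F` if it is in `S`, and
  -- `outs F` if it is not, since a set containing it can then no longer lie in `S`. The sets in
  -- `ins F` are the ones through which the first coordinate can be pivotal.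
  ins outs tails : ∀ {n} → List (Subset (suc n)) → List (Subset n)
  ins  []                  = []
  ins  ((inside  ∷ A) ∷ F) = A ∷ ins F
  ins  ((outside ∷ A) ∷ F) = ins F
  outs []                  = []
  outs ((inside  ∷ A) ∷ F) = outs F
  outs ((outside ∷ A) ∷ F) = A ∷ outs F
  tails []                 = []
  tails ((_ ∷ A) ∷ F)      = A ∷ tails F

  avoid-inside : ∀ {n} F (S : Subset n) → avoid F (inside ∷ S) ≈ avoid (tails F) S
  avoid-inside []                  S = refl
  avoid-inside ((inside  ∷ A) ∷ F) S = *-congˡ (avoid-inside F S)
  avoid-inside ((outside ∷ A) ∷ F) S = *-congˡ (avoid-inside F S)

  avoid-outside : ∀ {n} F (S : Subset n) → avoid F (outside ∷ S) ≈ avoid (outs F) S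
  avoid-outside []                  S = refl
  avoid-outside ((inside  ∷ A) ∷ F) S = trans
    (solve 1 (λ a → (con (ℤ.+ 1) :- con (ℤ.+ 0)) :* a := a) refl (avoid F (outside ∷ S))) (avoid-outside F S)
  avoid-outside ((outside ∷ A) ∷ F) S = *-congˡ (avoid-outside F S)

  avoid-tails≤outs : ∀ {n} F (S : Subset n) → avoid (tails F) S ≤ avoid (outs F) S
  avoid-tails≤outs []                  S = ≤-refl
  avoid-tails≤outs ((inside  ∷ A) ∷ F) S = ≤-resp refl (*-identityˡ _)
    (*-mono-≤ (0≤1-sub A S) (avoid-nonneg (tails F) S) (1-sub≤1 A S) (avoid-tails≤outs F S))
  avoid-tails≤outs ((outside ∷ A) ∷ F) S = *-monoʳ-≤ (0≤1-sub A S) (avoid-tails≤outs F S)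

  -- If `S` avoids `outs F` but not `tails F`, some member of `ins F` lies in `S`; the sum is the
  -- union bound over these witnesses of pivotality.
  avoid-outs≤tails : ∀ {n} F (S : Subset n) → avoid (outs F) S ≤
                     avoid (tails F) S + Σ (ins F) (λ A → avoid (outs F) S * sub A S)
  avoid-outs≤tails []                  S = ≤-reflexive (sym (+-identityʳ 1#))
  avoid-outs≤tails ((inside  ∷ A) ∷ F) S = ≤-trans (avoid-outs≤tails F S)
    (≤-by (sub A S * (avoid (outs F) S - avoid (tails F) S))
      (solve 4 (λ s o t r → (con (ℤ.+ 1) :- s) :* t :+ (o :* s :+ r) := (t :+ r) :+ s :* (o :- t))
        refl (sub A S) _ _ _)
      (*-nonneg (sub-nonneg A S) (x≤y⇒0≤y-x (avoid-tails≤outs F S))))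
  avoid-outs≤tails ((outside ∷ A) ∷ F) S = ≤-resp refl
    (trans (distribˡ k _ _) (+-congˡ (trans (sym (Σ-*ˡ (ins F) k _)) (Σ-cong (ins F) (λ _ → sym (*-assoc _ _ _))))))
    (*-monoʳ-≤ (0≤1-sub A S) (avoid-outs≤tails F S))
    where k = 1# - sub A S

  cap : ∀ {n} → Subset n → Subset n → Carrier
  cap []            []            = 0#
  cap (inside  ∷ A) (inside  ∷ B) = 1# + cap A B
  cap (inside  ∷ A) (outside ∷ B) = cap A B
  cap (outside ∷ A) (_       ∷ B) = cap A B

  cap-nonneg : ∀ {n} (A B : Subset n) → 0# ≤ cap A B
  cap-nonneg []            []            = ≤-refl
  cap-nonneg (inside  ∷ A) (inside  ∷ B) = +-nonneg 0≤1 (cap-nonneg A B)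
  cap-nonneg (inside  ∷ A) (outside ∷ B) = cap-nonneg A B
  cap-nonneg (outside ∷ A) (_       ∷ B) = cap-nonneg A B

  -- |A ∩ B| p ^ |A ∪ B|, the weight of a pair of dependent sets.
  dep : ∀ {n} → Subset n → Subset n → Carrier
  dep A B = cap A B * π (A ∪ B)

  dep-nonneg : ∀ {n} (A B : Subset n) → 0# ≤ dep A B
  dep-nonneg A B = *-nonneg (cap-nonneg A B) (π-nonneg (A ∪ B))

  Λ : ∀ {n} → List (Subset n) → List (Subset n) → Carrier
  Λ F H = Σ F (λ A → Σ H (dep A))

  Λ-nonneg : ∀ {n} (F H : List (Subset n)) → 0# ≤ Λ F H
  Λ-nonneg F H = Σ-nonneg F (λ A → Σ-nonneg H (dep-nonneg A))

  dep↑ : ∀ {n} → Subset (suc n) → Subset (suc n) → Carrier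
  dep↑ (_ ∷ A) (_ ∷ B) = dep A B

  both-inside both-outside : ∀ {n} → (Subset n → Subset n → Carrier) → Subset (suc n) → Subset (suc n) → Carrier
  both-inside  f (inside  ∷ A) (inside  ∷ B) = f A B
  both-inside  f _             _             = 0#
  both-outside f (outside ∷ A) (outside ∷ B) = f A B
  both-outside f _             _             = 0#

  private
    Σ-ins : ∀ {n} F H (f : Subset n → Subset n → Carrier) →
            Σ (ins F) (λ A → Σ (ins H) (f A)) ≈ Σ F (λ A → Σ H (both-inside f A))
    Σ-ins []                  H f = refl
    Σ-ins ((inside  ∷ A) ∷ F) H f = +-cong (inner H) (Σ-ins F H f)
      where
      inner : ∀ H → Σ (ins H) (f A) ≈ Σ H (both-inside f (inside ∷ A))
      inner []                  = refl
      inner ((inside  ∷ B) ∷ H) = +-congˡ (inner H)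
      inner ((outside ∷ B) ∷ H) = trans (inner H) (sym (+-identityˡ _))
    Σ-ins ((outside ∷ A) ∷ F) H f = trans (Σ-ins F H f) (trans (sym (+-identityˡ _))
      (+-congʳ (sym (Σ-zero H))))

    Σ-outs : ∀ {n} F H (f : Subset n → Subset n → Carrier) →
             Σ (outs F) (λ A → Σ (outs H) (f A)) ≈ Σ F (λ A → Σ H (both-outside f A))
    Σ-outs []                  H f = refl
    Σ-outs ((outside ∷ A) ∷ F) H f = +-cong (inner H) (Σ-outs F H f)
      where
      inner : ∀ H → Σ (outs H) (f A) ≈ Σ H (both-outside f (outside ∷ A))
      inner []                  = refl
      inner ((outside ∷ B) ∷ H) = +-congˡ (inner H)
      inner ((inside  ∷ B) ∷ H) = trans (inner H) (sym (+-identityˡ _))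
    Σ-outs ((inside  ∷ A) ∷ F) H f = trans (Σ-outs F H f) (trans (sym (+-identityˡ _))
      (+-congʳ (sym (Σ-zero H))))

    Σ-tails : ∀ {n} (F H : List (Subset (suc n))) → Λ (tails F) (tails H) ≈ Σ F (λ A → Σ H (dep↑ A))
    Σ-tails []            H = refl
    Σ-tails ((_ ∷ A) ∷ F) H = +-cong (inner H) (Σ-tails F H)
      where
      inner : ∀ H → Σ (tails H) (dep A) ≈ Σ H (dep↑ (_ ∷ A))
      inner []            = refl
      inner ((_ ∷ B) ∷ H) = +-congˡ (inner H)

  -- For a pair of sets, the first element contributes a factor `p` to `π (A ∪ B)` when it lies in
  -- either set; when it lies in neither, the weight is split as `p + q = 1`. If it lies in both, it
  -- also adds one to `cap`, which is the last sum.
  Λ-split : ∀ {n} (F H : List (Subset (suc n))) → Λ F H ≈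
            p * Λ (tails F) (tails H) + q * Λ (outs F) (outs H) +
            p * Σ (ins F) (λ A → Σ (ins H) (λ B → π (A ∪ B)))
  Λ-split F H = sym (trans
    (+-cong (+-cong (*-congˡ (Σ-tails F H)) (*-congˡ (Σ-outs F H dep))) (*-congˡ (Σ-ins F H _)))
    (trans (gather F _ _ _) (Σ-cong F (λ A → trans (gather H _ _ _) (Σ-cong H (pointwise A))))))
    where
    gather : ∀ {A : Set} (xs : List A) (f g h : A → Carrier) →
             p * Σ xs f + q * Σ xs g + p * Σ xs h ≈ Σ xs (λ x → p * f x + q * g x + p * h x)
    gather xs f g h = sym (trans (Σ-+ xs _ _) (+-cong (trans (Σ-+ xs _ _)
      (+-cong (Σ-*ˡ xs p f) (Σ-*ˡ xs q g))) (Σ-*ˡ xs p h)))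

    pointwise : ∀ A B → p * dep↑ A B + q * both-outside dep A B + p * both-inside (λ A B → π (A ∪ B)) A B
                      ≈ dep A B
    pointwise (inside ∷ A) (inside ∷ B) =
      solve 3 (λ p c x → p :* (c :* x) :+ (con (ℤ.+ 1) :- p) :* con (ℤ.+ 0) :+ p :* x
                      := (con (ℤ.+ 1) :+ c) :* (p :* x)) refl p (cap A B) (π (A ∪ B))
    pointwise (inside ∷ A) (outside ∷ B) =
      solve 3 (λ p c x → p :* (c :* x) :+ (con (ℤ.+ 1) :- p) :* con (ℤ.+ 0) :+ p :* con (ℤ.+ 0)
                      := c :* (p :* x)) refl p (cap A B) (π (A ∪ B))
    pointwise (outside ∷ A) (inside ∷ B) =
      solve 3 (λ p c x → p :* (c :* x) :+ (con (ℤ.+ 1) :- p) :* con (ℤ.+ 0) :+ p :* con (ℤ.+ 0)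
                      := c :* (p :* x)) refl p (cap A B) (π (A ∪ B))
    pointwise (outside ∷ A) (outside ∷ B) =
      solve 3 (λ p c x → p :* (c :* x) :+ (con (ℤ.+ 1) :- p) :* (c :* x) :+ p :* con (ℤ.+ 0)
                      := c :* x) refl p (cap A B) (π (A ∪ B))

  Λ-outs≤tails : ∀ {n} (F H : List (Subset (suc n))) → Λ (outs F) (outs H) ≤ Λ (tails F) (tails H)
  Λ-outs≤tails F H = ≤-resp (sym (Σ-outs F H dep)) (sym (Σ-tails F H))
    (Σ-mono F (λ A → Σ-mono H (pointwise A)))
    where
    pointwise : ∀ A B → both-outside dep A B ≤ dep↑ A B
    pointwise (inside  ∷ A) (_       ∷ B) = dep-nonneg A B
    pointwise (outside ∷ A) (inside  ∷ B) = dep-nonneg A B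
    pointwise (outside ∷ A) (outside ∷ B) = ≤-refl

  private
    module _ {n} (F : List (Subset (suc n))) where
      α a₀ a₁ : Carrier
      α  = Σ (ins F) π
      a₀ = E (avoid (outs F))
      a₁ = E (avoid (tails F))

      a₁≤a₀ : a₁ ≤ a₀
      a₁≤a₀ = E-mono {n} (avoid-tails≤outs F)

      -- The probability that the first coordinate is pivotal; Harris decouples the
      -- witness of pivotality from the avoidance event.
      a₀-a₁≤a₀α : a₀ - a₁ ≤ a₀ * α
      a₀-a₁≤a₀α = ≤-resp refl (solve 2 (λ a b → (a :+ b) :- a := b) refl a₁ (a₀ * α))
        (+-monoˡ-≤ (- a₁) (≤-trans (E-mono {n} (avoid-outs≤tails F))
          (≤-resp (sym (E-+ {n} _ _)) refl (+-monoʳ-≤ a₁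
            (≤-resp (sym (E-Σ {n} (ins F) _)) (Σ-*ˡ (ins F) a₀ π)
              (Σ-mono (ins F) (λ A → decouple A)))))))
        where
        decouple : ∀ A → E (λ S → avoid (outs F) S * sub A S) ≤ a₀ * π A
        -- `sub A` increases with `S`, so `harris` is applied to its negative, which reverses the
        -- inequality.
        decouple A = ≤-resp
          (trans (sym (E-neg {n} _)) (E-cong {n} (λ S → solve 2 (λ a b → :- (a :* :- b) := a :* b) refl _ _)))
          (trans (-‿cong (trans (*-congˡ (trans (E-neg {n} (sub A)) (-‿cong (E-sub A)))) refl))
            (solve 2 (λ a b → :- (a :* :- b) := a :* b) refl a₀ (π A)))
          (neg-≤ (harris {n} (avoid↓ (outs F)) (λ h → neg-≤ (sub-mono A h))))

  -- By induction on the coordinates: one coordinate contributes p q times the product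
  -- of the probabilities that it is pivotal for F and for H to the covariance.
  correlation : ∀ {n} (F H : List (Subset n)) →
    E (λ S → avoid F S * avoid H S) ≤
    E (avoid F) * E (avoid H) + E (λ S → avoid F S * avoid H S) * Λ F H
  correlation {zero} F H = ≤-by _ refl
    (*-nonneg (*-nonneg (avoid-nonneg F []) (avoid-nonneg H [])) (Λ-nonneg F H))
  correlation {suc n} F H = ≤-resp (sym m-split)
    (+-cong (*-cong (sym (split F)) (sym (split H))) (*-cong (sym m-split) (sym (Λ-split F H))))
    -- The slack consists of the two induction hypotheses, the term `(m₀ - m₁) (Λ₁ - Λ₀)`,
    -- nonnegative because `m` falls and `Λ` grows when the first element enters `S`, a spare
    -- `m₁ τ`, and the excess of `m₀ τ` over the product of the two pivotal differences.
    (≤-by (p * d₁ + q * d₀ + p * q * ((m₀ - m₁) * (Λ₁ - Λ₀)) + p * p * (m₁ * τ) + p * q * e)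
      (solve 10 (λ p a₀ a₁ b₀ b₁ m₀ m₁ Λ₀ Λ₁ τ → let q = con (ℤ.+ 1) :- p in
          (p :* a₁ :+ q :* a₀) :* (p :* b₁ :+ q :* b₀) :+
            (p :* m₁ :+ q :* m₀) :* (p :* Λ₁ :+ q :* Λ₀ :+ p :* τ)
          := (p :* m₁ :+ q :* m₀) :+
             (p :* ((a₁ :* b₁ :+ m₁ :* Λ₁) :- m₁) :+ q :* ((a₀ :* b₀ :+ m₀ :* Λ₀) :- m₀) :+
              p :* q :* ((m₀ :- m₁) :* (Λ₁ :- Λ₀)) :+ p :* p :* (m₁ :* τ) :+
              p :* q :* (m₀ :* τ :- (a₀ :- a₁) :* (b₀ :- b₁))))
        refl p (a₀ F) (a₁ F) (a₀ H) (a₁ H) m₀ m₁ Λ₀ Λ₁ τ)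
      (+-nonneg (+-nonneg (+-nonneg (+-nonneg
        (*-nonneg 0≤p (x≤y⇒0≤y-x (correlation (tails F) (tails H))))
        (*-nonneg 0≤q (x≤y⇒0≤y-x (correlation (outs F) (outs H)))))
        (*-nonneg (*-nonneg 0≤p 0≤q) (*-nonneg (x≤y⇒0≤y-x m₁≤m₀) (x≤y⇒0≤y-x (Λ-outs≤tails F H)))))
        (*-nonneg (*-nonneg 0≤p 0≤p) (*-nonneg 0≤m₁ 0≤τ)))
        (*-nonneg (*-nonneg 0≤p 0≤q) (x≤y⇒0≤y-x pivotal))))
    where
    m₀ = E (λ S → avoid (outs F) S * avoid (outs H) S)
    m₁ = E (λ S → avoid (tails F) S * avoid (tails H) S)
    Λ₀ = Λ (outs F) (outs H)
    Λ₁ = Λ (tails F) (tails H)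
    τ  = Σ (ins F) (λ A → Σ (ins H) (λ B → π (A ∪ B)))
    d₁ = (a₁ F * a₁ H + m₁ * Λ₁) - m₁
    d₀ = (a₀ F * a₀ H + m₀ * Λ₀) - m₀
    e  = m₀ * τ - (a₀ F - a₁ F) * (a₀ H - a₁ H)

    split : ∀ F → E (avoid F) ≈ p * a₁ F + q * a₀ F
    split F = +-cong (*-congˡ (E-cong {n} (avoid-inside F))) (*-congˡ (E-cong {n} (avoid-outside F)))

    m-split : E (λ S → avoid F S * avoid H S) ≈ p * m₁ + q * m₀
    m-split = +-cong (*-congˡ (E-cong {n} (λ S → *-cong (avoid-inside F S) (avoid-inside H S))))
                     (*-congˡ (E-cong {n} (λ S → *-cong (avoid-outside F S) (avoid-outside H S))))

    m₁≤m₀ : m₁ ≤ m₀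
    m₁≤m₀ = E-mono {n} (λ S → *-mono-≤ (avoid-nonneg (tails F) S) (avoid-nonneg (tails H) S)
                                       (avoid-tails≤outs F S) (avoid-tails≤outs H S))

    0≤m₁ : 0# ≤ m₁
    0≤m₁ = E-nonneg {n} (λ S → *-nonneg (avoid-nonneg (tails F) S) (avoid-nonneg (tails H) S))

    0≤τ : 0# ≤ τ
    0≤τ = Σ-nonneg (ins F) (λ A → Σ-nonneg (ins H) (λ B → π-nonneg (A ∪ B)))

    αβ≤τ : α F * α H ≤ τ
    αβ≤τ = ≤-resp (sym (Σ-*-Σ (ins F) (ins H) π π)) refl
      (Σ-mono (ins F) (λ A → Σ-mono (ins H) (π-∪ A)))

    -- Each difference is at most `a₀ α`. Then `harris` absorbs the two factors `a₀` into `m₀`, and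
    -- `αβ≤τ` absorbs the two factors `α` into `τ`.
    pivotal : (a₀ F - a₁ F) * (a₀ H - a₁ H) ≤ m₀ * τ
    pivotal = ≤-trans
      (*-mono-≤ (x≤y⇒0≤y-x (a₁≤a₀ F)) (x≤y⇒0≤y-x (a₁≤a₀ H)) (a₀-a₁≤a₀α F) (a₀-a₁≤a₀α H))
      (≤-resp (solve 4 (λ a b x y → (a :* b) :* (x :* y) := (a :* x) :* (b :* y)) refl (a₀ F) (a₀ H) (α F) (α H)) refl
        (*-mono-≤ (*-nonneg (E-nonneg {n} (avoid-nonneg (outs F))) (E-nonneg {n} (avoid-nonneg (outs H))))
                  (*-nonneg (Σ-nonneg (ins F) π-nonneg) (Σ-nonneg (ins H) π-nonneg))
                  (harris {n} (avoid↓ (outs F)) (avoid↓ (outs H))) αβ≤τ))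

-- The second moment argument for abstract families of sets.

module SecondMoment
  {c ℓ₁ ℓ₂} (ℝ : CompleteOrderedField c ℓ₁ ℓ₂)
  (p : CompleteOrderedField.Carrier ℝ)
  (0≤p : CompleteOrderedField._≤_ ℝ (CompleteOrderedField.0# ℝ) p)
  (p≤1 : CompleteOrderedField._≤_ ℝ p (CompleteOrderedField.1# ℝ))
  where
  open OrderedField ℝ
  open ListSum ℝ
  open Expectation ℝ p
  open Correlation ℝ p 0≤p p≤1

  -- The families F x carry the second moment; those of H x are rare, and κ collects
  -- the strongly dependent pairs.
  second-moment :
    ∀ {n a b} {X : Set a} (T : List X) (F H : X → List (Subset n)) {A : Pred (Subset n) b}
    (A? : Decidable₁ A) → (∀ S → A S → ∀ x → avoid (F x) S * avoid (H x) S ≈ 0#) →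
    ∀ {η λ₀ K} (κ : X → X → Carrier) → 0# ≤ η → η ≤ 1# → λ₀ ≤ η → (∀ x y → 0# ≤ κ x y) →
    All (λ x → Σ (H x) π ≤ η) T →
    (∀ x y → Λ (F x) (F y) ≤ λ₀ + κ x y) →
    (∀ x → Σ T (κ x) ≤ K) →
    0# < Σ T (λ x → E (avoid (F x))) → K ≤ η * Σ T (λ x → E (avoid (F x))) →
    E (λ S → ⟦ A? S ⟧) ≤ fromℕ 5 * η
  second-moment {n} {X = X} T F H {A} A? A⇒0 {η} {λ₀} {K} κ 0≤η η≤1 λ₀≤η 0≤κ rare Λ≤ Σκ≤K 0<Q K≤ηQ =
    *-cancelʳ-≤ (*-pos 0<Q 0<Q) PQ²≤5ηQ²
    where
    f g : X → Subset n → Carrier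
    f x = avoid (F x)
    g x = avoid (H x)

    m : X → X → Carrier
    m x y = E (λ S → f x S * f y S)

    Q V P EY : Carrier
    Q = Σ T (λ x → E (f x))
    V = Σ T (λ x → Σ T (m x))
    P = E (λ S → ⟦ A? S ⟧)
    EY = Σ T (λ x → E (λ S → f x S * g x S))

    Y : Subset n → Carrier
    Y S = Σ T (λ x → f x S * g x S)

    0≤f : ∀ x S → 0# ≤ f x S
    0≤f x = avoid-nonneg (F x)

    0≤g : ∀ x S → 0# ≤ g x S
    0≤g x = avoid-nonneg (H x)

    fg≤f : ∀ x S → f x S * g x S ≤ f x S
    fg≤f x S = ≤-resp refl (*-identityʳ _) (*-monoʳ-≤ (0≤f x S) (avoid-≤1 (H x) S))

    -- Only the uniform part `λ₀` of the dependence keeps the factor `m x y`, to be absorbed later.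
    -- Next to `κ x y`, which may be large for single pairs, `m x y` is weakened to `E (f x)`, so
    -- that just the row sums of `κ` matter.
    m≤ : ∀ x y → m x y ≤ E (f x) * E (f y) + m x y * λ₀ + E (f x) * κ x y
    m≤ x y = ≤-trans (correlation (F x) (F y)) (≤-trans
      (+-monoʳ-≤ _ (≤-trans (*-monoʳ-≤ 0≤m (Λ≤ x y)) (≤-resp (sym (distribˡ _ _ _)) refl
        (+-monoʳ-≤ _ (*-monoˡ-≤ (0≤κ x y) (E-mono {n} (λ S → ≤-resp refl (*-identityʳ _)
          (*-monoʳ-≤ (0≤f x S) (avoid-≤1 (F y) S)))))))))
      (≤-reflexive (sym (+-assoc _ _ _))))
      where
      0≤m : 0# ≤ m x y
      0≤m = E-nonneg {n} (λ S → *-nonneg (0≤f x S) (0≤f y S))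

    0≤V : 0# ≤ V
    0≤V = Σ-nonneg T (λ x → Σ-nonneg T (λ y → E-nonneg {n} (λ S → *-nonneg (0≤f x S) (0≤f y S))))

    V-bound : V ≤ Q * Q + η * V + η * (Q * Q)
    V-bound = ≤-trans (Σ-mono T (λ x → Σ-mono T (m≤ x)))
      (≤-trans (≤-reflexive (trans (Σ-cong T row) (trans (Σ-+ T _ _) (+-congʳ (Σ-+ T _ _)))))
      (+-mono-≤ (+-mono-≤ (≤-reflexive (sym (Σ-*-Σ T T _ _)))
                          (≤-trans (≤-reflexive (trans (Σ-cong T (λ x → Σ-*ʳ T λ₀ (m x))) (Σ-*ʳ T λ₀ _)))
                                   (≤-resp (*-comm _ _) refl (*-monoˡ-≤ 0≤V λ₀≤η))))
                (≤-trans (Σ-mono T (λ x → ≤-trans (≤-reflexive (Σ-*ˡ T (E (f x)) (κ x)))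
                            (*-monoʳ-≤ (E-nonneg {n} (0≤f x)) (Σκ≤K x))))
                (≤-trans (≤-reflexive (Σ-*ʳ T K _))
                (≤-trans (*-monoʳ-≤ (<⇒≤ 0<Q) K≤ηQ)
                  (≤-reflexive (solve 2 (λ q e → q :* (e :* q) := e :* (q :* q)) refl Q η)))))))
      where
      row : ∀ x → Σ T (λ y → E (f x) * E (f y) + m x y * λ₀ + E (f x) * κ x y) ≈
                  Σ T (λ y → E (f x) * E (f y)) + Σ T (λ y → m x y * λ₀) + Σ T (λ y → E (f x) * κ x y)
      row x = trans (Σ-+ T _ _) (+-congʳ (Σ-+ T _ _))

    -- Both `f x` and `g x` are decreasing, so `harris` gives `E (f x) E (g x)` as a lower bound;
    -- the union bound makes the second factor at least `1 - η`.
    EY-bound : (1# - η) * Q ≤ EY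
    EY-bound = ≤-resp (Σ-*ˡ T (1# - η) (λ x → E (f x))) refl (go T rare)
      where
      go : ∀ T → All (λ x → Σ (H x) π ≤ η) T →
           Σ T (λ x → (1# - η) * E (f x)) ≤ Σ T (λ x → E (λ S → f x S * g x S))
      go []      []        = ≤-refl
      go (x ∷ T) (r ∷ rare) = +-mono-≤
        (≤-trans (*-monoˡ-≤ (E-nonneg {n} (0≤f x)) (≤-trans (+-monoʳ-≤ 1# (neg-≤ r)) (1-Σπ≤E-avoid (H x))))
        (≤-trans (≤-reflexive (*-comm _ _)) (harris {n} (avoid↓ (F x)) (avoid↓ (H x)))))
        (go T rare)

    Y² : ∀ S → Y S * Y S ≤ Σ T (λ x → Σ T (λ y → f x S * f y S))
    Y² S = ≤-resp (sym (Σ-*-Σ T T _ _)) refl (Σ-mono T (λ x → Σ-mono T (λ y →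
      *-mono-≤ (*-nonneg (0≤f x S) (0≤g x S)) (*-nonneg (0≤f y S) (0≤g y S)) (fg≤f x S) (fg≤f y S))))

    -- Chebyshev's inequality, scaled by Q².
    chebyshev : ∀ S → ⟦ A? S ⟧ * (Q * Q) ≤
                      Q * Q + (- (fromℕ 2 * Q)) * Y S + Σ T (λ x → Σ T (λ y → f x S * f y S))
    chebyshev S = ≤-trans (pointwise (A? S)) (+-monoʳ-≤ _ (Y² S))
      where
      square : ∀ y → (Q - y) * (Q - y) ≈ Q * Q + (- (fromℕ 2 * Q)) * y + y * y
      square y = solve 2 (λ q y → (q :- y) :* (q :- y) :=
        q :* q :+ (:- ((con (ℤ.+ 1) :+ (con (ℤ.+ 1) :+ con (ℤ.+ 0))) :* q)) :* y :+ y :* y) refl Q y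

      pointwise : (a? : Dec (A S)) → ⟦ a? ⟧ * (Q * Q) ≤ Q * Q + (- (fromℕ 2 * Q)) * Y S + Y S * Y S
      pointwise (no  _) = ≤-resp (sym (zeroˡ _)) (square (Y S)) (x²-nonneg (Q - Y S))
      -- On the event every summand of `Y S` vanishes, so the square of `Q - Y S` is exactly `Q²`.
      pointwise (yes a) = ≤-reflexive (trans (trans (*-identityˡ _)
        (solve 1 (λ q → q :* q := (q :- con (ℤ.+ 0)) :* (q :- con (ℤ.+ 0))) refl Q))
        (trans (*-cong Q-0≈Q-Y Q-0≈Q-Y) (square (Y S))))
        where
        Q-0≈Q-Y : Q - 0# ≈ Q - Y S
        Q-0≈Q-Y = +-congˡ (-‿cong (sym (trans (Σ-cong T (A⇒0 S a)) (Σ-zero T))))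

    P-bound : P * (Q * Q) ≤ Q * Q + (- (fromℕ 2 * Q)) * EY + V
    P-bound = ≤-resp (trans (E-cong {n} (λ S → *-comm _ _)) (trans (E-*ˡ {n} _ _) (*-comm _ _)))
      (trans (E-+ {n} _ _) (+-cong
        (trans (E-+ {n} _ _) (+-cong (E-const n _) (trans (E-*ˡ {n} _ _) (*-congˡ (E-Σ {n} T _)))))
        (trans (E-Σ {n} T _) (Σ-cong T (λ x → E-Σ {n} T _)))))
      (E-mono {n} chebyshev)

    P≤1 : P ≤ 1#
    P≤1 = ≤-resp refl (E-const n 1#) (E-mono {n} (λ S → ⟦⟧-≤1 (A? S)))

    PQ²≤5ηQ² : P * (Q * Q) ≤ (fromℕ 5 * η) * (Q * Q)
    -- From `(1 - η) V ≤ (1 + η) Q²` and the bounds on `P` and `EY` follows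
    -- `(1 - η) P Q² ≤ (4 η - 2 η²) Q²`. Adding `η P Q² ≤ η Q²` gives the constant 5 without a
    -- division by `1 - η`, which may be zero.
    PQ²≤5ηQ² = ≤-by
      ((1# - η) * (Q * Q + (- (fromℕ 2 * Q)) * EY + V - P * (Q * Q)) +
       (Q * Q + η * V + η * (Q * Q) - V) + fromℕ 2 * Q * (1# - η) * (EY - (1# - η) * Q) +
       η * (Q * Q) * (1# - P) + fromℕ 2 * (η * η) * (Q * Q))
      (solve 5 (λ η Q V P EY → let one = con (ℤ.+ 1); two = one :+ (one :+ con (ℤ.+ 0)) in
        ((one :+ (one :+ (one :+ two))) :* η) :* (Q :* Q) := P :* (Q :* Q) :+
        ((one :- η) :* (Q :* Q :+ (:- (two :* Q)) :* EY :+ V :- P :* (Q :* Q)) :+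
         (Q :* Q :+ η :* V :+ η :* (Q :* Q) :- V) :+ two :* Q :* (one :- η) :* (EY :- (one :- η) :* Q) :+
         η :* (Q :* Q) :* (one :- P) :+ two :* (η :* η) :* (Q :* Q)))
        refl η Q V P EY)
      (+-nonneg (+-nonneg (+-nonneg (+-nonneg
        (*-nonneg 0≤1-η (x≤y⇒0≤y-x P-bound))
        (x≤y⇒0≤y-x V-bound))
        (*-nonneg (*-nonneg (*-nonneg (fromℕ-nonneg 2) (<⇒≤ 0<Q)) 0≤1-η) (x≤y⇒0≤y-x EY-bound)))
        (*-nonneg (*-nonneg 0≤η 0≤Q²) (x≤y⇒0≤y-x P≤1)))
        (*-nonneg (*-nonneg (fromℕ-nonneg 2) (*-nonneg 0≤η 0≤η)) 0≤Q²))
      where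
      0≤1-η : 0# ≤ 1# - η
      0≤1-η = x≤y⇒0≤y-x η≤1
      0≤Q² : 0# ≤ Q * Q
      0≤Q² = <⇒≤ (*-pos 0<Q 0<Q)

-- How weight, size and intersection change when an element is inserted.

module SubsetWeights
  {c ℓ₁ ℓ₂} (ℝ : CompleteOrderedField c ℓ₁ ℓ₂)
  (p : CompleteOrderedField.Carrier ℝ)
  (0≤p : CompleteOrderedField._≤_ ℝ (CompleteOrderedField.0# ℝ) p)
  (p≤1 : CompleteOrderedField._≤_ ℝ p (CompleteOrderedField.1# ℝ))
  where
  open OrderedField ℝ
  open ListSum ℝ
  open Correlation ℝ p 0≤p p≤1

  insert : ∀ {n} → Fin n → Subset n → Subset n
  insert i A = A [ i ]≔ inside

  insert-⊆ : ∀ {n} {i : Fin n} {A S} → i ∈ S → A ⊆ S → insert i A ⊆ S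
  insert-⊆ {i = zero}  {_ ∷ A}         i∈S         A⊆S here      = i∈S
  insert-⊆ {i = zero}  {_ ∷ A}         i∈S         A⊆S (there m) = A⊆S (there m)
  insert-⊆ {i = suc i} {_ ∷ A}         (there i∈S) A⊆S here      = A⊆S here
  insert-⊆ {i = suc i} {_ ∷ A} {_ ∷ S} (there i∈S) A⊆S (there m) =
    there (insert-⊆ i∈S (drop-∷-⊆ A⊆S) m)

  ∪-insert : ∀ {n} (A X : Subset n) i → A ∪ insert i X ≡ insert i (A ∪ X)
  ∪-insert (a ∷ A) (x ∷ X) zero    = ≡.cong (_∷ (A ∪ X)) (∨-zeroʳ a)
  ∪-insert (a ∷ A) (x ∷ X) (suc i) = ≡.cong (_ ∷_) (∪-insert A X i)

  mem : ∀ {n} → Subset n → Fin n → Carrier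
  mem A i = if lookup A i then 1# else 0#

  mem-nonneg : ∀ {n} (A : Subset n) i → 0# ≤ mem A i
  mem-nonneg (inside  ∷ A) zero    = 0≤1
  mem-nonneg (outside ∷ A) zero    = ≤-refl
  mem-nonneg (_       ∷ A) (suc i) = mem-nonneg A i

  mem-≤1 : ∀ {n} (A : Subset n) i → mem A i ≤ 1#
  mem-≤1 (inside  ∷ A) zero    = ≤-refl
  mem-≤1 (outside ∷ A) zero    = 0≤1
  mem-≤1 (_       ∷ A) (suc i) = mem-≤1 A i

  mem-idem : ∀ {n} (A : Subset n) i → mem A i * mem A i ≈ mem A i
  mem-idem (inside  ∷ A) zero    = *-identityˡ 1#
  mem-idem (outside ∷ A) zero    = zeroˡ 0#
  mem-idem (_       ∷ A) (suc i) = mem-idem A i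

  ∈⇒mem≈1 : ∀ {n} {A : Subset n} {i} → i ∈ A → mem A i ≈ 1#
  ∈⇒mem≈1                    here        = refl
  ∈⇒mem≈1 {A = _ ∷ A} {suc i} (there i∈A) = ∈⇒mem≈1 i∈A

  ∉⇒mem≈0 : ∀ {n} {A : Subset n} {i} → i ∉ A → mem A i ≈ 0#
  ∉⇒mem≈0 {A = inside  ∷ A} {zero}  i∉A = ⊥-elim (i∉A here)
  ∉⇒mem≈0 {A = outside ∷ A} {zero}  i∉A = refl
  ∉⇒mem≈0 {A = _       ∷ A} {suc i} i∉A = ∉⇒mem≈0 (λ i∈A → i∉A (there i∈A))

  mem-∪ : ∀ {n} (A X : Subset n) {i} → i ∉ X → mem (A ∪ X) i ≈ mem A i
  mem-∪ (a       ∷ A) (inside  ∷ X) {zero}  i∉X = ⊥-elim (i∉X here)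
  mem-∪ (inside  ∷ A) (outside ∷ X) {zero}  i∉X = refl
  mem-∪ (outside ∷ A) (outside ∷ X) {zero}  i∉X = refl
  mem-∪ (a       ∷ A) (x       ∷ X) {suc i} i∉X = mem-∪ A X (λ i∈X → i∉X (there i∈X))

  mem-insert : ∀ {n} (A : Subset n) i j → mem (insert i A) j ≤ ⟦ j ≟ i ⟧ + mem A j
  mem-insert (a ∷ A) zero    zero    = ≤-by (mem (a ∷ A) zero) refl (mem-nonneg (a ∷ A) zero)
  mem-insert (a ∷ A) zero    (suc j) = ≤-reflexive (sym (+-identityˡ _))
  mem-insert (inside  ∷ A) (suc i) zero    = ≤-reflexive (sym (+-identityˡ _))
  mem-insert (outside ∷ A) (suc i) zero    = ≤-reflexive (sym (+-identityˡ _))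
  mem-insert (a ∷ A) (suc i) (suc j) = ≤-trans (mem-insert A i j)
    (+-monoˡ-≤ _ (⟦⟧-mono (j ≟ i) (suc j ≟ suc i) (≡.cong suc)))

  Σ-⟦⟧-unique : ∀ {n a} {A : Pred (Fin n) a} (A? : Decidable₁ A) →
                (∀ {i j} → A i → A j → i ≡ j) → Σ (allFin n) (λ i → ⟦ A? i ⟧) ≤ 1#
  Σ-⟦⟧-unique {zero}  A? unique = 0≤1
  Σ-⟦⟧-unique {suc n} A? unique = ≤-trans (≤-reflexive (Σ-allFin-suc (λ i → ⟦ A? i ⟧))) (go (A? zero))
    where
    go : (a? : Dec _) → ⟦ a? ⟧ + Σ (allFin n) (λ i → ⟦ A? (suc i) ⟧) ≤ 1#
    go (no  _) = ≤-resp (sym (+-identityˡ _)) refl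
      (Σ-⟦⟧-unique (λ i → A? (suc i)) (λ a b → suc-injective (unique a b)))
    go (yes a) = ≤-resp refl (+-identityʳ 1#) (+-monoʳ-≤ 1#
      (≤-resp refl (Σ-zero (allFin n)) (Σ-mono (allFin n) (λ i → none i (A? (suc i))))))
      where
      none : ∀ i (b? : Dec _) → ⟦ b? ⟧ ≤ 0#
      none i (no _)  = ≤-refl
      none i (yes b) with unique a b
      ... | ()

  card : ∀ {n} → Subset n → Carrier
  card {n} A = Σ (allFin n) (mem A)

  card-insert : ∀ {n} (A : Subset n) i → card (insert i A) ≤ 1# + card A
  card-insert {n} A i = ≤-trans (Σ-mono (allFin n) (mem-insert A i))
    (≤-trans (≤-reflexive (Σ-+ (allFin n) _ _))
      (+-monoˡ-≤ _ (Σ-⟦⟧-unique (λ j → j ≟ i) (λ { ≡.refl ≡.refl → ≡.refl }))))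

  card-⊥ : ∀ n → card {n} ∅ ≈ 0#
  card-⊥ n = trans (Σ-cong (allFin n) (λ i → ∉⇒mem≈0 (∉⊥ {x = i}))) (Σ-zero (allFin n))

  -- The conditional probability of `i ∈ S` given `A ⊆ S`: it is 1 for members of `A` and `p`
  -- otherwise. As a polynomial in `mem A i` it is accessible to the ring solver.
  φ : ∀ {n} → Subset n → Fin n → Carrier
  φ A i = mem A i + p * (1# - mem A i)

  1-mem-nonneg : ∀ {n} (A : Subset n) i → 0# ≤ 1# - mem A i
  1-mem-nonneg A i = x≤y⇒0≤y-x (mem-≤1 A i)

  φ-nonneg : ∀ {n} (A : Subset n) i → 0# ≤ φ A i
  φ-nonneg A i = +-nonneg (mem-nonneg A i) (*-nonneg 0≤p (1-mem-nonneg A i))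

  φ-≤1 : ∀ {n} (A : Subset n) i → φ A i ≤ 1#
  φ-≤1 A i = ≤-by ((1# - p) * (1# - mem A i))
    (solve 2 (λ p m → let one = con (ℤ.+ 1) in
      one := (m :+ p :* (one :- m)) :+ (one :- p) :* (one :- m)) refl p (mem A i))
    (*-nonneg (x≤y⇒0≤y-x p≤1) (1-mem-nonneg A i))

  φ-≤mem+p : ∀ {n} (A : Subset n) i → φ A i ≤ mem A i + p
  φ-≤mem+p A i = ≤-by (p * mem A i)
    (solve 2 (λ p m → m :+ p := (m :+ p :* (con (ℤ.+ 1) :- m)) :+ p :* m) refl p (mem A i))
    (*-nonneg 0≤p (mem-nonneg A i))

  π-insert : ∀ {n} (A : Subset n) i → π (insert i A) ≈ φ A i * π A
  π-insert (inside  ∷ A) zero    = solve 2 (λ p a → let one = con (ℤ.+ 1) in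
    p :* a := (one :+ p :* (one :- one)) :* (p :* a)) refl p (π A)
  π-insert (outside ∷ A) zero    = solve 2 (λ p a → let zro = con (ℤ.+ 0) in
    p :* a := (zro :+ p :* (con (ℤ.+ 1) :- zro)) :* a) refl p (π A)
  π-insert (inside  ∷ A) (suc i) = trans (*-congˡ (π-insert A i))
    (solve 3 (λ p f a → p :* (f :* a) := f :* (p :* a)) refl p (φ A i) (π A))
  π-insert (outside ∷ A) (suc i) = π-insert A i

  cap-insert : ∀ {n} (A X : Subset n) i → cap A (insert i X) ≤ mem A i + cap A X
  cap-insert (inside  ∷ A) (inside  ∷ X) zero    = ≤-by 1# (+-comm _ _) 0≤1
  cap-insert (inside  ∷ A) (outside ∷ X) zero    = ≤-refl
  cap-insert (outside ∷ A) (x       ∷ X) zero    = ≤-reflexive (sym (+-identityˡ _))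
  cap-insert (inside  ∷ A) (inside  ∷ X) (suc i) = ≤-trans (+-monoʳ-≤ 1# (cap-insert A X i))
    (≤-reflexive (solve 3 (λ a b c → a :+ (b :+ c) := b :+ (a :+ c)) refl 1# (mem A i) (cap A X)))
  cap-insert (inside  ∷ A) (outside ∷ X) (suc i) = cap-insert A X i
  cap-insert (outside ∷ A) (x       ∷ X) (suc i) = cap-insert A X i

  cap-⊥ : ∀ {n} (A : Subset n) → cap A ∅ ≈ 0#
  cap-⊥ []            = refl
  cap-⊥ (inside  ∷ A) = cap-⊥ A
  cap-⊥ (outside ∷ A) = cap-⊥ A

  π-⊥ : ∀ n → π {n} ∅ ≈ 1#
  π-⊥ zero    = refl
  π-⊥ (suc n) = π-⊥ n

  avoid≈0 : ∀ {n} {F : List (Subset n)} {A S} → A ∈ᴸ F → A ⊆ S → avoid F S ≈ 0#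
  avoid≈0 {F = A ∷ F} {S = S} (Any.here ≡.refl) A⊆S = trans (*-congʳ (+-congˡ (-‿cong (⊆⇒sub≈1 A S A⊆S))))
    (trans (*-congʳ (-‿inverseʳ 1#)) (zeroˡ _))
  avoid≈0 {F = A ∷ F} (Any.there A∈F)   A⊆S = trans (*-congˡ (avoid≈0 A∈F A⊆S)) (zeroʳ _)

-- Words in the generators, and their values.

module Words
  {c ℓ₁ ℓ₂ g ℓ} (ℝ : CompleteOrderedField c ℓ₁ ℓ₂)
  (G : Group g ℓ) {N : ℕ} (order : HasOrder G N)
  (p : CompleteOrderedField.Carrier ℝ)
  (0≤p : CompleteOrderedField._≤_ ℝ (CompleteOrderedField.0# ℝ) p)
  (p≤1 : CompleteOrderedField._≤_ ℝ p (CompleteOrderedField.1# ℝ))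
  where
  open OrderedField ℝ
  open ListSum ℝ
  open Expectation ℝ p
  open Correlation ℝ p 0≤p p≤1
  open SubsetWeights ℝ p 0≤p p≤1

  private
    module G = Group G
    module Gₚ = GroupProperties G
    open Inverse order using (to; from; to-cong; from-cong; strictlyInverseʳ; strictlyInverseˡ)

  -- A sign and the index of an element: `true` stands for the element, `false` for its inverse.
  -- Both signs are available under the same event that the index lies in `S`.
  Letter : Set
  Letter = Bool × Fin N

  Word : ℕ → Set
  Word = Vec Letter

  letters : List Letter
  letters = map (true ,_) (allFin N) ++ map (false ,_) (allFin N)

  -- The first letter varies innermost, so that `Σ-peel` sums over it with the rest of the word
  -- fixed.
  words : ∀ k → List (Word k)
  words zero    = [] ∷ []
  words (suc k) = concatMap (λ w → map (_∷ w) letters) (words k)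

  step : Letter → G.Carrier
  step (true  , i) = from i
  step (false , i) = from i G.⁻¹

  eval : ∀ {k} → Word k → G.Carrier
  eval []      = G.ε
  eval (l ∷ w) = step l G.∙ eval w

  value : ∀ {k} → Word k → Fin N
  value w = to (eval w)

  support : ∀ {k} → Word k → Subset N
  support []            = ∅
  support ((_ , i) ∷ w) = insert i (support w)

  -- Only indices are compared, so s followed by s⁻¹ on one index counts as a repetition: the
  -- support would be too small to have weight `p ^ k`.
  Distinct : ∀ {k} → Word k → Set
  Distinct []            = ⊤
  Distinct ((_ , i) ∷ w) = i ∉ support w × Distinct w

  distinct? : ∀ {k} (w : Word k) → Dec (Distinct w)
  distinct? []            = yes tt
  distinct? ((_ , i) ∷ w) = ¬? (i ∈? support w) ×-dec distinct? w

  ∈-letters : ∀ l → l ∈ᴸ letters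
  ∈-letters (true  , i) = ∈-++⁺ˡ (∈-map⁺ (true ,_) (∈-allFin i))
  ∈-letters (false , i) = ∈-++⁺ʳ (map (true ,_) (allFin N)) (∈-map⁺ (false ,_) (∈-allFin i))

  ∈-words : ∀ {k} (w : Word k) → w ∈ᴸ words k
  ∈-words []      = Any.here ≡.refl
  ∈-words (l ∷ w) = ∈-concat⁺′ (∈-map⁺ (_∷ w) (∈-letters l))
                               (∈-map⁺ (λ w → map (_∷ w) letters) (∈-words w))

  -- An edge from x to z is right multiplication by x⁻¹z, which is the element indexed in `S` or,
  -- when z⁻¹x is the one in `S`, its inverse.
  walk⇒word : ∀ {S k x y} → Cayley.Walk G order S k x y →
              ∃[ w ] support {k} w ⊆ S × x G.∙ eval w G.≈ y
  walk⇒word (GraphDistance.nil x≈y) = [] , (λ i∈⊥ → ⊥-elim (∉⊥ i∈⊥)) , G.trans (G.identityʳ _) x≈y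
  walk⇒word {S} {x = x} {y} (GraphDistance.cons {y = z} (_ , e) walk) with walk⇒word walk
  ... | w , w⊆S , zw≈y = extend e
    where
    append : ∀ l → proj₂ l ∈ S → x G.∙ step l G.≈ z → ∃[ w ] support w ⊆ S × x G.∙ eval w G.≈ y
    append l l∈S xl≈z = l ∷ w , insert-⊆ l∈S w⊆S ,
      G.trans (G.sym (G.assoc _ _ _)) (G.trans (G.∙-congʳ xl≈z) zw≈y)

    extend : _ ⊎ _ → ∃[ w ] support w ⊆ S × x G.∙ eval w G.≈ y
    extend (inj₁ x⁻¹z∈S) = append (true , to (x G.⁻¹ G.∙ z)) x⁻¹z∈S
      (G.trans (G.∙-congˡ (strictlyInverseʳ _))
      (G.trans (G.sym (G.assoc _ _ _)) (G.trans (G.∙-congʳ (G.inverseʳ x)) (G.identityˡ z))))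
    extend (inj₂ z⁻¹x∈S) = append (false , to (z G.⁻¹ G.∙ x)) z⁻¹x∈S
      (G.trans (G.∙-congˡ (G.trans (G.⁻¹-cong (strictlyInverseʳ _))
        (G.trans (Gₚ.⁻¹-anti-homo-∙ _ _) (G.∙-congˡ (Gₚ.⁻¹-involutive z)))))
      (G.trans (G.sym (G.assoc _ _ _)) (G.trans (G.∙-congʳ (G.inverseʳ x)) (G.identityˡ z))))

  family : ∀ {a k} {P : Pred (Word k) a} → Decidable₁ P → Fin N → List (Subset N)
  family {k = k} P? x = map support (filter (λ w → (value w ≟ x) ×-dec P? w) (words k))

  shorter generic degenerate : ℕ → Fin N → List (Subset N)
  shorter zero    x = []
  shorter (suc k) x = family {k = k} (λ _ → yes tt) x ++ shorter k x
  generic    d x = family {k = d} distinct? x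
  degenerate d x = family {k = d} (λ w → ¬? (distinct? w)) x ++ shorter d x

  ∈-family : ∀ {a k} {P : Pred (Word k) a} (P? : Decidable₁ P) {x} w → value w ≡ x → P w →
             support w ∈ᴸ family P? x
  ∈-family P? w w↦x Pw = ∈-map⁺ support (∈-filter⁺ (λ w → (value w ≟ _) ×-dec P? w) (∈-words w) (w↦x , Pw))

  -- Only distances from the identity are used. A walk to `x` spells a word; if its length is `d`
  -- and its letters are distinct, the generic factor vanishes, and in all other cases the
  -- degenerate one.
  diameter⇒covered : ∀ d {S} → Cayley.Diameter≤ G order S d →
                     ∀ x → avoid (generic d x) S * avoid (degenerate d x) S ≈ 0#
  diameter⇒covered d {S} diam x with diam G.ε (from x)
  ... | k , k≤d , walk , _ with walk⇒word walk
  ... | w , w⊆S , εw≈x = go (ℕ.≤⇒≤′ k≤d) w w⊆S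
          (≡.trans (to-cong (G.trans (G.sym (G.identityˡ _)) εw≈x)) (strictlyInverseˡ x))
    where
    go : ∀ {k} → k ℕ.≤′ d → (w : Word k) → support w ⊆ S → value w ≡ x →
         avoid (generic d x) S * avoid (degenerate d x) S ≈ 0#
    go ℕ.≤′-refl w w⊆S w↦x with distinct? w
    ... | yes dw = trans (*-congʳ (avoid≈0 (∈-family distinct? w w↦x dw) w⊆S)) (zeroˡ _)
    ... | no ¬dw = trans (*-congˡ (avoid≈0 (∈-++⁺ˡ (∈-family (λ w → ¬? (distinct? w)) w w↦x ¬dw)) w⊆S)) (zeroʳ _)
    go {k} (ℕ.≤′-step k≤) w w⊆S w↦x =
      trans (*-congˡ (avoid≈0 (∈-++⁺ʳ (family {k = d} (λ w → ¬? (distinct? w)) x) (∈-shorter (ℕ.≤⇒≤′ (ℕ.s≤s (ℕ.≤′⇒≤ k≤))))) w⊆S)) (zeroʳ _)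
      where
      ∈-shorter : ∀ {e} → suc k ℕ.≤′ e → support w ∈ᴸ shorter e x
      ∈-shorter ℕ.≤′-refl               = ∈-++⁺ˡ (∈-family (λ _ → yes tt) w w↦x tt)
      ∈-shorter (ℕ.≤′-step {n = e} k<e) =
        ∈-++⁺ʳ (family {k = e} (λ _ → yes tt) x) (∈-shorter k<e)

  Σ-letters± : ∀ f → Σ letters f ≈ Σ (allFin N) (λ i → f (true , i)) + Σ (allFin N) (λ i → f (false , i))
  Σ-letters± f = trans (Σ-++ (map (true ,_) (allFin N)) _ f)
    (+-cong (Σ-map (true ,_) (allFin N) f) (Σ-map (false ,_) (allFin N) f))

  Σ-letters : ∀ (f : Fin N → Carrier) → Σ letters (λ l → f (proj₂ l)) ≈ fromℕ 2 * Σ (allFin N) f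
  Σ-letters f = trans (Σ-letters± (λ l → f (proj₂ l)))
    ((solve 1 (λ x → x :+ x := (con (ℤ.+ 1) :+ (con (ℤ.+ 1) :+ con (ℤ.+ 0))) :* x) refl _))

  Σ-words-suc : ∀ k (f : Word (suc k) → Carrier) →
                Σ (words (suc k)) f ≈ Σ (words k) (λ w → Σ letters (λ l → f (l ∷ w)))
  Σ-words-suc k f = go (words k)
    where
    go : ∀ ws → Σ (concatMap (λ w → map (_∷ w) letters) ws) f ≈ Σ ws (λ w → Σ letters (λ l → f (l ∷ w)))
    go []       = refl
    go (w ∷ ws) = trans (Σ-++ (map (_∷ w) letters) _ f) (+-cong (Σ-map (_∷ w) letters f) (go ws))

  Σ-peel : ∀ k {f : Word (suc k) → Carrier} {h} → (∀ w → Σ letters (λ l → f (l ∷ w)) ≤ h w) →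
           Σ (words (suc k)) f ≤ Σ (words k) h
  Σ-peel k h = ≤-trans (≤-reflexive (Σ-words-suc k _)) (Σ-mono (words k) h)

  private
    from-injective : ∀ {i j} → from i G.≈ from j → i ≡ j
    from-injective {i} {j} h = ≡.trans (≡.sym (strictlyInverseˡ i)) (≡.trans (to-cong h) (strictlyInverseˡ j))

    to-injective : ∀ {x y} → to x ≡ to y → x G.≈ y
    to-injective {x} {y} h = G.trans (G.sym (strictlyInverseʳ x)) (G.trans (from-cong h) (strictlyInverseʳ y))

  -- Right translation is injective, so the first letter is determined by its sign,
  -- the rest of the word and the value.
  Σ-first-letter : ∀ {k} (w : Word k) y → Σ letters (λ l → ⟦ value (l ∷ w) ≟ y ⟧) ≤ fromℕ 2
  Σ-first-letter w y = ≤-trans (≤-reflexive (Σ-letters± (λ l → ⟦ value (l ∷ w) ≟ y ⟧)))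
    (≤-trans (+-mono-≤ (Σ-⟦⟧-unique (λ i → value ((true , i) ∷ w) ≟ y) (λ hi hj → unique⁺ (≡.trans hi (≡.sym hj))))
                       (Σ-⟦⟧-unique (λ i → value ((false , i) ∷ w) ≟ y) (λ hi hj → unique⁻ (≡.trans hi (≡.sym hj)))))
      (≤-reflexive (+-congˡ (sym (+-identityʳ 1#)))))
    where
    unique⁺ : ∀ {i j} → value ((true , i) ∷ w) ≡ value ((true , j) ∷ w) → i ≡ j
    unique⁺ h = from-injective (Gₚ.∙-cancelʳ _ _ _ (to-injective h))

    unique⁻ : ∀ {i j} → value ((false , i) ∷ w) ≡ value ((false , j) ∷ w) → i ≡ j
    unique⁻ h = from-injective (Gₚ.⁻¹-injective (Gₚ.∙-cancelʳ _ _ _ (to-injective h)))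

  -- The value that the remaining word must have after the first letter `l` if the whole word has
  -- value `y`.
  rest : Letter → Fin N → Fin N
  rest l y = to (step l G.⁻¹ G.∙ from y)

  value-rest : ∀ {k} l (w : Word k) {y} → value (l ∷ w) ≡ y → value w ≡ rest l y
  value-rest l w ≡.refl = to-cong (G.sym (G.trans (G.∙-congˡ (strictlyInverseʳ _))
    (G.trans (G.sym (G.assoc _ _ _)) (G.trans (G.∙-congʳ (G.inverseˡ _)) (G.identityˡ _)))))

  Σ-value : ∀ {k} (w : Word k) → Σ (allFin N) (λ y → ⟦ value w ≟ y ⟧) ≤ 1#
  Σ-value w = Σ-⟦⟧-unique (λ y → value w ≟ y) (λ hi hj → ≡.trans (≡.sym hi) hj)

-- Weighted counts of words.

module Counting
  {c ℓ₁ ℓ₂ g ℓ} (ℝ : CompleteOrderedField c ℓ₁ ℓ₂)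
  (G : Group g ℓ) {N : ℕ} (order : HasOrder G N)
  (p : CompleteOrderedField.Carrier ℝ)
  (0≤p : CompleteOrderedField._≤_ ℝ (CompleteOrderedField.0# ℝ) p)
  (p≤1 : CompleteOrderedField._≤_ ℝ p (CompleteOrderedField.1# ℝ)) (d : ℕ) (1≤d : 1 ℕ.≤ d)
  where
  open OrderedField ℝ
  open ListSum ℝ
  open Expectation ℝ p
  open Correlation ℝ p 0≤p p≤1
  open SubsetWeights ℝ p 0≤p p≤1
  open Words ℝ G order p 0≤p p≤1

  -- For a set `A` of at most `d` indices, `θ` bounds the number of signed letters in `A`. Given
  -- `A ⊆ S`, the expected number of available letters is at most `β`: those in `A`, and a fraction
  -- `p` of all `2 N`.
  θ β : Carrier
  θ = fromℕ 2 * fromℕ d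
  β = fromℕ 2 * (p * fromℕ N) + θ

  0≤2 : 0# ≤ fromℕ 2
  0≤2 = fromℕ-nonneg 2

  0≤θ : 0# ≤ θ
  0≤θ = *-nonneg 0≤2 (fromℕ-nonneg d)

  1≤θ : 1# ≤ θ
  1≤θ = ≤-resp (*-identityˡ 1#) refl (*-mono-≤ 0≤1 0≤1 (1≤fromℕ {2} (ℕ.s≤s ℕ.z≤n)) (1≤fromℕ 1≤d))

  θ≤β : θ ≤ β
  θ≤β = ≤-by _ (+-comm _ _) (*-nonneg 0≤2 (*-nonneg 0≤p (fromℕ-nonneg N)))

  1≤β : 1# ≤ β
  1≤β = ≤-trans 1≤θ θ≤β

  0<β : 0# < β
  0<β = <-≤-trans 0<1 1≤β

  0≤β : 0# ≤ β
  0≤β = <⇒≤ 0<β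

  Σ-allFin-const : ∀ k → Σ (allFin N) (λ _ → k) ≈ fromℕ N * k
  Σ-allFin-const k = trans (Σ-const (allFin N) k) (*-congʳ (reflexive (≡.cong fromℕ (length-tabulate {n = N} (λ i → i)))))

  #words : ℕ → ℕ
  #words k = (2 ℕ.* N) ℕ.^ k

  Σ-words-const : ∀ k x → Σ (words k) (λ _ → x) ≈ fromℕ (#words k) * x
  Σ-words-const zero    x = trans (+-identityʳ x) (sym (trans (*-congʳ (+-identityʳ 1#)) (*-identityˡ x)))
  Σ-words-const (suc k) x = trans (Σ-words-suc k _)
    (trans (Σ-cong (words k) (λ _ → trans (Σ-letters (λ _ → x)) (*-congˡ (Σ-allFin-const x))))
    (trans (Σ-words-const k _)
    (trans (solve 4 (λ a b c x → a :* (b :* (c :* x)) := ((b :* c) :* a) :* x) refl _ _ _ x)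
      (*-congʳ (sym (trans (fromℕ-* (2 ℕ.* N) _) (*-congʳ (fromℕ-* 2 N))))))))

  Σ-words-value : ∀ k y → Σ (words (suc k)) (λ w → ⟦ value w ≟ y ⟧) ≤ fromℕ (2 ℕ.* #words k)
  Σ-words-value k y = ≤-trans (Σ-peel k (λ w → Σ-first-letter w y))
    (≤-reflexive (trans (Σ-words-const k (fromℕ 2)) (trans (*-comm _ _) (sym (fromℕ-* 2 (#words k))))))

  module _ (A : Subset N) (card≤d : card A ≤ fromℕ d) where

    private
      m f : Letter → Carrier
      m l = mem A (proj₂ l)
      f l = φ A (proj₂ l)

      0≤m : ∀ l → 0# ≤ m l
      0≤m l = mem-nonneg A (proj₂ l)

    Σ-mem : Σ letters m ≤ θ
    Σ-mem = ≤-trans (≤-reflexive (Σ-letters (mem A))) (*-monoʳ-≤ 0≤2 card≤d)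

    Σ-φ : Σ letters f ≤ β
    Σ-φ = ≤-trans (Σ-mono letters (λ l → φ-≤mem+p A (proj₂ l)))
      (≤-trans (≤-reflexive (trans (Σ-letters (λ i → mem A i + p)) (*-congˡ (trans (Σ-+ (allFin N) _ _) (+-congˡ (Σ-allFin-const p))))))
      (≤-trans (*-monoʳ-≤ 0≤2 (+-monoˡ-≤ _ card≤d))
        (≤-reflexive (solve 4 (λ t d n p → t :* (d :+ n :* p) := t :* (p :* n) :+ t :* d) refl (fromℕ 2) (fromℕ d) (fromℕ N) p))))

    -- The weight of a word conditioned on A; its part Π with all letters in A, the
    -- remaining part Ψ, and the number O of letters in A.
    Φ Π Ψ O : ∀ {k} → Word k → Carrier
    Φ []      = 1#
    Φ (l ∷ w) = f l * Φ w
    Π []      = 1#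
    Π (l ∷ w) = m l * Π w
    Ψ []      = 0#
    Ψ (l ∷ w) = p * (1# - m l) * Φ w + m l * Ψ w
    O []      = 0#
    O (l ∷ w) = m l + O w

    Φ-nonneg : ∀ {k} (w : Word k) → 0# ≤ Φ w
    Φ-nonneg []      = 0≤1
    Φ-nonneg (l ∷ w) = *-nonneg (φ-nonneg A _) (Φ-nonneg w)

    Π-nonneg : ∀ {k} (w : Word k) → 0# ≤ Π w
    Π-nonneg []      = 0≤1
    Π-nonneg (l ∷ w) = *-nonneg (0≤m l) (Π-nonneg w)

    Ψ-nonneg : ∀ {k} (w : Word k) → 0# ≤ Ψ w
    Ψ-nonneg []      = ≤-refl
    Ψ-nonneg (l ∷ w) = +-nonneg (*-nonneg (*-nonneg 0≤p (1-mem-nonneg A _)) (Φ-nonneg w))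
                                (*-nonneg (0≤m l) (Ψ-nonneg w))

    O-nonneg : ∀ {k} (w : Word k) → 0# ≤ O w
    O-nonneg []      = ≤-refl
    O-nonneg (l ∷ w) = +-nonneg (0≤m l) (O-nonneg w)

    O-≤ : ∀ {k} (w : Word k) → O w ≤ fromℕ k
    O-≤ []      = ≤-refl
    O-≤ (l ∷ w) = +-mono-≤ (mem-≤1 A _) (O-≤ w)

    Φ≈Π+Ψ : ∀ {k} (w : Word k) → Φ w ≈ Π w + Ψ w
    Φ≈Π+Ψ []      = sym (+-identityʳ 1#)
    Φ≈Π+Ψ (l ∷ w) = trans (solve 3 (λ p m x → (m :+ p :* (con (ℤ.+ 1) :- m)) :* x :=
        m :* x :+ p :* (con (ℤ.+ 1) :- m) :* x) refl p (m l) (Φ w))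
      (trans (+-congʳ (*-congˡ (Φ≈Π+Ψ w)))
        (solve 4 (λ m a b c → m :* (a :+ b) :+ c := m :* a :+ (c :+ m :* b)) refl (m l) (Π w) (Ψ w) _))

    Σ-Φ : ∀ k → Σ (words k) Φ ≤ β ^ k
    Σ-Φ zero    = ≤-reflexive (+-identityʳ 1#)
    Σ-Φ (suc k) = ≤-trans (Σ-peel k (λ w → ≤-trans (≤-reflexive (Σ-*ʳ letters (Φ w) f))
        (*-monoˡ-≤ (Φ-nonneg w) Σ-φ)))
      (≤-trans (≤-reflexive (Σ-*ˡ (words k) β Φ)) (*-monoʳ-≤ 0≤β (Σ-Φ k)))

    Σ-Π : ∀ k → Σ (words k) Π ≤ θ ^ k
    Σ-Π zero    = ≤-reflexive (+-identityʳ 1#)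
    Σ-Π (suc k) = ≤-trans (Σ-peel k (λ w → ≤-trans (≤-reflexive (Σ-*ʳ letters (Π w) m))
        (*-monoˡ-≤ (Π-nonneg w) Σ-mem)))
      (≤-trans (≤-reflexive (Σ-*ˡ (words k) θ Π)) (*-monoʳ-≤ 0≤θ (Σ-Π k)))

    Σ-OΠ : ∀ k → Σ (words k) (λ w → O w * Π w) ≤ fromℕ k * θ ^ k
    Σ-OΠ k = ≤-trans (Σ-mono (words k) (λ w → *-monoˡ-≤ (Π-nonneg w) (O-≤ w)))
      (≤-trans (≤-reflexive (Σ-*ˡ (words k) (fromℕ k) Π)) (*-monoʳ-≤ (fromℕ-nonneg k) (Σ-Π k)))

    -- One of the `k` positions is marked and carries a letter of `A`, for which there are `θ`
    -- choices; each other position contributes `β`. The factor `β` on the left replaces the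
    -- exponent `k - 1`, which would be awkward at `k = 0`.
    Σ-OΦ : ∀ k → Σ (words k) (λ w → O w * Φ w) * β ≤ fromℕ k * θ * β ^ k
    Σ-OΦ zero    = ≤-reflexive (solve 2 (λ b t → (con (ℤ.+ 0) :* con (ℤ.+ 1) :+ con (ℤ.+ 0)) :* b :=
                     con (ℤ.+ 0) :* t :* con (ℤ.+ 1)) refl β θ)
    Σ-OΦ (suc k) = ≤-trans (*-monoˡ-≤ 0≤β (≤-trans
        (Σ-peel k {h = λ w → θ * Φ w + β * (O w * Φ w)} peel)
        (≤-reflexive (trans (Σ-+ (words k) _ _) (+-cong (Σ-*ˡ (words k) θ _) (Σ-*ˡ (words k) β _))))))
      (≤-trans (≤-reflexive (solve 4 (λ t x b y → (t :* x :+ b :* y) :* b := t :* x :* b :+ b :* (y :* b)) refl θ _ β _))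
      (≤-trans (+-mono-≤ (*-monoˡ-≤ 0≤β (*-monoʳ-≤ 0≤θ (Σ-Φ k))) (*-monoʳ-≤ 0≤β (Σ-OΦ k)))
        (≤-reflexive (solve 4 (λ t b x k → t :* x :* b :+ b :* (k :* t :* x) := (con (ℤ.+ 1) :+ k) :* t :* (b :* x))
          refl θ β (β ^ k) (fromℕ k)))))
      where
      peel : ∀ w → Σ letters (λ l → O (l ∷ w) * Φ (l ∷ w)) ≤ θ * Φ w + β * (O w * Φ w)
      peel w = ≤-trans (Σ-mono letters {g = λ l → m l * Φ w + f l * (O w * Φ w)} (λ l →
          ≤-by (m l * Φ w * (1# - f l))
            (solve 4 (λ m f o x → m :* x :+ f :* (o :* x) := (m :+ o) :* (f :* x) :+ m :* x :* (con (ℤ.+ 1) :- f))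
              refl (m l) (f l) (O w) (Φ w))
            (*-nonneg (*-nonneg (0≤m l) (Φ-nonneg w)) (x≤y⇒0≤y-x (φ-≤1 A (proj₂ l))))))
        (≤-trans (≤-reflexive (trans (Σ-+ letters _ _) (+-cong (Σ-*ʳ letters _ m) (Σ-*ʳ letters _ f))))
          (+-mono-≤ (*-monoˡ-≤ (Φ-nonneg w) Σ-mem) (*-monoˡ-≤ (*-nonneg (O-nonneg w) (Φ-nonneg w)) Σ-φ)))

    -- A first letter outside A is determined by the value of the word; a first letter
    -- in A can be chosen in at most θ ways.
    Σ-value-step : ∀ k {X Z : Word k → Carrier} {h : Word (suc k) → Carrier} {y s B} →
      (∀ w → 0# ≤ X w) → (∀ w → 0# ≤ Z w) → 0# ≤ s →
      (∀ l w → h (l ∷ w) ≤ X w + m l * Z w) →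
      (∀ y → Σ (words k) (λ w → ⟦ value w ≟ y ⟧ * Z w) * s ≤ B) →
      Σ (words (suc k)) (λ w → ⟦ value w ≟ y ⟧ * h w) * s ≤ fromℕ 2 * Σ (words k) X * s + θ * B
    Σ-value-step k {X} {Z} {h} {y} {s} {B} 0≤X 0≤Z 0≤s h≤ Z≤B = ≤-trans
      (*-monoˡ-≤ 0≤s (≤-trans (Σ-peel k {h = λ w → fromℕ 2 * X w + Σ letters (λ l → m l * R l w)} peel)
        (≤-trans (≤-reflexive (trans (Σ-+ (words k) _ _) (+-cong (Σ-*ˡ (words k) (fromℕ 2) X)
          (trans (Σ-swap (words k) letters (λ w l → m l * R l w))
                 (Σ-cong letters (λ l → Σ-*ˡ (words k) (m l) (R l))))))) ≤-refl)))
      (≤-trans (≤-reflexive (trans (distribʳ s _ _) (+-congˡ (trans (sym (Σ-*ʳ letters s _))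
          (Σ-cong letters (λ l → *-assoc _ _ _))))))
        (+-monoʳ-≤ _ (≤-trans (Σ-mono letters (λ l → *-monoʳ-≤ (0≤m l) (Z≤B (rest l y))))
          (≤-trans (≤-reflexive (Σ-*ʳ letters B m)) (*-monoˡ-≤ 0≤B Σ-mem)))))
      where
      R : Letter → Word k → Carrier
      R l w = ⟦ value w ≟ rest l y ⟧ * Z w

      0≤B : 0# ≤ B
      0≤B = ≤-trans (*-nonneg (Σ-nonneg (words k) (λ w → *-nonneg (⟦⟧-nonneg (value w ≟ y)) (0≤Z w))) 0≤s) (Z≤B y)

      peel : ∀ w → Σ letters (λ l → ⟦ value (l ∷ w) ≟ y ⟧ * h (l ∷ w)) ≤
                   fromℕ 2 * X w + Σ letters (λ l → m l * R l w)
      peel w = ≤-trans (Σ-mono letters {g = λ l → ⟦ value (l ∷ w) ≟ y ⟧ * X w + m l * R l w} (λ l →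
          ≤-trans (*-monoʳ-≤ (⟦⟧-nonneg (value (l ∷ w) ≟ y)) (h≤ l w))
          (≤-trans (≤-reflexive (distribˡ _ _ _)) (+-monoʳ-≤ _
            (≤-trans (≤-reflexive (solve 3 (λ a m z → a :* (m :* z) := m :* (a :* z)) refl _ (m l) (Z w)))
              (*-monoʳ-≤ (0≤m l) (*-monoˡ-≤ (0≤Z w) (⟦⟧-mono (value (l ∷ w) ≟ y) (value w ≟ rest l y) (value-rest l w)))))))))
        (≤-trans (≤-reflexive (trans (Σ-+ letters _ _) (+-congʳ (Σ-*ʳ letters (X w) _))))
          (+-monoˡ-≤ _ (*-monoˡ-≤ (0≤X w) (Σ-first-letter w y))))

    -- Consider the position of the first letter outside `A`. The value and the other letters
    -- determine that letter up to its sign, so it contributes only `2 p`; each letter before it is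
    -- in `A` and contributes at most `θ ≤ β`, each later one at most `β`.
    Σ-Ψ : ∀ k y → Σ (words k) (λ w → ⟦ value w ≟ y ⟧ * Ψ w) * β ≤ fromℕ k * (fromℕ 2 * p) * β ^ k
    Σ-Ψ zero    y = ≤-reflexive (solve 3 (λ v b p → let zro = con (ℤ.+ 0); one = con (ℤ.+ 1) in
      (v :* zro :+ zro) :* b := zro :* ((one :+ (one :+ zro)) :* p) :* one) refl _ β p)
    Σ-Ψ (suc k) y = ≤-trans (Σ-value-step k {X = λ w → p * Φ w} (λ w → *-nonneg 0≤p (Φ-nonneg w)) Ψ-nonneg 0≤β
        (λ l w → ≤-by (p * m l * Φ w)
          (solve 4 (λ p m x y → p :* x :+ m :* y := (p :* (con (ℤ.+ 1) :- m) :* x :+ m :* y) :+ p :* m :* x)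
            refl p (m l) (Φ w) (Ψ w))
          (*-nonneg (*-nonneg 0≤p (0≤m l)) (Φ-nonneg w)))
        (Σ-Ψ k))
      (≤-trans (+-mono-≤ (*-monoˡ-≤ 0≤β (*-monoʳ-≤ 0≤2 (≤-trans (≤-reflexive (Σ-*ˡ (words k) p Φ)) (*-monoʳ-≤ 0≤p (Σ-Φ k)))))
                         (*-monoˡ-≤ (*-nonneg (*-nonneg (fromℕ-nonneg k) (*-nonneg 0≤2 0≤p)) (^-nonneg k 0≤β)) θ≤β))
        (≤-reflexive (solve 5 (λ t p x b k → t :* (p :* x) :* b :+ b :* (k :* (t :* p) :* x)
                               := (con (ℤ.+ 1) :+ k) :* (t :* p) :* (b :* x)) refl (fromℕ 2) p (β ^ k) β (fromℕ k))))

    -- As for `Σ-Ψ`, with a second position marked for a letter of `A`, which costs `θ` instead of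
    -- `β`; the pairs of positions give the factor `k²`. The constant 4 leaves slack, which the
    -- induction step discards.
    Σ-OΨ : ∀ k y → Σ (words k) (λ w → ⟦ value w ≟ y ⟧ * (O w * Ψ w)) * (β * β) ≤
                   fromℕ k * fromℕ k * (fromℕ 4 * (p * θ)) * β ^ k
    Σ-OΨ zero    y = ≤-reflexive (solve 3 (λ v b p → let zro = con (ℤ.+ 0) in
      (v :* (zro :* zro) :+ zro) :* b := zro :* zro :* p :* con (ℤ.+ 1)) refl _ _ _)
    Σ-OΨ (suc k) y = ≤-trans (Σ-value-step k {X = λ w → p * (O w * Φ w)} {Z = λ w → Ψ w + O w * Ψ w}
        (λ w → *-nonneg 0≤p (*-nonneg (O-nonneg w) (Φ-nonneg w)))
        (λ w → +-nonneg (Ψ-nonneg w) (*-nonneg (O-nonneg w) (Ψ-nonneg w)))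
        (*-nonneg 0≤β 0≤β) step-≤ Z-≤)
      (≤-trans (+-monoˡ-≤ _ (≤-trans
          (≤-reflexive (trans (*-congʳ (*-congˡ (Σ-*ˡ (words k) p _)))
            (solve 4 (λ t p s b → t :* (p :* s) :* (b :* b) := t :* (p :* b) :* (s :* b)) refl (fromℕ 2) p _ β)))
          (*-monoʳ-≤ (*-nonneg 0≤2 (*-nonneg 0≤p 0≤β)) (Σ-OΦ k))))
      (≤-by (fromℕ 4 * (p * θ) * x * (fromℕ k * fromℕ k * (β - θ) + (fromℕ k + 1#) * β))
        (solve 5 (λ p t b x k → let one = con (ℤ.+ 1); zro = con (ℤ.+ 0); two = one :+ (one :+ zro); four = one :+ (one :+ two) in
          (one :+ k) :* (one :+ k) :* (four :* (p :* t)) :* (b :* x) :=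
          (two :* (p :* b) :* (k :* t :* x) :+
           t :* (b :* (k :* (two :* p) :* x) :+ k :* k :* (four :* (p :* t)) :* x)) :+
          four :* (p :* t) :* x :* (k :* k :* (b :- t) :+ (k :+ one) :* b))
          refl p θ β x (fromℕ k))
        (*-nonneg (*-nonneg (*-nonneg (fromℕ-nonneg 4) (*-nonneg 0≤p 0≤θ)) (^-nonneg k 0≤β))
          (+-nonneg (*-nonneg (*-nonneg (fromℕ-nonneg k) (fromℕ-nonneg k)) (x≤y⇒0≤y-x θ≤β))
                    (*-nonneg (+-nonneg (fromℕ-nonneg k) 0≤1) 0≤β)))))
      where
      x = β ^ k
      step-≤ : ∀ l w → O (l ∷ w) * Ψ (l ∷ w) ≤ p * (O w * Φ w) + m l * (Ψ w + O w * Ψ w)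
      step-≤ l w = ≤-by (p * (m l * (O w * Φ w)))
        -- Idempotence of `m l` is not a ring identity, so it is inserted by hand between two calls
        -- of the solver. It turns `m (1 - m)` into zero and makes the new letter count only in the
        -- branch where it lies in `A`.
        (trans (solve 5 (λ p m o x y → p :* (o :* x) :+ m :* (y :+ o :* y) :=
                  (p :* (m :- m) :* x :+ p :* (con (ℤ.+ 1) :- m) :* (o :* x) :+ m :* y :+ o :* (m :* y)) :+ p :* (m :* (o :* x)))
                  refl p (m l) (O w) (Φ w) (Ψ w))
        (trans (+-congʳ (+-congʳ (+-cong (+-congʳ (*-congʳ (*-congˡ (+-congˡ (-‿cong (sym m²))))))
                                         (*-congʳ (sym m²)))))
          (solve 5 (λ p m o x y → (p :* (m :- m :* m) :* x :+ p :* (con (ℤ.+ 1) :- m) :* (o :* x) :+ (m :* m) :* y :+ o :* (m :* y)) :+ p :* (m :* (o :* x)) :=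
             (m :+ o) :* (p :* (con (ℤ.+ 1) :- m) :* x :+ m :* y) :+ p :* (m :* (o :* x)))
             refl p (m l) (O w) (Φ w) (Ψ w))))
        (*-nonneg 0≤p (*-nonneg (0≤m l) (*-nonneg (O-nonneg w) (Φ-nonneg w))))
        where
        m² : m l * m l ≈ m l
        m² = mem-idem A (proj₂ l)

      Z-≤ : ∀ y → Σ (words k) (λ w → ⟦ value w ≟ y ⟧ * (Ψ w + O w * Ψ w)) * (β * β) ≤
            β * (fromℕ k * (fromℕ 2 * p) * x) + fromℕ k * fromℕ k * (fromℕ 4 * (p * θ)) * x
      Z-≤ y = ≤-trans (≤-reflexive (trans (*-congʳ (trans (Σ-cong (words k) (λ w → distribˡ _ _ _)) (Σ-+ (words k) _ _)))
          (solve 3 (λ a b c → (a :+ c) :* (b :* b) := b :* (a :* b) :+ c :* (b :* b)) refl _ β _)))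
        (+-mono-≤ (*-monoʳ-≤ 0≤β (Σ-Ψ k y)) (Σ-OΨ k y))

    cap-support : ∀ {k} (w : Word k) → cap A (support w) ≤ O w
    cap-support []            = ≤-reflexive (cap-⊥ A)
    cap-support ((_ , i) ∷ w) = ≤-trans (cap-insert A (support w) i) (+-monoʳ-≤ _ (cap-support w))

    -- Because the letters are distinct, each one inserted is new to the letters already present, so
    -- whether it costs a factor `p` depends on `A` alone.
    π-∪-support : ∀ {k} (w : Word k) → Distinct w → π (A ∪ support w) ≈ π A * Φ w
    π-∪-support []            _          = trans (reflexive (≡.cong π (∪-identityʳ A))) (sym (*-identityʳ _))
    π-∪-support ((_ , i) ∷ w) (i∉w , dw) = trans (reflexive (≡.cong π (∪-insert A (support w) i)))
      (trans (π-insert (A ∪ support w) i)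
      (trans (*-cong (+-cong (mem-∪ A (support w) i∉w) (*-congˡ (+-congˡ (-‿cong (mem-∪ A (support w) i∉w)))))
                     (π-∪-support w dw))
        (solve 3 (λ f a x → f :* (a :* x) := a :* (f :* x)) refl (φ A i) (π A) (Φ w))))

    dep-support : ∀ {k} (w : Word k) → Distinct w → dep A (support w) ≤ π A * (O w * Π w + O w * Ψ w)
    dep-support w dw = ≤-trans
      (*-mono-≤ (cap-nonneg A (support w)) (π-nonneg (A ∪ support w)) (cap-support w) (≤-reflexive (π-∪-support w dw)))
      (≤-reflexive (trans (*-congˡ (*-congˡ (Φ≈Π+Ψ w)))
        (solve 4 (λ o a x y → o :* (a :* (x :+ y)) := a :* (o :* x :+ o :* y)) refl (O w) (π A) (Π w) (Ψ w))))

  card-support : ∀ {k} (w : Word k) → card (support w) ≤ fromℕ k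
  card-support []            = ≤-reflexive (card-⊥ N)
  card-support ((_ , i) ∷ w) = ≤-trans (card-insert (support w) i) (+-monoʳ-≤ 1# (card-support w))

  card-support-≤d : ∀ {k} → k ℕ.≤ d → (w : Word k) → card (support w) ≤ fromℕ d
  card-support-≤d k≤d w = ≤-trans (card-support w) (fromℕ-mono-≤ k≤d)

  π-support : ∀ {k} (w : Word k) → Distinct w → π (support w) ≈ p ^ k
  π-support []            _          = π-⊥ N
  π-support ((_ , i) ∷ w) (i∉w , dw) = trans (π-insert (support w) i)
    (*-cong (trans (+-cong (∉⇒mem≈0 i∉w) (*-congˡ (+-congˡ (-‿cong (∉⇒mem≈0 i∉w)))))
              (solve 1 (λ p → con (ℤ.+ 0) :+ p :* (con (ℤ.+ 1) :- con (ℤ.+ 0)) := p) refl p))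
            (π-support w dw))

  π-peel : ∀ {k} → k ℕ.≤ d → (w : Word k) → Σ letters (λ l → π (insert (proj₂ l) (support w))) ≤ β * π (support w)
  π-peel k≤d w = ≤-trans
    (≤-reflexive (trans (Σ-cong letters (λ l → π-insert (support w) (proj₂ l))) (Σ-*ʳ letters _ _)))
    (*-monoˡ-≤ (π-nonneg (support w)) (Σ-φ (support w) (card-support-≤d k≤d w)))

  Σ-π : ∀ k → k ℕ.≤ d → Σ (words k) (λ w → π (support w)) ≤ β ^ k
  Σ-π zero    _   = ≤-reflexive (trans (+-identityʳ _) (π-⊥ N))
  Σ-π (suc k) k<d = ≤-trans (Σ-peel k (π-peel (ℕ.<⇒≤ k<d)))
    (≤-trans (≤-reflexive (Σ-*ˡ (words k) β _)) (*-monoʳ-≤ 0≤β (Σ-π k (ℕ.<⇒≤ k<d))))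

  -- Either the first letter already occurs in the rest, which leaves at most `θ` choices and costs
  -- no power of `p`, or the repetition lies in the rest. The factor `β` on the left again stands
  -- for an exponent `k - 1`.
  Σ-repeated : ∀ k → k ℕ.≤ d → Σ (words k) (λ w → ⟦ ¬? (distinct? w) ⟧ * π (support w)) * β ≤ fromℕ k * θ * β ^ k
  Σ-repeated zero    _   = ≤-reflexive (solve 3 (λ x b t → let zro = con (ℤ.+ 0) in
    (zro :* x :+ zro) :* b := zro :* t :* con (ℤ.+ 1)) refl (π {N} ∅) β θ)
  Σ-repeated (suc k) k<d = ≤-trans (*-monoˡ-≤ 0≤β (≤-trans
      (Σ-peel k {h = λ w → θ * π (support w) + β * (⟦ ¬? (distinct? w) ⟧ * π (support w))} peel)
      (≤-trans (≤-reflexive (trans (Σ-+ (words k) _ _) (+-cong (Σ-*ˡ (words k) θ _) (Σ-*ˡ (words k) β _)))) ≤-refl)))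
    (≤-trans (≤-reflexive (solve 4 (λ t x b y → (t :* x :+ b :* y) :* b := t :* x :* b :+ b :* (y :* b)) refl θ _ β _))
    (≤-trans (+-mono-≤ (*-monoˡ-≤ 0≤β (*-monoʳ-≤ 0≤θ (Σ-π k (ℕ.<⇒≤ k<d)))) (*-monoʳ-≤ 0≤β (Σ-repeated k (ℕ.<⇒≤ k<d))))
      (≤-reflexive (solve 4 (λ t b x k → t :* x :* b :+ b :* (k :* t :* x) := (con (ℤ.+ 1) :+ k) :* t :* (b :* x))
        refl θ β (β ^ k) (fromℕ k)))))
    where
    π-insert-≤ : ∀ A i → π (insert i A) ≤ π A
    π-insert-≤ A i = ≤-trans (≤-reflexive (π-insert A i))
      (≤-resp refl (*-identityˡ _) (*-monoˡ-≤ (π-nonneg A) (φ-≤1 A i)))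

    pointwise : ∀ (w : Word k) l → ⟦ ¬? (distinct? (l ∷ w)) ⟧ * π (support (l ∷ w)) ≤
                mem (support w) (proj₂ l) * π (support w) + ⟦ ¬? (distinct? w) ⟧ * π (support (l ∷ w))
    pointwise w (b , i) with i ∈? support w | distinct? w
    ... | yes i∈w | dw = ≤-trans
      (≤-resp (sym (*-identityˡ _)) (sym (trans (*-congʳ (∈⇒mem≈1 i∈w)) (*-identityˡ _))) (π-insert-≤ (support w) i))
      (≤-by _ refl (*-nonneg (⟦⟧-nonneg (¬? dw)) (π-nonneg (insert i (support w)))))
    ... | no  i∉w | yes dw = ≤-trans (≤-reflexive (zeroˡ _))
      (+-nonneg (*-nonneg (mem-nonneg (support w) i) (π-nonneg (support w))) (≤-reflexive (sym (zeroˡ _))))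
    ... | no  i∉w | no ¬dw = ≤-by _ (+-comm _ _) (*-nonneg (mem-nonneg (support w) i) (π-nonneg (support w)))

    peel : ∀ (w : Word k) → Σ letters (λ l → ⟦ ¬? (distinct? (l ∷ w)) ⟧ * π (support (l ∷ w))) ≤
           θ * π (support w) + β * (⟦ ¬? (distinct? w) ⟧ * π (support w))
    peel w = ≤-trans (Σ-mono letters (pointwise w))
      (≤-trans (≤-reflexive (trans (Σ-+ letters _ _) (+-cong (Σ-*ʳ letters (π (support w)) (λ l → mem (support w) (proj₂ l))) (Σ-*ˡ letters _ (λ l → π (insert (proj₂ l) (support w)))))))
      (+-mono-≤ (*-monoˡ-≤ (π-nonneg (support w)) (Σ-mem (support w) (card-support-≤d (ℕ.<⇒≤ k<d) w)))
        (≤-trans (*-monoʳ-≤ (⟦⟧-nonneg (¬? (distinct? w))) (π-peel (ℕ.<⇒≤ k<d) w))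
          (≤-reflexive (solve 3 (λ a b c → a :* (b :* c) := b :* (a :* c)) refl _ β _)))))

  ⟦×⟧ : ∀ {a b} {A : Set a} {B : Set b} (A? : Dec A) (B? : Dec B) → ⟦ A? ×-dec B? ⟧ ≈ ⟦ A? ⟧ * ⟦ B? ⟧
  ⟦×⟧ (yes _) (yes _) = sym (*-identityˡ _)
  ⟦×⟧ (yes _) (no  _) = sym (*-identityˡ _)
  ⟦×⟧ (no  _) _       = sym (zeroˡ _)

  Σ-family : ∀ {a k} {P : Pred (Word k) a} (P? : Decidable₁ P) x (h : Subset N → Carrier) →
             Σ (family P? x) h ≈ Σ (words k) (λ w → ⟦ value w ≟ x ⟧ * (⟦ P? w ⟧ * h (support w)))
  Σ-family {k = k} P? x h = trans (Σ-map support (filter (λ w → (value w ≟ x) ×-dec P? w) (words k)) h)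
    (trans (Σ-filter _ (words k) _)
      (Σ-cong (words k) (λ w → trans (*-congʳ (⟦×⟧ (value w ≟ x) (P? w))) (*-assoc _ _ _))))

  Σ-all-families : ∀ {a k} {P : Pred (Word k) a} (P? : Decidable₁ P) {h : Subset N → Carrier} → (∀ A → 0# ≤ h A) →
                   Σ (allFin N) (λ x → Σ (family P? x) h) ≤ Σ (words k) (λ w → ⟦ P? w ⟧ * h (support w))
  Σ-all-families {k = k} P? {h} 0≤h = ≤-trans
    (≤-reflexive (trans (Σ-cong (allFin N) (λ x → Σ-family P? x h)) (Σ-swap (allFin N) (words k) _)))
    (Σ-mono (words k) (λ w → ≤-trans (≤-reflexive (Σ-*ʳ (allFin N) _ _))
      (≤-resp refl (*-identityˡ _) (*-monoˡ-≤ (*-nonneg (⟦⟧-nonneg (P? w)) (0≤h _)) (Σ-value w)))))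

-- The probability bound for a fixed group, under numerical hypotheses.

module DiameterBound
  {c ℓ₁ ℓ₂ g ℓ} (ℝ : CompleteOrderedField c ℓ₁ ℓ₂)
  (G : Group g ℓ) {N : ℕ} (order : HasOrder G N)
  (p : CompleteOrderedField.Carrier ℝ)
  (0≤p : CompleteOrderedField._≤_ ℝ (CompleteOrderedField.0# ℝ) p)
  (p≤1 : CompleteOrderedField._≤_ ℝ p (CompleteOrderedField.1# ℝ)) (e : ℕ)
  where
  open OrderedField ℝ
  open ListSum ℝ
  open Expectation ℝ p
  open Correlation ℝ p 0≤p p≤1
  open SecondMoment ℝ p 0≤p p≤1
  open SubsetWeights ℝ p 0≤p p≤1
  open Words ℝ G order p 0≤p p≤1

  open RandomSubset ℝ using (Pr)

  -- Lengths are written `e + 2`, so that the two factors `β` in `Σ-OΨ` cancel against `β ^ d` and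
  -- leave `β ^ e` in `dependence`.
  d n : ℕ
  d = suc (suc e)
  open Counting ℝ G order p 0≤p p≤1 d (ℕ.s≤s ℕ.z≤n)
  n = 2 ℕ.* #words (suc e)

  u dependence : Carrier
  u = p ^ d
  dependence = fromℕ d * fromℕ d * (fromℕ 4 * (p * θ)) * β ^ e

  0≤u : 0# ≤ u
  0≤u = ^-nonneg d 0≤p

  -- Markov's inequality without deciding `ν x ≤ η`. Cotransitivity of `<` only tells that
  -- `ν x < η`, and then `x` is kept, or that `η′ < ν x`, and then `x` is rejected and charged `η′`
  -- of the total of `ν`.
  select : ∀ {a} {A : Set a} (xs : List A) (ν : A → Carrier) → (∀ x → 0# ≤ ν x) →
           ∀ {η′ η} → 0# ≤ η′ → η′ < η →
           ∃[ T ] All (λ x → ν x ≤ η) T × (∀ f → (∀ x → 0# ≤ f x) → Σ T f ≤ Σ xs f) ×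
                  (η′ * fromℕ (length xs) ≤ η′ * fromℕ (length T) + Σ xs ν)
  select []       ν 0≤ν 0≤η′ η′<η = [] , [] , (λ _ _ → ≤-refl) , ≤-reflexive (sym (+-identityʳ _))
  select (x ∷ xs) ν 0≤ν {η′} 0≤η′ η′<η with select xs ν 0≤ν 0≤η′ η′<η | <-cotrans η′<η (ν x)
  ... | T , small , sub , large | inj₁ η′<νx = T , small ,
    (λ f 0≤f → ≤-trans (sub f 0≤f) (≤-by (f x) (+-comm _ _) (0≤f x))) ,
    ≤-trans (≤-reflexive (trans (distribˡ _ _ _) (+-congʳ (*-identityʳ η′))))
    (≤-trans (+-mono-≤ (<⇒≤ η′<νx) large)
      (≤-reflexive (solve 3 (λ a b c → a :+ (b :+ c) := b :+ (a :+ c)) refl (ν x) _ (Σ xs ν))))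
  ... | T , small , sub , large | inj₂ νx<η = x ∷ T , <⇒≤ νx<η ∷ small ,
    (λ f 0≤f → +-monoʳ-≤ (f x) (sub f 0≤f)) ,
    ≤-trans (≤-reflexive (distribˡ _ _ _))
    (≤-trans (+-monoʳ-≤ _ large)
      (≤-by (ν x) (solve 5 (λ h l v r y → h :* (con (ℤ.+ 1) :+ l) :+ (v :+ r) := (h :* con (ℤ.+ 1) :+ (h :* l :+ r)) :+ v)
        refl η′ (fromℕ (length T)) (ν x) (Σ xs ν) 0#) (0≤ν x)))

  Σ-shorter : ∀ k → k ℕ.≤ d → Σ (allFin N) (λ x → Σ (shorter k x) π) ≤ fromℕ k * β ^ suc e
  Σ-shorter zero    _   = ≤-reflexive (trans (Σ-zero (allFin N)) (sym (zeroˡ _)))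
  Σ-shorter (suc k) k<d = ≤-trans
    (≤-reflexive (trans (Σ-cong (allFin N) (λ x → Σ-++ (family {k = k} (λ _ → yes tt) x) (shorter k x) π)) (Σ-+ (allFin N) _ _)))
    (≤-trans (+-mono-≤ (≤-trans (Σ-all-families {k = k} (λ _ → yes tt) π-nonneg)
        (≤-trans (≤-reflexive (Σ-cong (words k) (λ w → *-identityˡ _)))
        (≤-trans (Σ-π k (ℕ.<⇒≤ k<d)) (^-monoʳ-≤ 1≤β (ℕ.s≤s⁻¹ k<d)))))
        (Σ-shorter k (ℕ.<⇒≤ k<d)))
      (≤-reflexive (solve 2 (λ x k → x :+ k :* x := (con (ℤ.+ 1) :+ k) :* x) refl (β ^ suc e) (fromℕ k))))

  Σ-degenerate : Σ (allFin N) (λ x → Σ (degenerate d x) π) ≤ fromℕ d * (1# + θ) * β ^ suc e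
  Σ-degenerate = ≤-trans
    (≤-reflexive (trans (Σ-cong (allFin N) (λ x → Σ-++ (family repeated? x) (shorter d x) π)) (Σ-+ (allFin N) _ _)))
    (≤-trans (+-mono-≤ (≤-trans (Σ-all-families {k = d} repeated? π-nonneg)
        (*-cancelʳ-≤ 0<β (≤-trans (Σ-repeated d ℕ.≤-refl)
          (≤-reflexive (solve 3 (λ x b y → x :* (b :* y) := x :* y :* b) refl (fromℕ d * θ) β (β ^ suc e))))))
        (Σ-shorter d ℕ.≤-refl))
      (≤-reflexive (solve 3 (λ d t x → d :* t :* x :+ d :* x := d :* (con (ℤ.+ 1) :+ t) :* x)
        refl (fromℕ d) θ (β ^ suc e))))
    where
    repeated? : (w : Word d) → Dec (¬ Distinct w)
    repeated? w = ¬? (distinct? w)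

  Σ-generic-const : ∀ x {k} → 0# ≤ k → Σ (generic d x) (λ _ → k) ≤ fromℕ n * k
  Σ-generic-const x {k} 0≤k = ≤-trans (≤-reflexive (Σ-family {k = d} distinct? x (λ _ → k)))
    (≤-trans (Σ-mono (words d) (λ w → *-monoʳ-≤ (⟦⟧-nonneg (value w ≟ x))
        (≤-resp refl (*-identityˡ k) (*-monoˡ-≤ 0≤k (⟦⟧-≤1 (distinct? w))))))
    (≤-trans (≤-reflexive (Σ-*ʳ (words d) k _)) (*-monoˡ-≤ 0≤k (Σ-words-value (suc e) x))))

  length-generic : ∀ x → length (generic d x) ℕ.≤ n
  length-generic x = fromℕ-cancel-≤ (≤-resp
    (trans (Σ-const (generic d x) 1#) (*-identityʳ _)) (*-identityʳ _) (Σ-generic-const x 0≤1))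

  π-generic : ∀ x → All (λ A → π A ≤ u) (generic d x)
  π-generic x = Allₚ.map⁺ (All.map (λ {w} h → ≤-reflexive (π-support w (proj₂ h)))
    (Allₚ.all-filter (λ w → (value w ≟ x) ×-dec distinct? w) (words d)))

  E-generic : u ≤ 1# → ∀ x → (1# - u) ^ n ≤ E (avoid (generic d x))
  E-generic u≤1 x = ≤-trans
    (^-antimonoʳ-≤ (x≤y⇒0≤y-x u≤1) (≤-by u (solve 1 (λ u → con (ℤ.+ 1) := (con (ℤ.+ 1) :- u) :+ u) refl u) 0≤u)
      (length-generic x))
    (E-avoid-≥^ u≤1 (π-generic x))

  inA outA : Word d → Fin N → Carrier
  inA  w y = Σ (words d) (λ w′ → ⟦ value w′ ≟ y ⟧ * (O A A≤ w′ * Π A A≤ w′))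
    where
    A = support w
    A≤ = card-support w
  outA w y = Σ (words d) (λ w′ → ⟦ value w′ ≟ y ⟧ * (O A A≤ w′ * Ψ A A≤ w′))
    where
    A = support w
    A≤ = card-support w

  inA-nonneg : ∀ w y → 0# ≤ inA w y
  inA-nonneg w y = Σ-nonneg (words d) (λ w′ → *-nonneg (⟦⟧-nonneg (value w′ ≟ y))
    (*-nonneg (O-nonneg (support w) (card-support w) w′) (Π-nonneg (support w) (card-support w) w′)))

  outA-≤ : ∀ w y → outA w y ≤ dependence
  outA-≤ w y = *-cancelʳ-≤ (*-pos 0<β 0<β) (≤-trans (Σ-OΨ (support w) (card-support w) d y)
    (≤-reflexive (solve 3 (λ x b y → x :* (b :* (b :* y)) := x :* y :* (b :* b)) refl _ β (β ^ e))))

  Σ-inA : ∀ w → Σ (allFin N) (inA w) ≤ fromℕ d * θ ^ d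
  Σ-inA w = ≤-trans (≤-reflexive (Σ-swap (allFin N) (words d) _))
    (≤-trans (Σ-mono (words d) (λ w′ → ≤-trans (≤-reflexive (Σ-*ʳ (allFin N) _ _))
      (≤-resp refl (*-identityˡ _) (*-monoˡ-≤
        (*-nonneg (O-nonneg (support w) (card-support w) w′) (Π-nonneg (support w) (card-support w) w′)) (Σ-value w′)))))
      (Σ-OΠ (support w) (card-support w) d))

  -- The share of `Λ` due to pairs of words whose second word stays inside the support of the first.
  -- It is not small for every `y`, but each first word has at most `θ ^ d` such partners over all
  -- `y` together.
  κ : Fin N → Fin N → Carrier
  κ x y = Σ (words d) (λ w → ⟦ value w ≟ x ⟧ * (u * inA w y))

  κ-nonneg : ∀ x y → 0# ≤ κ x y
  κ-nonneg x y = Σ-nonneg (words d) (λ w → *-nonneg (⟦⟧-nonneg (value w ≟ x)) (*-nonneg 0≤u (inA-nonneg w y)))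

  Σ-κ : ∀ x → Σ (allFin N) (κ x) ≤ fromℕ n * (u * (fromℕ d * θ ^ d))
  Σ-κ x = ≤-trans (≤-reflexive (Σ-swap (allFin N) (words d) _))
    (≤-trans (Σ-mono (words d) {g = λ w → ⟦ value w ≟ x ⟧ * k} (λ w → ≤-trans (≤-reflexive
        (trans (Σ-*ˡ (allFin N) _ _) (*-congˡ (Σ-*ˡ (allFin N) u (inA w)))))
        (*-monoʳ-≤ (⟦⟧-nonneg (value w ≟ x)) (*-monoʳ-≤ 0≤u (Σ-inA w)))))
    (≤-trans (≤-reflexive (Σ-*ʳ (words d) k _)) (*-monoˡ-≤ 0≤k (Σ-words-value (suc e) x))))
    where
    k = u * (fromℕ d * θ ^ d)
    0≤k : 0# ≤ k
    0≤k = *-nonneg 0≤u (*-nonneg (fromℕ-nonneg d) (^-nonneg d 0≤θ))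

  Σ-dep : ∀ w → Distinct w → ∀ y → Σ (generic d y) (dep (support w)) ≤ u * inA w y + u * dependence
  Σ-dep w dw y = ≤-trans (≤-reflexive (Σ-family {k = d} distinct? y (dep A)))
    (≤-trans (Σ-mono (words d) pointwise)
    (≤-trans (≤-reflexive (trans (Σ-*ˡ (words d) u _) (trans (*-congˡ (Σ-+ (words d) _ _)) (distribˡ _ _ _))))
      (+-monoʳ-≤ _ (*-monoʳ-≤ 0≤u (outA-≤ w y)))))
    where
    A = support w
    A≤ = card-support w

    I : Word d → Carrier
    I w′ = ⟦ value w′ ≟ y ⟧

    OΠ+OΨ : Word d → Carrier
    OΠ+OΨ w′ = O A A≤ w′ * Π A A≤ w′ + O A A≤ w′ * Ψ A A≤ w′

    0≤OΠ+OΨ : ∀ w′ → 0# ≤ OΠ+OΨ w′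
    0≤OΠ+OΨ w′ = +-nonneg (*-nonneg (O-nonneg A A≤ w′) (Π-nonneg A A≤ w′))
                          (*-nonneg (O-nonneg A A≤ w′) (Ψ-nonneg A A≤ w′))

    restrict : ∀ w′ (dw? : Dec (Distinct w′)) → ⟦ dw? ⟧ * dep A (support w′) ≤ u * OΠ+OΨ w′
    restrict w′ (no  _)  = ≤-resp (sym (zeroˡ _)) refl (*-nonneg 0≤u (0≤OΠ+OΨ w′))
    restrict w′ (yes dw′) = ≤-resp (sym (*-identityˡ _)) (*-congʳ (π-support w dw)) (dep-support A A≤ w′ dw′)

    pointwise : ∀ w′ → I w′ * (⟦ distinct? w′ ⟧ * dep A (support w′)) ≤
                       u * (I w′ * (O A A≤ w′ * Π A A≤ w′) + I w′ * (O A A≤ w′ * Ψ A A≤ w′))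
    pointwise w′ = ≤-trans (*-monoʳ-≤ (⟦⟧-nonneg (value w′ ≟ y)) (restrict w′ (distinct? w′)))
      (≤-reflexive (solve 4 (λ i u a b → i :* (u :* (a :+ b)) := u :* (i :* a :+ i :* b)) refl (I w′) u _ _))

  Λ-generic : ∀ x y → Λ (generic d x) (generic d y) ≤ fromℕ n * (u * dependence) + κ x y
  Λ-generic x y = ≤-trans (≤-reflexive (Σ-family {k = d} distinct? x _))
    (≤-trans (Σ-mono (words d) {g = λ w → ⟦ value w ≟ x ⟧ * (u * inA w y) + ⟦ value w ≟ x ⟧ * (u * dependence)}
      (λ w → ≤-trans (*-monoʳ-≤ (⟦⟧-nonneg (value w ≟ x)) (restrict w (distinct? w))) (≤-reflexive (distribˡ _ _ _))))
    (≤-trans (≤-reflexive (trans (Σ-+ (words d) _ _) (+-congˡ (Σ-*ʳ (words d) _ _))))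
    (≤-trans (+-monoʳ-≤ _ (*-monoˡ-≤ 0≤uD (Σ-words-value (suc e) x)))
      (≤-reflexive (+-comm _ _)))))
    where
    0≤uD : 0# ≤ u * dependence
    0≤uD = *-nonneg 0≤u (*-nonneg (*-nonneg (*-nonneg (fromℕ-nonneg d) (fromℕ-nonneg d))
      (*-nonneg (fromℕ-nonneg 4) (*-nonneg 0≤p 0≤θ))) (^-nonneg e 0≤β))

    restrict : ∀ w (dw? : Dec (Distinct w)) → ⟦ dw? ⟧ * Σ (generic d y) (dep (support w)) ≤ u * inA w y + u * dependence
    restrict w (no  _) = ≤-resp (sym (zeroˡ _)) refl (+-nonneg (*-nonneg 0≤u (inA-nonneg w y)) 0≤uD)
    restrict w (yes dw) = ≤-resp (sym (*-identityˡ _)) refl (Σ-dep w dw y)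

  -- By `R₁` and Markov's inequality at least half of the elements are kept. `R₂` makes the uniform
  -- part of the dependence at most `η`. `R₃` compares the row sums of `κ` with `N (1 - u)ⁿ`, which
  -- is at most `2 Q`.
  diameter-bound : ∀ {η′ η} → 0# < η′ → η′ < η → η ≤ 1# → 1 ℕ.≤ N → u < 1# →
    fromℕ 2 * (fromℕ d * (1# + θ) * β ^ suc e) ≤ η′ * fromℕ N →
    fromℕ n * (u * dependence) ≤ η →
    fromℕ 2 * (fromℕ n * (u * (fromℕ d * θ ^ d))) ≤ η * (fromℕ N * (1# - u) ^ n) →
    Pr p (Cayley.diameter≤? G order d) ≤ fromℕ 5 * η
  diameter-bound {η′} {η} 0<η′ η′<η η≤1 1≤N u<1 R₁ R₂ R₃
    with select (allFin N) (λ x → Σ (degenerate d x) π) (λ x → Σ-nonneg (degenerate d x) π-nonneg) (<⇒≤ 0<η′) η′<η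
  ... | T , small , sub , large = ≤-resp (sym (Pr≈E (Cayley.diameter≤? G order d))) refl
    (second-moment T (generic d) (degenerate d) (Cayley.diameter≤? G order d) (λ S → diameter⇒covered d)
      κ 0≤η η≤1 R₂ κ-nonneg small Λ-generic
      (λ x → ≤-trans (sub (κ x) (κ-nonneg x)) (Σ-κ x)) 0<Q K≤ηQ)
    where
    Q t B : Carrier
    Q = Σ T (λ x → E (avoid (generic d x)))
    t = fromℕ (length T)
    B = (1# - u) ^ n

    0≤η : 0# ≤ η
    0≤η = <⇒≤ (<-trans 0<η′ η′<η)

    0<B : 0# < B
    0<B = ^-pos n (x<y⇒0<y-x u<1)

    N≤2t : fromℕ N ≤ fromℕ 2 * t
    N≤2t = *-cancelʳ-≤ 0<η′ (≤-by
      (fromℕ 2 * ((η′ * t + s) - η′ * N′) + (η′ * N′ - fromℕ 2 * s))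
      (solve 4 (λ h t s N → let two = con (ℤ.+ 1) :+ (con (ℤ.+ 1) :+ con (ℤ.+ 0)) in
        two :* t :* h := N :* h :+ (two :* ((h :* t :+ s) :- h :* N) :+ (h :* N :- two :* s))) refl η′ t s N′)
      (+-nonneg (*-nonneg 0≤2 (x≤y⇒0≤y-x (≤-resp (*-congˡ (reflexive (≡.cong fromℕ (length-tabulate {n = N} (λ i → i))))) refl large)))
                (x≤y⇒0≤y-x (≤-trans (*-monoʳ-≤ 0≤2 Σ-degenerate) R₁))))
      where
      s = Σ (allFin N) (λ x → Σ (degenerate d x) π)
      N′ = fromℕ N

    tB≤Q : t * B ≤ Q
    tB≤Q = ≤-trans (≤-reflexive (sym (Σ-const T B))) (Σ-mono T (E-generic (<⇒≤ u<1)))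

    NB≤2Q : fromℕ N * B ≤ fromℕ 2 * Q
    NB≤2Q = ≤-trans (*-monoˡ-≤ (<⇒≤ 0<B) N≤2t) (≤-trans (≤-reflexive (*-assoc _ _ _)) (*-monoʳ-≤ 0≤2 tB≤Q))

    0<Q : 0# < Q
    0<Q = [ (λ 0<Q → 0<Q) , (λ Q<2Q → <-respʳ-≈ 2Q-Q≈Q (x<y⇒0<y-x Q<2Q)) ]′ (<-cotrans 0<2Q Q)
      where
      0<2Q : 0# < fromℕ 2 * Q
      0<2Q = <-≤-trans (*-pos (<-≤-trans 0<1 (1≤fromℕ 1≤N)) 0<B) NB≤2Q

      2Q-Q≈Q : fromℕ 2 * Q - Q ≈ Q
      2Q-Q≈Q = solve 1 (λ q → (con (ℤ.+ 1) :+ (con (ℤ.+ 1) :+ con (ℤ.+ 0))) :* q :- q := q) refl Q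

    K≤ηQ : fromℕ n * (u * (fromℕ d * θ ^ d)) ≤ η * Q
    K≤ηQ = *-cancelʳ-≤ (0<fromℕ[1+n] 1) (≤-resp (*-comm _ _)
      (solve 3 (λ a b c → a :* (b :* c) := a :* c :* b) refl η (fromℕ 2) Q)
      (≤-trans R₃ (*-monoʳ-≤ 0≤η NB≤2Q)))

-- The exponential series.

module Exponential {c ℓ₁ ℓ₂} (ℝ : CompleteOrderedField c ℓ₁ ℓ₂) where
  open OrderedField ℝ
  open RealAnalysis ℝ using (expPartialSum; IsLog; fromℕ#0)

  2# : Carrier
  2# = fromℕ 2

  0≤2# : 0# ≤ 2#
  0≤2# = fromℕ-nonneg 2

  1/! : ℕ → Carrier
  1/! k = proj₁ (#⇒invertible (fromℕ#0 (k !) {{k ℕ.!≢0}}))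

  term : Carrier → ℕ → Carrier
  term y k = y ^ k * 1/! k

  -- `sum` in `expPartialSum` exposes the first term; here the last term is outermost, so that
  -- induction on `n` appends a term.
  Ex : Carrier → ℕ → Carrier
  Ex y zero    = 0#
  Ex y (suc n) = Ex y n + term y n

  expPartialSum≈Ex : ∀ y n → expPartialSum y n ≈ Ex y n
  expPartialSum≈Ex y n = trans (go n (term y)) (sym (Ex≈front n))
    where
    front : ℕ → (ℕ → Carrier) → Carrier
    front zero    f = 0#
    front (suc n) f = f 0 + front n (f ∘ suc)

    go : ∀ n (f : ℕ → Carrier) → sum {n} (λ k → f (toℕ k)) ≈ front n f
    go zero    f = refl
    go (suc n) f = +-congˡ (go n (f ∘ suc))

    front-suc : ∀ n f → front (suc n) f ≈ front n f + f n
    front-suc zero    f = trans (+-identityʳ _) (sym (+-identityˡ _))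
    front-suc (suc n) f = trans (+-congˡ (front-suc n (f ∘ suc))) (sym (+-assoc _ _ _))

    Ex≈front : ∀ n → Ex y n ≈ front n (term y)
    Ex≈front zero    = refl
    Ex≈front (suc n) = trans (+-congʳ (Ex≈front n)) (sym (front-suc n (term y)))

  !*1/! : ∀ k → fromℕ (k !) * 1/! k ≈ 1#
  !*1/! k = inverse (fromℕ#0 (k !) {{k ℕ.!≢0}})

  1/!-pos : ∀ k → 0# < 1/! k
  1/!-pos k = inverse-pos (<-≤-trans 0<1 (1≤fromℕ (ℕ.1≤n! k))) (!*1/! k)

  suc*1/! : ∀ k → fromℕ (suc k) * 1/! (suc k) ≈ 1/! k
  suc*1/! k = trans (sym (*-identityʳ _)) (trans (*-congˡ (sym (!*1/! k)))
    (trans (solve 4 (λ a b c d → a :* b :* (c :* d) := (a :* c) :* b :* d) refl _ _ (fromℕ (k !)) (1/! k))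
    (trans (*-congʳ (trans (*-congʳ (sym (fromℕ-* (suc k) (k !)))) (!*1/! (suc k)))) (*-identityˡ _))))

  1/!-zero : 1/! 0 ≈ 1#
  1/!-zero = trans (trans (sym (*-identityˡ _)) (*-congʳ (sym (+-identityʳ 1#)))) (!*1/! 0)

  term-nonneg : ∀ {y} k → 0# ≤ y → 0# ≤ term y k
  term-nonneg k 0≤y = *-nonneg (^-nonneg k 0≤y) (<⇒≤ (1/!-pos k))

  term-zero : ∀ y → term y 0 ≈ 1#
  term-zero y = trans (*-identityˡ _) 1/!-zero

  term-suc : ∀ y k → fromℕ (suc k) * term y (suc k) ≈ y * term y k
  term-suc y k = trans (solve 4 (λ n y a b → n :* (y :* a :* b) := y :* (a :* (n :* b))) refl _ y _ _)
    (*-congˡ (*-congˡ (suc*1/! k)))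

  Ex-cong : ∀ {y z} n → y ≈ z → Ex y n ≈ Ex z n
  Ex-cong zero    y≈z = refl
  Ex-cong (suc n) y≈z = +-cong (Ex-cong n y≈z) (*-congʳ (^-cong n y≈z))

  Ex-monoˡ : ∀ {y z} n → 0# ≤ y → y ≤ z → Ex y n ≤ Ex z n
  Ex-monoˡ zero    0≤y y≤z = ≤-refl
  Ex-monoˡ (suc n) 0≤y y≤z = +-mono-≤ (Ex-monoˡ n 0≤y y≤z)
    (*-monoˡ-≤ (<⇒≤ (1/!-pos n)) (^-monoˡ-≤ n 0≤y y≤z))

  Ex-monoʳ : ∀ {y m n} → 0# ≤ y → m ℕ.≤′ n → Ex y m ≤ Ex y n
  Ex-monoʳ 0≤y ℕ.≤′-refl        = ≤-refl
  Ex-monoʳ {y} {m} {suc n} 0≤y (ℕ.≤′-step h) = ≤-trans (Ex-monoʳ {m = m} 0≤y h) (≤-by (term y n) refl (term-nonneg n 0≤y))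

  Ex-nonneg : ∀ {y} n → 0# ≤ y → 0# ≤ Ex y n
  Ex-nonneg n 0≤y = Ex-monoʳ {m = 0} {n} 0≤y (ℕ.≤⇒≤′ ℕ.z≤n)

  Ex-1 : ∀ y → Ex y 1 ≈ 1#
  Ex-1 y = trans (+-identityˡ _) (term-zero y)

  1≤Ex : ∀ {y} n → 0# ≤ y → 1# ≤ Ex y (suc n)
  1≤Ex {y} n 0≤y = ≤-resp (Ex-1 y) refl (Ex-monoʳ {m = 1} {suc n} 0≤y (ℕ.≤⇒≤′ (ℕ.s≤s ℕ.z≤n)))

  Ex-0 : ∀ n → Ex 0# n ≤ 1#
  Ex-0 zero          = 0≤1
  Ex-0 (suc zero)    = ≤-reflexive (Ex-1 0#)
  Ex-0 (suc (suc n)) = ≤-resp (trans (sym (+-identityʳ _)) (+-congˡ (sym (trans (*-congʳ (zeroˡ _)) (zeroˡ _))))) refl (Ex-0 (suc n))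

  private
    bernoulli : ∀ {y v} k → 0# ≤ y → 0# ≤ v → y ^ suc k + fromℕ (suc k) * (v * y ^ k) ≤ (y + v) ^ suc k
    bernoulli {y} {v} zero 0≤y 0≤v = ≤-reflexive (solve 2 (λ y v → let one = con (ℤ.+ 1) in
      y :* one :+ (one :+ con (ℤ.+ 0)) :* (v :* one) := (y :+ v) :* one) refl y v)
    bernoulli {y} {v} (suc k) 0≤y 0≤v = ≤-trans
      (≤-by (fromℕ (suc k) * (v * v * y ^ k))
        (solve 4 (λ y v x k → (y :+ v) :* (y :* x :+ k :* (v :* x)) :=
          (y :* (y :* x) :+ (con (ℤ.+ 1) :+ k) :* (v :* (y :* x))) :+ k :* (v :* v :* x)) refl y v (y ^ k) (fromℕ (suc k)))
        (*-nonneg (fromℕ-nonneg (suc k)) (*-nonneg (*-nonneg 0≤v 0≤v) (^-nonneg k 0≤y))))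
      (*-monoʳ-≤ (+-nonneg 0≤y 0≤v) (bernoulli k 0≤y 0≤v))

    bernoulli′ : ∀ {y w} k → 0# ≤ y → 0# ≤ w → (y + w) ^ suc k ≤ y ^ suc k + fromℕ (suc k) * (w * (y + w) ^ k)
    bernoulli′ {y} {w} zero 0≤y 0≤w = ≤-reflexive (solve 2 (λ y v → let one = con (ℤ.+ 1) in
      (y :+ v) :* one := y :* one :+ (one :+ con (ℤ.+ 0)) :* (v :* one)) refl y w)
    bernoulli′ {y} {w} (suc k) 0≤y 0≤w = ≤-trans
      (*-monoʳ-≤ (+-nonneg 0≤y 0≤w) (bernoulli′ k 0≤y 0≤w))
      (≤-by (w * ((y + w) ^ suc k - y ^ suc k))
        (solve 5 (λ y w x k z → y :* (y :* x) :+ (con (ℤ.+ 1) :+ k) :* (w :* ((y :+ w) :* z)) :=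
          (y :+ w) :* (y :* x :+ k :* (w :* z)) :+ w :* ((y :+ w) :* z :- y :* x)) refl y w (y ^ k) (fromℕ (suc k)) ((y + w) ^ k))
        (*-nonneg 0≤w (x≤y⇒0≤y-x (^-monoˡ-≤ (suc k) 0≤y (≤-by w refl 0≤w)))))

    scale : ∀ a b v k → (a + fromℕ (suc k) * (v * b)) * 1/! (suc k) ≈ a * 1/! (suc k) + v * (b * 1/! k)
    scale a b v k = trans (solve 5 (λ a n v b i → (a :+ n :* (v :* b)) :* i := a :* i :+ v :* (b :* (n :* i))) refl a _ v b _)
      (+-congˡ (*-congˡ (*-congˡ (suc*1/! k))))

  -- The truncated form of (1 + v) exp y ≤ exp (y + v). The part multiplied by `v` has one term less
  -- because the linear term of the binomial expansion lowers the degree by one.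
  Ex-+-≥ : ∀ {y v} n → 0# ≤ y → 0# ≤ v → Ex y (suc n) + v * Ex y n ≤ Ex (y + v) (suc n)
  Ex-+-≥ {y} {v} zero 0≤y 0≤v = ≤-reflexive
    (trans (+-cong (Ex-1 y) (zeroʳ v)) (trans (+-identityʳ 1#) (sym (Ex-1 (y + v)))))
  Ex-+-≥ {y} {v} (suc n) 0≤y 0≤v = ≤-trans
    (≤-reflexive (solve 5 (λ a b v c t → (a :+ b) :+ v :* (c :+ t) := (a :+ v :* c) :+ (b :+ v :* t))
      refl (Ex y (suc n)) (term y (suc n)) v (Ex y n) (term y n)))
    (+-mono-≤ (Ex-+-≥ n 0≤y 0≤v)
      (≤-resp (scale _ _ v n) refl (*-monoˡ-≤ (<⇒≤ (1/!-pos (suc n))) (bernoulli n 0≤y 0≤v))))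

  -- The truncated form of (1 - w) exp (y + w) ≤ exp y, by the mean value estimate of `bernoulli′`
  -- for each term.
  Ex-+-≤ : ∀ {y w} n → 0# ≤ y → 0# ≤ w → Ex (y + w) (suc n) ≤ Ex y (suc n) + w * Ex (y + w) n
  Ex-+-≤ {y} {w} zero 0≤y 0≤w = ≤-reflexive
    (trans (Ex-1 (y + w)) (trans (sym (+-identityʳ 1#)) (+-cong (sym (Ex-1 y)) (sym (zeroʳ w)))))
  Ex-+-≤ {y} {w} (suc n) 0≤y 0≤w = ≤-trans
    (+-mono-≤ (Ex-+-≤ n 0≤y 0≤w)
      (≤-resp refl (scale _ _ w n) (*-monoˡ-≤ (<⇒≤ (1/!-pos (suc n))) (bernoulli′ n 0≤y 0≤w))))
    (≤-reflexive (solve 5 (λ a b v c t → (a :+ v :* c) :+ (b :+ v :* t) := (a :+ b) :+ v :* (c :+ t))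
      refl (Ex y (suc n)) (term y (suc n)) w (Ex (y + w) n) (term (y + w) n)))

  -- Each factor `1 + v` costs one more term of the series. This is harmless, because the upper
  -- bounds are available for every truncation.
  [1+v]^n*Ex : ∀ {z v} n m → 0# ≤ z → 0# ≤ v → (1# + v) ^ n * Ex z m ≤ Ex (z + fromℕ n * v) (n ℕ.+ m)
  [1+v]^n*Ex {z} {v} zero m 0≤z 0≤v = ≤-reflexive (trans (*-identityˡ _)
    (Ex-cong m (solve 2 (λ z v → z := z :+ con (ℤ.+ 0) :* v) refl z v)))
  [1+v]^n*Ex {z} {v} (suc n) m 0≤z 0≤v = ≤-trans
    (≤-resp (sym (*-assoc _ _ _)) refl (*-monoʳ-≤ (+-nonneg 0≤1 0≤v) ([1+v]^n*Ex n m 0≤z 0≤v)))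
    (≤-trans (≤-trans (≤-reflexive (trans (distribʳ _ _ _) (+-congʳ (*-identityˡ _))))
      (+-monoˡ-≤ _ (Ex-monoʳ {n = suc (n ℕ.+ m)} 0≤y (ℕ.≤′-step ℕ.≤′-refl))))
    (≤-trans (Ex-+-≥ (n ℕ.+ m) 0≤y 0≤v)
      (≤-reflexive (Ex-cong (suc (n ℕ.+ m)) (solve 3 (λ z n v → (z :+ n :* v) :+ v := z :+ (con (ℤ.+ 1) :+ n) :* v) refl z (fromℕ n) v)))))
    where
    0≤y : 0# ≤ z + fromℕ n * v
    0≤y = +-nonneg 0≤z (*-nonneg (fromℕ-nonneg n) 0≤v)

  [1-w]^j*Ex : ∀ {w} j n → 0# ≤ w → w ≤ 1# → (1# - w) ^ j * Ex (fromℕ j * w) n ≤ 1#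
  [1-w]^j*Ex {w} zero n 0≤w w≤1 = ≤-resp
    (trans (Ex-cong n (sym (zeroˡ w))) (sym (*-identityˡ _))) refl (Ex-0 n)
  [1-w]^j*Ex {w} (suc j) n 0≤w w≤1 = ≤-trans
    (≤-resp (trans (*-congˡ (*-congˡ (Ex-cong n (solve 2 (λ j w → j :* w :+ w := (con (ℤ.+ 1) :+ j) :* w) refl (fromℕ j) w))))
              (solve 3 (λ a b c → b :* (a :* c) := a :* b :* c) refl (1# - w) ((1# - w) ^ j) _)) refl
      (*-monoʳ-≤ (^-nonneg j (x≤y⇒0≤y-x w≤1)) (one n)))
    ([1-w]^j*Ex j n 0≤w w≤1)
    where
    y = fromℕ j * w
    0≤y : 0# ≤ y
    0≤y = *-nonneg (fromℕ-nonneg j) 0≤w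

    one : ∀ n → (1# - w) * Ex (y + w) n ≤ Ex y n
    one zero    = ≤-reflexive (zeroʳ _)
    one (suc n) = ≤-resp
      (solve 2 (λ e w → e :- w :* e := (con (ℤ.+ 1) :- w) :* e) refl (Ex (y + w) (suc n)) w)
      (solve 2 (λ a b → (a :+ b) :- b := a) refl (Ex y (suc n)) (w * Ex (y + w) (suc n)))
      (+-monoˡ-≤ (- (w * Ex (y + w) (suc n))) (≤-trans (Ex-+-≤ n 0≤y 0≤w)
        (+-monoʳ-≤ _ (*-monoʳ-≤ 0≤w (Ex-monoʳ {m = n} (+-nonneg 0≤y 0≤w) (ℕ.≤′-step ℕ.≤′-refl))))))

  -- exp (jw) ≤ (1 + 2w)ʲ for w ≤ 1/2, because (1 - w)(1 + 2w) ≥ 1.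
  Ex≤[1+2w]^j : ∀ {w} j n → 0# ≤ w → 2# * w ≤ 1# → Ex (fromℕ j * w) n ≤ (1# + 2# * w) ^ j
  Ex≤[1+2w]^j {w} j n 0≤w 2w≤1 = ≤-trans
    (≤-resp (*-identityʳ _) refl (*-monoʳ-≤ 0≤Ex (1≤^ j 1≤)))
    (≤-resp (sym (trans (*-congˡ (^-distrib-* (1# - w) (1# + 2# * w) j))
               (solve 3 (λ a b c → a :* (b :* c) := b :* a :* c) refl (Ex (fromℕ j * w) n) _ _))) (*-identityˡ _)
      (*-monoˡ-≤ (^-nonneg j (+-nonneg 0≤1 (*-nonneg 0≤2# 0≤w))) ([1-w]^j*Ex j n 0≤w w≤1)))
    where
    0≤Ex : 0# ≤ Ex (fromℕ j * w) n
    0≤Ex = Ex-nonneg n (*-nonneg (fromℕ-nonneg j) 0≤w)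

    w≤1 : w ≤ 1#
    w≤1 = ≤-trans (≤-by w (solve 1 (λ w → (con (ℤ.+ 1) :+ (con (ℤ.+ 1) :+ con (ℤ.+ 0))) :* w := w :+ w) refl w) 0≤w) 2w≤1

    1≤ : 1# ≤ (1# - w) * (1# + 2# * w)
    1≤ = ≤-by (w * (1# - 2# * w))
      (solve 1 (λ w → let one = con (ℤ.+ 1); two = one :+ (one :+ con (ℤ.+ 0)) in
        (one :- w) :* (one :+ two :* w) := one :+ w :* (one :- two :* w)) refl w)
      (*-nonneg 0≤w (x≤y⇒0≤y-x 2w≤1))

  1/2 : Carrier
  1/2 = proj₁ (1/ (0<fromℕ[1+n] 1))

  2*1/2 : 2# * 1/2 ≈ 1#
  2*1/2 = proj₂ (proj₂ (1/ (0<fromℕ[1+n] 1)))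

  0<1/2 : 0# < 1/2
  0<1/2 = proj₁ (proj₂ (1/ (0<fromℕ[1+n] 1)))

  -- `Ex≤[1+2w]^j` with `w = 1/2` and `j = 2 A` gives 2 to the power `2 A`.
  Ex-bounded : ∀ {y} A n → 0# ≤ y → y ≤ fromℕ A → Ex y n ≤ fromℕ (4 ℕ.^ A)
  Ex-bounded {y} A n 0≤y y≤A = ≤-trans (Ex-monoˡ n 0≤y y≤A) (≤-trans
    (≤-reflexive (Ex-cong n (sym (trans (*-congʳ (fromℕ-* A 2)) (trans (*-assoc _ _ _) (trans (*-congˡ 2*1/2) (*-identityʳ _)))))))
    (≤-trans (Ex≤[1+2w]^j {1/2} (A ℕ.* 2) n (<⇒≤ 0<1/2) (≤-reflexive 2*1/2))
    (≤-reflexive (trans (^-cong (A ℕ.* 2) (trans (+-congˡ 2*1/2) (+-congˡ (sym (+-identityʳ 1#)))))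
      (trans (sym (fromℕ-^ 2 (A ℕ.* 2))) (reflexive (≡.cong fromℕ
        (≡.trans (≡.cong (2 ℕ.^_) (ℕ.*-comm A 2)) (≡.sym (ℕ.^-*-assoc 2 2 A))))))))))

  limit-≤ : ∀ {s l b} n₁ → s ⟶ l → (∀ n → n₁ ℕ.≤ n → s n ≤ b) → l ≤ b
  limit-≤ {s} {l} {b} n₁ s⟶l s≤b b<l with s⟶l (l - b) (x<y⇒0<y-x b<l)
  ... | n₀ , h = s≤b n (ℕ.m≤n⊔m n₀ n₁) (0<y-x⇒x<y (<-respʳ-≈
      (solve 3 (λ l b s → (l :- b) :- (l :- s) := s :- b) refl l b (s n))
      (x<y⇒0<y-x (proj₂ (h n (ℕ.m≤m⊔n n₀ n₁))))))
    where n = n₀ ℕ.⊔ n₁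

  limit-≥ : ∀ {s l b} n₁ → s ⟶ l → (∀ n → n₁ ℕ.≤ n → b ≤ s n) → b ≤ l
  limit-≥ {s} {l} {b} n₁ s⟶l b≤s l<b with s⟶l (b - l) (x<y⇒0<y-x l<b)
  ... | n₀ , h = b≤s n (ℕ.m≤n⊔m n₀ n₁) (0<y-x⇒x<y (<-respʳ-≈
      (solve 3 (λ l b s → (b :- l) :- (s :- l) := b :- s) refl l b (s n))
      (x<y⇒0<y-x (proj₁ (h n (ℕ.m≤m⊔n n₀ n₁))))))
    where n = n₀ ℕ.⊔ n₁

  Ex≤exp : ∀ {x L} n → 0# ≤ L → IsLog x L → Ex L n ≤ x
  Ex≤exp {x} {L} n 0≤L log = limit-≥ n log (λ m n≤m →
    ≤-resp refl (sym (expPartialSum≈Ex L m)) (Ex-monoʳ 0≤L (ℕ.≤⇒≤′ n≤m)))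

  exp≤ : ∀ {x L b} n₁ → IsLog x L → (∀ n → n₁ ℕ.≤ n → Ex L n ≤ b) → x ≤ b
  exp≤ {L = L} n₁ log h = limit-≤ n₁ log (λ n n₁≤n → ≤-resp (sym (expPartialSum≈Ex L n)) refl (h n n₁≤n))

  m≤2^m : ∀ m → m ℕ.≤ 2 ℕ.^ m
  m≤2^m zero    = ℕ.z≤n
  m≤2^m (suc m) = ℕ.≤-trans (ℕ.+-mono-≤ (ℕ.m^n>0 2 m) (m≤2^m m)) (ℕ.≤-reflexive (≡.cong (2 ℕ.^ m ℕ.+_) (≡.sym (ℕ.+-identityʳ _))))

  -- Cauchy products, leading to exp (- y) ≤ 1 for y ≥ 0.

  private
    conv : (ℕ → Carrier) → (ℕ → Carrier) → ℕ → Carrier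
    conv f g zero    = f 0 * g 0
    conv f g (suc k) = f 0 * g (suc k) + conv (f ∘ suc) g k

    -- The formal derivative, when sequences are read as power series; `conv` is their product.
    D : (ℕ → Carrier) → ℕ → Carrier
    D f i = fromℕ (suc i) * f (suc i)

    conv-cong : ∀ {f f′ g g′} k → (∀ i → f i ≈ f′ i) → (∀ i → g i ≈ g′ i) → conv f g k ≈ conv f′ g′ k
    conv-cong zero    f≈ g≈ = *-cong (f≈ 0) (g≈ 0)
    conv-cong (suc k) f≈ g≈ = +-cong (*-cong (f≈ 0) (g≈ (suc k))) (conv-cong k (f≈ ∘ suc) g≈)

    conv-+ : ∀ {f f′ g} k → conv (λ i → f i + f′ i) g k ≈ conv f g k + conv f′ g k
    conv-+ zero    = distribʳ _ _ _
    conv-+ (suc k) = trans (+-cong (distribʳ _ _ _) (conv-+ k))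
      (solve 4 (λ a b c d → (a :+ b) :+ (c :+ d) := (a :+ c) :+ (b :+ d)) refl _ _ _ _)

    conv-*ˡ : ∀ {f g} a k → conv (λ i → a * f i) g k ≈ a * conv f g k
    conv-*ˡ a zero    = *-assoc _ _ _
    conv-*ˡ a (suc k) = trans (+-cong (*-assoc _ _ _) (conv-*ˡ a k)) (sym (distribˡ _ _ _))

    conv-*ʳ : ∀ {f g} a k → conv f (λ i → a * g i) k ≈ a * conv f g k
    conv-*ʳ a zero    = solve 3 (λ f a g → f :* (a :* g) := a :* (f :* g)) refl _ a _
    conv-*ʳ a (suc k) = trans (+-cong (solve 3 (λ f a g → f :* (a :* g) := a :* (f :* g)) refl _ a _) (conv-*ʳ a k))
      (sym (distribˡ _ _ _))

    leibniz : ∀ f g k → fromℕ (suc k) * conv f g (suc k) ≈ conv (D f) g k + conv f (D g) k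
    leibniz f g zero    = solve 5 (λ n f₀ f₁ g₀ g₁ → n :* (f₀ :* g₁ :+ f₁ :* g₀) := (n :* f₁) :* g₀ :+ f₀ :* (n :* g₁))
      refl (fromℕ 1) (f 0) (f 1) (g 0) (g 1)
    leibniz f g (suc k) = trans
      (solve 4 (λ n′ f₀ g₂ C → (con (ℤ.+ 1) :+ n′) :* (f₀ :* g₂ :+ C) := (con (ℤ.+ 1) :+ n′) :* (f₀ :* g₂) :+ C :+ n′ :* C)
        refl (fromℕ (suc k)) (f 0) (g (suc (suc k))) (conv f′ g (suc k)))
      (trans (+-congˡ (leibniz f′ g k))
      (trans (solve 8 (λ n′ f₀ g₂ f₁ g₁ R P Q → let one = con (ℤ.+ 1) in
          (one :+ n′) :* (f₀ :* g₂) :+ (f₁ :* g₁ :+ R) :+ (P :+ Q) :=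
          ((one :+ con (ℤ.+ 0)) :* f₁ :* g₁ :+ (R :+ P)) :+ (f₀ :* ((one :+ n′) :* g₂) :+ Q))
          refl (fromℕ (suc k)) (f 0) (g (suc (suc k))) (f 1) (g (suc k)) (conv (f′ ∘ suc) g k) (conv (D f′) g k) (conv f′ (D g) k))
        (+-congʳ (+-congˡ (sym (trans (conv-cong k (λ i → trans (distribʳ _ _ _) (+-congʳ (*-identityˡ _))) (λ _ → refl)) (conv-+ k)))))))
      where f′ = f ∘ suc

    -- The series exp (y t) exp (- y t) has derivative zero by `leibniz` and `term-suc`, so all its
    -- coefficients beyond the constant one vanish.
    conv-term : ∀ y k → conv (term y) (term (- y)) (suc k) ≈ 0#
    conv-term y k = ≤-antisym (cancel (≤-reflexive h)) (cancel′ (≤-reflexive (sym h)))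
      where
      h : conv (term y) (term (- y)) (suc k) * fromℕ (suc k) ≈ 0# * fromℕ (suc k)
      h = trans (*-comm _ _) (trans (leibniz (term y) (term (- y)) k)
        (trans (+-cong (trans (conv-cong k (term-suc y) (λ _ → refl)) (conv-*ˡ y k))
                       (trans (conv-cong k (λ _ → refl) (term-suc (- y))) (conv-*ʳ (- y) k)))
          (solve 3 (λ y c n → y :* c :+ (:- y) :* c := con (ℤ.+ 0) :* n) refl y _ (fromℕ (suc k)))))
      cancel  = *-cancelʳ-≤ (0<fromℕ[1+n] k)
      cancel′ = *-cancelʳ-≤ (0<fromℕ[1+n] k)

    -- Every partial sum grows by one term, and together these new terms form the next Cauchy
    -- coefficient.
    conv-partial : ∀ f z m → conv f (Ex z ∘ suc) (suc m) ≈ conv f (Ex z ∘ suc) m + conv f (term z) (suc m)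
    conv-partial f z zero    = solve 5 (λ f₀ f₁ G₀ g₀ g₁ → let zro = con (ℤ.+ 0) in
      f₀ :* ((zro :+ g₀) :+ g₁) :+ f₁ :* (zro :+ g₀) := f₀ :* (zro :+ g₀) :+ (f₀ :* g₁ :+ f₁ :* g₀))
      refl (f 0) (f 1) 0# (term z 0) (term z 1)
    conv-partial f z (suc m) = trans (+-congˡ (conv-partial (f ∘ suc) z m))
      (solve 5 (λ f₀ G g A B → f₀ :* (G :+ g) :+ (A :+ B) := (f₀ :* G :+ A) :+ (f₀ :* g :+ B)) refl _ _ _ _ _)

    -- The product of the series for exp y with the partial sums for exp (- y).
    conv-Ex : ∀ y m → conv (term y) (Ex (- y) ∘ suc) m ≈ 1#
    conv-Ex y zero    = trans (*-cong (term-zero y) (Ex-1 (- y))) (*-identityˡ 1#)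
    conv-Ex y (suc m) = trans (conv-partial (term y) (- y) m)
      (trans (+-cong (conv-Ex y m) (conv-term y m)) (+-identityʳ 1#))

    conv-mono : ∀ {f g g′} m → (∀ i → 0# ≤ f i) → (∀ i → g i ≤ g′ i) → conv f g m ≤ conv f g′ m
    conv-mono zero    0≤f g≤ = *-monoʳ-≤ (0≤f 0) (g≤ 0)
    conv-mono (suc m) 0≤f g≤ = +-mono-≤ (*-monoʳ-≤ (0≤f 0) (g≤ (suc m))) (conv-mono m (0≤f ∘ suc) g≤)

    -- The sum of 2^i times the i-th entry. For the exponential series it belongs to the series for
    -- exp (2y), hence stays bounded; splitting 2^m as 2^i 2^(m - i) then shows that a convolution
    -- with a geometrically dominated sequence is of order 2^(- m).
    weighted : (ℕ → Carrier) → ℕ → Carrier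
    weighted f zero    = f 0
    weighted f (suc m) = f 0 + 2# * weighted (f ∘ suc) m

    conv-geometric : ∀ {f g C} m → (∀ i → 0# ≤ f i) → (∀ j → g j * 2# ^ j ≤ C) →
                     conv f g m * 2# ^ m ≤ weighted f m * C
    conv-geometric zero    0≤f g≤ = ≤-resp (sym (*-assoc _ _ _)) refl (*-monoʳ-≤ (0≤f 0) (g≤ 0))
    conv-geometric {f} {g} {C} (suc m) 0≤f g≤ = ≤-trans
      (≤-reflexive (solve 5 (λ f g c t x → (f :* g :+ c) :* (t :* x) := f :* (g :* (t :* x)) :+ t :* (c :* x)) refl (f 0) _ _ 2# (2# ^ m)))
      (≤-trans (+-mono-≤ (*-monoʳ-≤ (0≤f 0) (g≤ (suc m))) (*-monoʳ-≤ 0≤2# (conv-geometric m (0≤f ∘ suc) g≤)))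
        (≤-reflexive (solve 4 (λ f t w c → f :* c :+ t :* (w :* c) := (f :+ t :* w) :* c) refl (f 0) 2# _ C)))

    weighted-term : ∀ y {f} k m → (∀ i → f i ≈ term y (i ℕ.+ k)) →
                    weighted f m * 2# ^ k + Ex (2# * y) k ≈ Ex (2# * y) (suc (m ℕ.+ k))
    weighted-term y {f} k zero    h = trans (+-comm _ _) (+-congˡ (term-2y (h 0)))
      where
      term-2y : ∀ {x} → x ≈ term y k → x * 2# ^ k ≈ term (2# * y) k
      term-2y x≈ = trans (*-congʳ x≈) (trans
        (solve 3 (λ a b c → a :* b :* c := (c :* a) :* b) refl (y ^ k) (1/! k) (2# ^ k))
        (*-congʳ (sym (^-distrib-* 2# y k))))
    weighted-term y {f} k (suc m) h = trans
      (solve 5 (λ a t w x e → (a :+ t :* w) :* x :+ e := w :* (t :* x) :+ (a :* x :+ e)) refl (f 0) 2# (weighted (f ∘ suc) m) (2# ^ k) _)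
      (trans (+-congˡ (weighted-term y {f} k zero h))
      (trans (weighted-term y (suc k) m (λ i → trans (h (suc i)) (reflexive (≡.cong (term y) (≡.sym (ℕ.+-suc i k))))))
        (reflexive (≡.cong (Ex (2# * y) ∘ suc) (ℕ.+-suc m k)))))

    -- The two signs are proved together because the next factor exchanges them.
    ^-neg : ∀ {y} k → 0# ≤ y → 0# ≤ y ^ k + (- y) ^ k × 0# ≤ y ^ k - (- y) ^ k
    ^-neg zero 0≤y = +-nonneg 0≤1 0≤1 , ≤-reflexive (sym (-‿inverseʳ 1#))
    ^-neg {y} (suc k) 0≤y with ^-neg k 0≤y
    ... | h₁ , h₂ =
      ≤-resp refl (solve 3 (λ y a b → y :* (a :- b) := y :* a :+ (:- y) :* b) refl y _ _) (*-nonneg 0≤y h₂) ,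
      ≤-resp refl (solve 3 (λ y a b → y :* (a :+ b) := y :* a :- (:- y) :* b) refl y _ _) (*-nonneg 0≤y h₁)

    Ex-neg : ∀ {y} n → 0# ≤ y → 0# ≤ Ex y n + Ex (- y) n
    Ex-neg zero 0≤y = ≤-reflexive (sym (+-identityˡ 0#))
    Ex-neg {y} (suc n) 0≤y = ≤-resp refl
      (solve 5 (λ a b x y i → (a :+ b) :+ (x :+ y) :* i := (a :+ x :* i) :+ (b :+ y :* i)) refl _ _ _ _ (1/! n))
      (+-nonneg (Ex-neg n 0≤y) (*-nonneg (proj₁ (^-neg n 0≤y)) (<⇒≤ (1/!-pos n))))

    unbounded : ∀ {e} B n₀ → 0# < e → ∃[ m ] n₀ ℕ.≤ m × B < e * 2# ^ m
    unbounded {e} B n₀ 0<e = scale-up (1/ 0<e)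
      where
      step : ∀ n → B < e * fromℕ n → ∃[ m ] n₀ ℕ.≤ m × B < e * 2# ^ m
      step n B<en = m , ℕ.m≤n⊔m n n₀ , <-≤-trans B<en (*-monoʳ-≤ (<⇒≤ 0<e) n≤2^m)
        where
        m = n ℕ.⊔ n₀
        n≤2^m : fromℕ n ≤ 2# ^ m
        n≤2^m = ≤-trans (fromℕ-mono-≤ (ℕ.≤-trans (ℕ.m≤m⊔n n n₀) (m≤2^m m))) (≤-reflexive (fromℕ-^ 2 m))

      scale-up : ∃[ e′ ] 0# < e′ × e * e′ ≈ 1# → ∃[ m ] n₀ ℕ.≤ m × B < e * 2# ^ m
      scale-up (e′ , 0<e′ , ee′≈1) = let (n , Be′<n) = archimedean (B * e′) in step n
        (<-resp (trans (*-assoc B e′ e) (trans (*-congˡ (trans (*-comm e′ e) ee′≈1)) (*-identityʳ B)))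
          (*-comm (fromℕ n) e) (*-monoˡ-< 0<e Be′<n))

    -- In `conv-Ex` at `m + 1` the leading summand is at least `1 + e`, so the rest of the
    -- convolution is at most `- e`. Only negative partial sums can cause this; they have index
    -- below `j₀`, and their total contribution is of order 2^(- m).
    no-lower-bound : ∀ {y e M M₂} j₀ m → 0# ≤ y → (∀ n → Ex y n ≤ M) → (∀ n → Ex (2# * y) n ≤ M₂) → 0# < e →
                     (∀ n → j₀ ℕ.≤ n → 1# + e ≤ Ex (- y) n) →
                     j₀ ℕ.≤ m → ¬ (M₂ * (M * 2# ^ j₀) < e * 2# ^ m)
    no-lower-bound {y} {e} {M} {M₂} j₀ m 0≤y Ex≤M Ex≤M₂ 0<e large j₀≤m =
      ≤-trans (*-monoˡ-≤ (^-nonneg m 0≤2#) e≤conv) (≤-trans (conv-geometric m 0≤f g-geometric)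
        (*-monoˡ-≤ 0≤C weighted≤M₂))
      where
      f g G : ℕ → Carrier
      f = term y ∘ suc
      G = Ex (- y) ∘ suc
      C : Carrier
      C = M * 2# ^ j₀
      -- A majorant of `- G`: below `j₀` it uses `- Ex (- y) ≤ Ex y ≤ M`, and from `j₀` on `G` is
      -- positive, so zero suffices.
      g j with j ℕ.<? j₀
      ... | yes _ = M
      ... | no  _ = 0#

      0≤f : ∀ i → 0# ≤ f i
      0≤f i = term-nonneg (suc i) 0≤y

      0≤M : 0# ≤ M
      0≤M = Ex≤M 0

      0≤C : 0# ≤ C
      0≤C = *-nonneg 0≤M (^-nonneg j₀ 0≤2#)

      g-geometric : ∀ j → g j * 2# ^ j ≤ C
      g-geometric j with j ℕ.<? j₀
      ... | yes j<j₀ = *-monoʳ-≤ 0≤M (^-monoʳ-≤ (1≤fromℕ {2} (ℕ.s≤s ℕ.z≤n)) (ℕ.<⇒≤ j<j₀))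
      ... | no  _    = ≤-resp (sym (zeroˡ _)) refl 0≤C

      -G≤g : ∀ j → - G j ≤ g j
      -G≤g j with j ℕ.<? j₀
      ... | yes _ = ≤-trans
        (≤-by (Ex y (suc j) + G j) (solve 2 (λ a b → a := :- b :+ (a :+ b)) refl (Ex y (suc j)) (G j)) (Ex-neg (suc j) 0≤y))
        (Ex≤M (suc j))
      ... | no j≮j₀ = ≤-trans (neg-≤ (≤-trans (+-nonneg 0≤1 (<⇒≤ 0<e)) (large (suc j) (ℕ.≤-trans (ℕ.≮⇒≥ j≮j₀) (ℕ.n≤1+n j)))))
        (≤-reflexive -0#≈0#)

      conv-neg : ∀ {f} m → conv f (λ j → - G j) m ≈ - conv f G m
      conv-neg {f} zero    = solve 2 (λ f g → f :* (:- g) := :- (f :* g)) refl (f 0) (G 0)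
      conv-neg {f} (suc m) = trans (+-congˡ (conv-neg m))
        (solve 3 (λ f g c → f :* (:- g) :+ :- c := :- (f :* g :+ c)) refl (f 0) (G (suc m)) _)

      e≤conv : e ≤ conv f g m
      e≤conv = ≤-trans (≤-by (G (suc m) - (1# + e))
          (trans (solve 2 (λ x c → :- c := (x :* con (ℤ.+ 1) :- (x :* con (ℤ.+ 1) :+ c)) ) refl (G (suc m)) (conv f G m))
          (trans (+-congˡ (-‿cong (trans (+-congʳ (trans (*-comm _ _) (*-congʳ (sym (term-zero y))))) (conv-Ex y (suc m)))))
            (solve 2 (λ x e → x :* con (ℤ.+ 1) :- con (ℤ.+ 1) := e :+ (x :- (con (ℤ.+ 1) :+ e))) refl (G (suc m)) e)))
          (x≤y⇒0≤y-x (large (suc (suc m)) (ℕ.≤-trans j₀≤m (ℕ.≤-trans (ℕ.n≤1+n m) (ℕ.n≤1+n (suc m)))))))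
        (≤-trans (≤-reflexive (sym (conv-neg m))) (conv-mono m 0≤f -G≤g))

      weighted≤M₂ : weighted f m ≤ M₂
      weighted≤M₂ = ≤-trans (≤-by (W + Ex (2# * y) 1)
          (solve 2 (λ w x → w :* ((con (ℤ.+ 1) :+ (con (ℤ.+ 1) :+ con (ℤ.+ 0))) :* con (ℤ.+ 1)) :+ x := w :+ (w :+ x)) refl W (Ex (2# * y) 1))
          (+-nonneg (0≤weighted m 0≤f) (Ex-nonneg 1 0≤2y)))
        (≤-trans (≤-reflexive (weighted-term y 1 m (λ i → reflexive (≡.cong (term y) (ℕ.+-comm 1 i)))))
          (Ex≤M₂ (suc (m ℕ.+ 1))))
        where
        W = weighted f m
        0≤2y : 0# ≤ 2# * y
        0≤2y = *-nonneg 0≤2# 0≤y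
        0≤weighted : ∀ {f} m → (∀ i → 0# ≤ f i) → 0# ≤ weighted f m
        0≤weighted zero    0≤f = 0≤f 0
        0≤weighted (suc m) 0≤f = +-nonneg (0≤f 0) (*-nonneg 0≤2# (0≤weighted m (0≤f ∘ suc)))

  eventually-≥ : ∀ {s l b} → s ⟶ l → b < l → ∃[ n₀ ] ∀ n → n₀ ℕ.≤ n → b ≤ s n
  eventually-≥ {s} {l} {b} s⟶l b<l with s⟶l (l - b) (x<y⇒0<y-x b<l)
  ... | n₀ , h = n₀ , λ n n₀≤n → <⇒≤ (0<y-x⇒x<y (<-respʳ-≈
    (solve 3 (λ l b s → (l :- b) :- (l :- s) := s :- b) refl l b (s n)) (x<y⇒0<y-x (proj₂ (h n n₀≤n)))))

  -- `IsLog` does not by itself exclude a negative logarithm of a number above 1. At negative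
  -- arguments the series has mixed signs and cannot be estimated term by term; its product with the
  -- series at `y` is used instead.
  exp-neg≤1 : ∀ {x y} → 0# ≤ y → IsLog x (- y) → x ≤ 1#
  exp-neg≤1 {x} {y} 0≤y log 1<x = absurd (archimedean y) (archimedean (2# * y)) (eventually-≥ log 1+e<x)
    where
    e : Carrier
    e = (x - 1#) * 1/2

    0<e : 0# < e
    0<e = *-pos (x<y⇒0<y-x 1<x) 0<1/2

    1+e<x : 1# + e < x
    1+e<x = 0<y-x⇒x<y (<-respʳ-≈ (sym (trans
        (solve 2 (λ x e → let one = con (ℤ.+ 1) in x :- (one :+ e) := (x :- one) :* one :- e) refl x e)
        (trans (+-congʳ (*-congˡ (sym 2*1/2)))
          (solve 2 (λ x h → let one = con (ℤ.+ 1); two = one :+ (one :+ con (ℤ.+ 0)) in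
            (x :- one) :* (two :* h) :- (x :- one) :* h := (x :- one) :* h) refl x 1/2))))
      0<e)

    absurd : ∃[ A ] y < fromℕ A → ∃[ A ] 2# * y < fromℕ A → ∃[ n₀ ] (∀ n → n₀ ℕ.≤ n → 1# + e ≤ expPartialSum (- y) n) → ⊥
    absurd (A , y<A) (A₂ , 2y<A₂) (n₀ , h) = finish (unbounded (M₂ * (M * 2# ^ n₀)) n₀ 0<e)
      where
      M M₂ : Carrier
      M  = fromℕ (4 ℕ.^ A)
      M₂ = fromℕ (4 ℕ.^ A₂)

      finish : ∃[ m ] n₀ ℕ.≤ m × M₂ * (M * 2# ^ n₀) < e * 2# ^ m → ⊥
      finish (m , n₀≤m , unbdd) = no-lower-bound n₀ m 0≤y
        (λ n → Ex-bounded A n 0≤y (<⇒≤ y<A)) (λ n → Ex-bounded A₂ n (*-nonneg 0≤2# 0≤y) (<⇒≤ 2y<A₂)) 0<e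
        (λ n n₀≤n → ≤-resp refl (expPartialSum≈Ex (- y) n) (h n n₀≤n)) n₀≤m unbdd

-- Logarithms, and what the two thresholds imply.

module Logarithm {c ℓ₁ ℓ₂} (ℝ : CompleteOrderedField c ℓ₁ ℓ₂) where
  open OrderedField ℝ
  open RealAnalysis ℝ using (expPartialSum; IsLog; IsDegreeThreshold; IsProbThreshold; fromℕ#0)
  open Exponential ℝ

  log-resp : ∀ {x L L′} → L ≈ L′ → IsLog x L → IsLog x L′
  log-resp {x} {L} {L′} L≈L′ log e 0<e = let (n₀ , h) = log e 0<e in n₀ , λ n n₀≤n →
    <-respˡ-≈ (+-congʳ (same n)) (proj₁ (h n n₀≤n)) ,
    <-respˡ-≈ (+-congˡ (-‿cong (same n))) (proj₂ (h n n₀≤n))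
    where
    same : ∀ n → expPartialSum L n ≈ expPartialSum L′ n
    same n = trans (expPartialSum≈Ex L n) (trans (Ex-cong n L≈L′) (sym (expPartialSum≈Ex L′ n)))

  log-nonneg : ∀ {x L} → 1# < x → IsLog x L → 0# ≤ L
  log-nonneg 1<x log L<0 = exp-neg≤1 (<⇒≤ (neg-pos L<0)) (log-resp (sym (-‿involutive _)) log) 1<x

  -- If `L′ < L`, then exp L is at least exp L′ plus the difference `v`, so the partial sums at `L′`
  -- stay `v` below `x` and cannot converge to it.
  log-mono : ∀ {x L L′} → 0# ≤ L → 0# ≤ L′ → IsLog x L → IsLog x L′ → L ≤ L′
  log-mono {x} {L} {L′} 0≤L 0≤L′ log log′ L′<L = exp≤ {b = x - v} 1 log′ below
    (0<y-x⇒x<y (<-respʳ-≈ (solve 2 (λ x v → v := x :- (x :- v)) refl x v) 0<v))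
    where
    v : Carrier
    v = L - L′

    0<v : 0# < v
    0<v = x<y⇒0<y-x L′<L

    below : ∀ n → 1 ℕ.≤ n → Ex L′ n ≤ x - v
    below (suc n) _ = ≤-trans (Ex-monoʳ {m = suc n} {suc (suc n)} 0≤L′ (ℕ.≤′-step ℕ.≤′-refl))
      (≤-resp (solve 2 (λ a b → (a :+ b) :- b := a) refl (Ex L′ (suc (suc n))) v) refl
        (+-monoˡ-≤ (- v) (≤-trans
          (+-monoʳ-≤ _ (≤-resp (*-identityʳ v) refl (*-monoʳ-≤ (<⇒≤ 0<v) (1≤Ex n 0≤L′))))
          (≤-trans (Ex-+-≥ (suc n) 0≤L′ (<⇒≤ 0<v))
          (≤-trans (≤-reflexive (Ex-cong (suc (suc n)) (solve 2 (λ a b → b :+ (a :- b) := a) refl L L′)))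
            (Ex≤exp (suc (suc n)) 0≤L log))))))

  -- Each threshold comes with its own witness for log N; this identifies them.
  log-unique : ∀ {x L L′} → 1# < x → IsLog x L → IsLog x L′ → L ≈ L′
  log-unique 1<x log log′ = ≤-antisym
    (log-mono (log-nonneg 1<x log) (log-nonneg 1<x log′) log log′)
    (log-mono (log-nonneg 1<x log′) (log-nonneg 1<x log) log′ log)

  log-large : ∀ {N L} A → 4 ℕ.^ A ℕ.< N → 0# ≤ L → IsLog (fromℕ N) L → fromℕ A ≤ L
  log-large A 4^A<N 0≤L log L<A =
    exp≤ 0 log (λ n _ → Ex-bounded A n 0≤L (<⇒≤ L<A)) (fromℕ-mono-< 4^A<N)

  1≤2loglog : ∀ {L ℓ} → 2# < L → 0# ≤ ℓ → IsLog L ℓ → 1# ≤ 2# * ℓ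
  1≤2loglog {L} {ℓ} 2<L 0≤ℓ log 2ℓ<1 = exp≤ 0 log (λ n _ → ≤-trans
    (≤-trans (≤-reflexive (Ex-cong n (sym (trans (*-congʳ (+-identityʳ 1#)) (*-identityˡ ℓ)))))
      (Ex≤[1+2w]^j 1 n 0≤ℓ (<⇒≤ 2ℓ<1)))
    (≤-trans (≤-reflexive (*-identityʳ _)) (≤-trans (+-monoʳ-≤ 1# (<⇒≤ 2ℓ<1)) (≤-reflexive (+-congˡ (sym (+-identityʳ 1#))))))) 2<L

  -- Choose `j` above `2 ℓ`. Then `L = exp ℓ ≤ (1 + 2 ℓ / j)^j`, and the k-th power of this is at
  -- most exp (2 ℓ k), hence at most exp L. Passing from exp to a power and back doubles the
  -- exponent, and the 2 in the denominator of the degree threshold pays for it.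
  log^k≤ : ∀ {N L ℓ} k → 0# ≤ L → 0# ≤ ℓ → IsLog N L → IsLog L ℓ → 2# * ℓ * fromℕ k ≤ L → L ^ k ≤ N
  log^k≤ {N} {L} {ℓ} k 0≤L 0≤ℓ logN logL 2ℓk≤L = go (archimedean (2# * ℓ))
    where
    go : ∃[ j ] 2# * ℓ < fromℕ j → L ^ k ≤ N
    go (j , 2ℓ<j) = finish (1/ 0<j)
      where
      0<j : 0# < fromℕ j
      0<j = ≤-<-trans (*-nonneg 0≤2# 0≤ℓ) 2ℓ<j

      finish : ∃[ y ] 0# < y × fromℕ j * y ≈ 1# → L ^ k ≤ N
      finish (y , 0<y , jy≈1) = ≤-trans (^-monoˡ-≤ k 0≤L L≤[1+v]^j)
        (≤-trans (≤-reflexive (^-assocʳ (1# + v) j k))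
        (≤-trans (≤-reflexive (sym (trans (*-congˡ (Ex-1 0#)) (*-identityʳ _))))
        (≤-trans ([1+v]^n*Ex (j ℕ.* k) 1 ≤-refl 0≤v)
        (≤-trans (Ex-monoˡ (j ℕ.* k ℕ.+ 1) (+-nonneg ≤-refl (*-nonneg (fromℕ-nonneg (j ℕ.* k)) 0≤v))
            (≤-trans (≤-reflexive jkv≈2ℓk) 2ℓk≤L))
          (Ex≤exp (j ℕ.* k ℕ.+ 1) 0≤L logN)))))
        where
        w v : Carrier
        w = ℓ * y
        v = 2# * w

        0≤w : 0# ≤ w
        0≤w = *-nonneg 0≤ℓ (<⇒≤ 0<y)

        0≤v : 0# ≤ v
        0≤v = *-nonneg 0≤2# 0≤w

        jw≈ℓ : fromℕ j * w ≈ ℓ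
        jw≈ℓ = trans (solve 3 (λ j l y → j :* (l :* y) := l :* (j :* y)) refl (fromℕ j) ℓ y) (trans (*-congˡ jy≈1) (*-identityʳ ℓ))

        2w≤1 : 2# * w ≤ 1#
        2w≤1 = ≤-resp (*-assoc _ _ _) jy≈1 (*-monoˡ-≤ (<⇒≤ 0<y) (<⇒≤ 2ℓ<j))

        jkv≈2ℓk : 0# + fromℕ (j ℕ.* k) * v ≈ 2# * ℓ * fromℕ k
        jkv≈2ℓk = trans (+-identityˡ _) (trans (*-congʳ (fromℕ-* j k))
          (trans (solve 4 (λ j k t w → j :* k :* (t :* w) := t :* (j :* w) :* k) refl (fromℕ j) (fromℕ k) 2# w)
            (*-congʳ (*-congˡ jw≈ℓ))))

        L≤[1+v]^j : L ≤ (1# + v) ^ j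
        L≤[1+v]^j = exp≤ 0 logL (λ n _ → ≤-trans (≤-reflexive (Ex-cong n (sym jw≈ℓ))) (Ex≤[1+2w]^j j n 0≤w 2w≤1))

  -- Squaring `d ≤ s` gives `2 ℓ d² ≤ L`. The later estimates use the bound on `d` through these two
  -- consequences only.
  degree-threshold : ∀ {γ N d dN L} → 0# < γ → γ < 1# → 2 ℕ.≤ d → IsDegreeThreshold γ N dN → fromℕ d ≤ dN →
    1# < fromℕ N → 2# < L → IsLog (fromℕ N) L → fromℕ (d ℕ.* d) ≤ L × L ^ (d ℕ.* d) ≤ fromℕ N
  degree-threshold {γ} {N} {d} {dN} {L} 0<γ γ<1 2≤d (logN , ℓ , 2ℓ#0 , s , log , loglog , (0≤s , s²≈) , dN≈) d≤dN 1<N 2<L log′ =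
    ≤-trans (≤-resp (*-identityˡ _) refl (*-monoˡ-≤ (fromℕ-nonneg (d ℕ.* d)) (1≤2loglog 2<L (<⇒≤ 0<ℓ) loglog′))) 2ℓd²≤L ,
    log^k≤ (d ℕ.* d) (<⇒≤ 0<L) (<⇒≤ 0<ℓ) log′ loglog′ 2ℓd²≤L
    where
    z : Carrier
    z = 2# * ℓ

    L≈ : logN ≈ L
    L≈ = log-unique 1<N log log′

    0<L : 0# < L
    0<L = <-trans (0<fromℕ[1+n] 1) 2<L

    loglog′ : IsLog L ℓ
    loglog′ e 0<e = let (n₀ , h) = loglog e 0<e in n₀ , λ n n₀≤n →
      <-respˡ-≈ (+-congˡ (-‿cong L≈)) (proj₁ (h n n₀≤n)) , <-respˡ-≈ (+-congʳ L≈) (proj₂ (h n n₀≤n))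

    s²z≈L : s * s * z ≈ L
    s²z≈L = trans (*-congʳ (trans (*-congˡ (sym (*-identityʳ s))) s²≈))
      (trans (*-assoc _ _ _) (trans (*-congˡ (trans (*-comm _ _) (inverse 2ℓ#0))) (trans (*-identityʳ _) L≈)))

    d≤s : fromℕ d ≤ s
    d≤s = ≤-trans d≤dN (≤-trans (≤-reflexive dN≈) (≤-by (γ * s)
      (solve 2 (λ g s → s := (con (ℤ.+ 1) :- g) :* s :+ g :* s) refl γ s) (*-nonneg (<⇒≤ 0<γ) 0≤s)))

    0<s : 0# < s
    0<s = <-≤-trans 0<1 (≤-trans (1≤fromℕ (ℕ.≤-trans (ℕ.n≤1+n 1) 2≤d)) d≤s)

    -- The given `2ℓ#0` leaves the sign of log log N open; it is settled by `s² z = L > 0`.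
    0<z : 0# < z
    0<z = [ (λ z<0 → ⊥-elim (<-asym 0<L (<-resp (trans (*-comm _ _) s²z≈L) (zeroˡ _)
              (*-monoˡ-< (*-pos 0<s 0<s) z<0)))) , (λ 0<z → 0<z) ]′ (#⇒<⊎> 2ℓ#0)

    0<ℓ : 0# < ℓ
    0<ℓ = <-resp (zeroˡ 1/2) (trans (solve 3 (λ t l h → t :* l :* h := l :* (t :* h)) refl 2# ℓ 1/2) (trans (*-congˡ 2*1/2) (*-identityʳ ℓ)))
      (*-monoˡ-< 0<1/2 0<z)

    2ℓd²≤L : 2# * ℓ * fromℕ (d ℕ.* d) ≤ L
    2ℓd²≤L = ≤-trans (*-monoʳ-≤ (<⇒≤ 0<z) (≤-trans (≤-reflexive (fromℕ-* d d))
        (*-mono-≤ (fromℕ-nonneg d) (fromℕ-nonneg d) d≤s d≤s)))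
      (≤-reflexive (trans (*-comm _ _) s²z≈L))

  prob-threshold : ∀ {ε N} .{{_ : NonZero N}} {d r p L} → 0# ≤ p → p ≤ r → IsProbThreshold ε N d r →
    1# < fromℕ N → IsLog (fromℕ N) L →
    fromℕ (2 ℕ.^ d) * fromℕ (N ℕ.^ (d ℕ.∸ 1)) * p ^ d ≤ (1# - ε) * L
  prob-threshold {ε} {N} {d} {r} {p} {L} 0≤p p≤r (logN , log , _ , r^d≈) 1<N log′ = ≤-trans
    (*-monoʳ-≤ (*-nonneg (fromℕ-nonneg (2 ℕ.^ d)) (fromℕ-nonneg (N ℕ.^ (d ℕ.∸ 1)))) (^-monoˡ-≤ d 0≤p p≤r))
    (≤-reflexive (trans (*-congˡ r^d≈)
      (trans (solve 6 (λ a b e x l y → a :* b :* (e :* x :* (l :* y)) := (a :* x) :* (b :* y) :* (e :* l)) refl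
        (fromℕ (2 ℕ.^ d)) (fromℕ (N ℕ.^ (d ℕ.∸ 1))) (1# - ε) _ logN _)
      (trans (*-congʳ (trans (*-cong
          (inverse (fromℕ#0 (2 ℕ.^ d) {{ℕ.m^n≢0 2 d}}))
          (inverse (fromℕ#0 (N ℕ.^ (d ℕ.∸ 1)) {{ℕ.m^n≢0 N (d ℕ.∸ 1)}}))) (*-identityˡ 1#)))
      (trans (*-identityˡ _) (*-congˡ (log-unique 1<N log log′)))))))

-- The numerical estimates.

module Estimates {c ℓ₁ ℓ₂} (ℝ : CompleteOrderedField c ℓ₁ ℓ₂) where
  open OrderedField ℝ
  open Exponential ℝ

  private
    x≤x^suc : ∀ {x} m → 1# ≤ x → x ≤ x ^ suc m
    x≤x^suc m 1≤x = ≤-resp (*-identityʳ _) refl (*-monoʳ-≤ (≤-trans 0≤1 1≤x) (1≤^ m 1≤x))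

    1≤* : ∀ {x y} → 1# ≤ x → 1# ≤ y → 1# ≤ x * y
    1≤* 1≤x 1≤y = ≤-resp (*-identityˡ 1#) refl (*-mono-≤ 0≤1 0≤1 1≤x 1≤y)

    ^-* : ∀ x m n → (x ^ m) ^ n ≈ x ^ (m ℕ.* n)
    ^-* = ^-assocʳ

    1≤2# : 1# ≤ 2#
    1≤2# = 1≤fromℕ {2} (ℕ.s≤s ℕ.z≤n)

    fromℕ≤2^ : ∀ d → fromℕ d ≤ 2# ^ d
    fromℕ≤2^ d = ≤-trans (fromℕ-mono-≤ (m≤2^m d)) (≤-reflexive (fromℕ-^ 2 d))

    n!≤n^n : ∀ n → n ! ℕ.≤ n ℕ.^ n
    n!≤n^n zero    = ℕ.≤-refl
    n!≤n^n (suc n) = ℕ.*-monoʳ-≤ (suc n) (ℕ.≤-trans (n!≤n^n n) (ℕ.^-monoˡ-≤ n (ℕ.n≤1+n n)))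

    square-suc : ∀ P → P ℕ.* P ℕ.+ (suc P ℕ.+ P) ≡ suc P ℕ.* suc P
    square-suc = solveℕ 1 (λ P → P :*ℕ P :+ℕ (conℕ 1 :+ℕ P :+ℕ P) :=ℕ (conℕ 1 :+ℕ P) :*ℕ (conℕ 1 :+ℕ P)) ≡.refl
      where
      open +-*-Solver using () renaming (solve to solveℕ; _:*_ to _:*ℕ_; _:+_ to _:+ℕ_; _:=_ to _:=ℕ_; con to conℕ)

    square-≤ : ∀ P → 1 ℕ.≤ P → suc P ℕ.* suc P ℕ.≤ 4 ℕ.* (P ℕ.* P)
    square-≤ P 1≤P = ℕ.≤-trans (ℕ.*-mono-≤ suc≤2* suc≤2*) (ℕ.≤-reflexive (solveℕ 1 (λ P →
        (P :+ℕ (P :+ℕ conℕ 0)) :*ℕ (P :+ℕ (P :+ℕ conℕ 0)) :=ℕ conℕ 4 :*ℕ (P :*ℕ P)) ≡.refl P))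
      where
      open +-*-Solver using () renaming (solve to solveℕ; _:*_ to _:*ℕ_; _:+_ to _:+ℕ_; _:=_ to _:=ℕ_; con to conℕ)
      suc≤2* : suc P ℕ.≤ 2 ℕ.* P
      suc≤2* = ℕ.+-mono-≤ 1≤P (ℕ.≤-reflexive (≡.sym (ℕ.+-identityʳ P)))

  -- Compared after raising both sides to the power d, where βᵈ ≤ 4ᵈ N L.
  polynomial-bound : ∀ {N L M c} P → let d = suc P; D = fromℕ d in
    1 ℕ.≤ P → 0# ≤ M → 1# ≤ L → 1# ≤ c → M ^ d ≤ N * L → D ≤ L → L ^ (d ℕ.* d) ≤ N →
    (c * (2# * 2# * 2#) * (2# * 2#)) ^ 4 ≤ L →
    c * L * (D * D * D) * (2# * M + 2# * D) ^ P ≤ N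
  -- The d-th power of the left side is at most `(32 c)^(d²) L^(d + P) N^P`, where 32 = 8 · 4 comes
  -- from `D³ ≤ 8^d` and `βᵈ ≤ 4ᵈ N L`. As `d² ≤ 4 P²`, the last hypothesis bounds the first factor
  -- by `L^(P²)`, and `P² + d + P = d²`.
  polynomial-bound {N} {L} {M} {c} P 1≤P 0≤M 1≤L 1≤c M^d≤NL D≤L L^dd≤N H⁴≤L = ^-cancel-≤ P 0≤N
    (≤-trans (≤-reflexive (^-distrib-* X (β ^ P) d)) (≤-trans
      (*-mono-≤ (^-nonneg d 0≤X) (^-nonneg d (^-nonneg P 0≤β)) X^d≤
        (≤-trans (≤-reflexive (trans (^-* β P d) (trans (reflexive (≡.cong (β ^_) (ℕ.*-comm P d))) (sym (^-* β d P)))))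
        (≤-trans (^-monoˡ-≤ P (^-nonneg d 0≤β) β^d≤)
        (≤-trans (≤-reflexive (trans (^-distrib-* (f ^ d) (N * L) P) (*-cong (^-* f d P) (^-distrib-* N L P))))
          (*-monoˡ-≤ (*-nonneg (^-nonneg P 0≤N) (^-nonneg P 0≤L)) (^-monoʳ-≤ 1≤f (ℕ.*-monoʳ-≤ d (ℕ.n≤1+n P))))))))
    (≤-trans (≤-reflexive (solve 6 (λ a b x f n l → (a :* x :* b) :* (f :* (n :* l)) := ((a :* b) :* f) :* (x :* l) :* n)
        refl (c ^ dd) (e ^ dd) (L ^ d) (f ^ dd) (N ^ P) (L ^ P)))
    (*-monoˡ-≤ (^-nonneg P 0≤N) (≤-trans
      (≤-reflexive (*-cong (trans (*-congʳ (sym (^-distrib-* c e dd))) (sym (^-distrib-* (c * e) f dd))) (sym (^-homo-* L d P))))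
      (≤-trans (*-monoˡ-≤ (^-nonneg (d ℕ.+ P) 0≤L) H^dd≤)
      (≤-trans (≤-reflexive (trans (sym (^-homo-* L (P ℕ.* P) (d ℕ.+ P))) (reflexive (≡.cong (L ^_) (square-suc P))))) L^dd≤N)))))))
    where
    d dd : ℕ
    d = suc P
    dd = d ℕ.* d
    D X β e f : Carrier
    D = fromℕ d
    X = c * L * (D * D * D)
    β = 2# * M + 2# * D
    e = 2# * 2# * 2#
    f = 2# * 2#

    0≤L : 0# ≤ L
    0≤L = ≤-trans 0≤1 1≤L
    0≤c : 0# ≤ c
    0≤c = ≤-trans 0≤1 1≤c
    0≤N : 0# ≤ N
    0≤N = ≤-trans (^-nonneg dd 0≤L) L^dd≤N
    0≤D : 0# ≤ D
    0≤D = fromℕ-nonneg d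
    0≤β : 0# ≤ β
    0≤β = +-nonneg (*-nonneg 0≤2# 0≤M) (*-nonneg 0≤2# 0≤D)
    1≤f : 1# ≤ f
    1≤f = 1≤* 1≤2# 1≤2#
    1≤e : 1# ≤ e
    1≤e = 1≤* 1≤f 1≤2#
    0≤f : 0# ≤ f
    0≤f = ≤-trans 0≤1 1≤f
    0≤DDD : 0# ≤ D * D * D
    0≤DDD = *-nonneg (*-nonneg 0≤D 0≤D) 0≤D
    0≤X : 0# ≤ X
    0≤X = *-nonneg (*-nonneg 0≤c 0≤L) 0≤DDD
    double : ∀ x → 2# * x + 2# * x ≈ f * x
    double x = solve 1 (λ x → let two = con (ℤ.+ 1) :+ (con (ℤ.+ 1) :+ con (ℤ.+ 0)) in
      two :* x :+ two :* x := two :* two :* x) refl x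

    -- The larger of `M` and `D` dominates: either `M^d ≤ N L` is given, or `D^d ≤ L^(d²) ≤ N`.
    β^d≤ : β ^ d ≤ f ^ d * (N * L)
    β^d≤ = ≤-by-cases M D
      (λ M≤D → ≤-trans (^-monoˡ-≤ d 0≤β (≤-trans (+-monoˡ-≤ _ (*-monoʳ-≤ 0≤2# M≤D)) (≤-reflexive (double D))))
        (≤-trans (≤-reflexive (^-distrib-* f D d)) (*-monoʳ-≤ (^-nonneg d 0≤f)
        (≤-trans (^-monoˡ-≤ d 0≤D D≤L) (≤-trans (^-monoʳ-≤ 1≤L (ℕ.m≤m*n d d))
        (≤-trans L^dd≤N (≤-resp (*-identityʳ N) refl (*-monoʳ-≤ 0≤N 1≤L))))))))
      (λ D≤M → ≤-trans (^-monoˡ-≤ d 0≤β (≤-trans (+-monoʳ-≤ _ (*-monoʳ-≤ 0≤2# D≤M)) (≤-reflexive (double M))))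
        (≤-trans (≤-reflexive (^-distrib-* f M d)) (*-monoʳ-≤ (^-nonneg d 0≤f) M^d≤NL)))

    DDD≤ : D * D * D ≤ e ^ d
    DDD≤ = ≤-trans (*-mono-≤ (*-nonneg 0≤D 0≤D) 0≤D (*-mono-≤ 0≤D 0≤D (fromℕ≤2^ d) (fromℕ≤2^ d)) (fromℕ≤2^ d))
      (≤-reflexive (sym (trans (^-distrib-* f 2# d) (*-congʳ (^-distrib-* 2# 2# d)))))

    X^d≤ : X ^ d ≤ c ^ dd * L ^ d * e ^ dd
    X^d≤ = ≤-trans (≤-reflexive (trans (^-distrib-* (c * L) (D * D * D) d) (*-congʳ (^-distrib-* c L d))))
      (*-mono-≤ (*-nonneg (^-nonneg d 0≤c) (^-nonneg d 0≤L)) (^-nonneg d 0≤DDD)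
        (*-monoˡ-≤ (^-nonneg d 0≤L) (^-monoʳ-≤ 1≤c (ℕ.m≤m*n d d)))
        (≤-trans (^-monoˡ-≤ d 0≤DDD DDD≤) (≤-reflexive (^-* e d d))))

    H^dd≤ : (c * e * f) ^ dd ≤ L ^ (P ℕ.* P)
    H^dd≤ = ≤-trans (^-monoʳ-≤ 1≤H (square-≤ P 1≤P))
      (≤-trans (≤-reflexive (sym (^-* (c * e * f) 4 (P ℕ.* P)))) (^-monoˡ-≤ (P ℕ.* P) (^-nonneg 4 (≤-trans 0≤1 1≤H)) H⁴≤L))
      where
      1≤H : 1# ≤ c * e * f
      1≤H = 1≤* (1≤* 1≤c 1≤e) 1≤f

  -- (1 - u)⁻ⁿ ≤ (1 + v)ⁿ with v = u (1 + 2u), and the exponent ε L / 2 is left over.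
  survival-bound : ∀ {N L u ε} n m → 0# ≤ u → 2# * u ≤ 1# → 2# * 2# * u ≤ ε → 0# ≤ L → (∀ m → Ex L m ≤ N) →
    fromℕ n * u ≤ (1# - ε) * L → Ex (ε * 1/2 * L) m ≤ N * (1# - u) ^ n
  survival-bound {N} {L} {u} {ε} n m 0≤u 2u≤1 4u≤ε 0≤L Ex≤N nu≤ = ≤-trans
    (≤-resp (*-identityʳ _) refl (*-monoʳ-≤ (Ex-nonneg m 0≤z) (1≤^ n 1≤)))
    (≤-trans (≤-reflexive (trans (*-congˡ (^-distrib-* (1# - u) (1# + v) n))
        (solve 3 (λ a b c → a :* (b :* c) := c :* a :* b) refl _ _ _)))
      (*-monoˡ-≤ (^-nonneg n 0≤1-u) (≤-trans ([1+v]^n*Ex n m 0≤z 0≤v)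
        (≤-trans (Ex-monoˡ (n ℕ.+ m) (+-nonneg 0≤z (*-nonneg (fromℕ-nonneg n) 0≤v)) z+nv≤L) (Ex≤N (n ℕ.+ m))))))
    where
    v z : Carrier
    v = u * (1# + 2# * u)
    z = ε * 1/2 * L

    0≤v : 0# ≤ v
    0≤v = *-nonneg 0≤u (+-nonneg 0≤1 (*-nonneg 0≤2# 0≤u))
    0≤ε : 0# ≤ ε
    0≤ε = ≤-trans (*-nonneg (*-nonneg 0≤2# 0≤2#) 0≤u) 4u≤ε
    0≤z : 0# ≤ z
    0≤z = *-nonneg (*-nonneg 0≤ε (<⇒≤ 0<1/2)) 0≤L
    0≤1-u : 0# ≤ 1# - u
    0≤1-u = ≤-resp refl (solve 1 (λ u → let one = con (ℤ.+ 1) in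
        (one :- (one :+ (one :+ con (ℤ.+ 0))) :* u) :+ u := one :- u) refl u)
      (+-nonneg (x≤y⇒0≤y-x 2u≤1) 0≤u)

    1≤ : 1# ≤ (1# - u) * (1# + v)
    1≤ = ≤-by (u * u * (1# - 2# * u))
      (solve 1 (λ u → let one = con (ℤ.+ 1); two = one :+ (one :+ con (ℤ.+ 0)) in
        (one :- u) :* (one :+ u :* (one :+ two :* u)) := one :+ u :* u :* (one :- two :* u)) refl u)
      (*-nonneg (*-nonneg 0≤u 0≤u) (x≤y⇒0≤y-x 2u≤1))

    2u≤ε/2 : 2# * u ≤ ε * 1/2
    2u≤ε/2 = ≤-resp (trans (solve 3 (λ t u h → t :* t :* u :* h := t :* u :* (t :* h)) refl 2# u 1/2) (trans (*-congˡ 2*1/2) (*-identityʳ _)))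
      refl (*-monoˡ-≤ (<⇒≤ 0<1/2) 4u≤ε)

    -- The correction in `n v` is `2 u` times `n u`; with `2 u ≤ ε / 2` and `n u ≤ L` it uses up
    -- only half of the reserve `ε L`.
    nv≤ : fromℕ n * v ≤ (1# - ε) * L + ε * 1/2 * L
    nv≤ = ≤-trans (≤-reflexive (solve 3 (λ n u t → n :* (u :* (con (ℤ.+ 1) :+ t)) := n :* u :+ t :* (n :* u)) refl (fromℕ n) u (2# * u)))
      (+-mono-≤ nu≤ (*-mono-≤ (*-nonneg 0≤2# 0≤u) (*-nonneg (fromℕ-nonneg n) 0≤u) 2u≤ε/2
        (≤-trans nu≤ (≤-by (ε * L) (solve 2 (λ e l → l := (con (ℤ.+ 1) :- e) :* l :+ e :* l) refl ε L) (*-nonneg 0≤ε 0≤L)))))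

    z+nv≤L : z + fromℕ n * v ≤ L
    z+nv≤L = ≤-trans (+-monoʳ-≤ z nv≤) (≤-reflexive (trans
      (solve 4 (λ e h l o → e :* h :* l :+ ((o :- e) :* l :+ e :* h :* l) := o :* l :- e :* l :+ ((con (ℤ.+ 1) :+ (con (ℤ.+ 1) :+ con (ℤ.+ 0))) :* h) :* (e :* l)) refl ε 1/2 L 1#)
      (trans (+-congˡ (trans (*-congʳ 2*1/2) (*-identityˡ _)))
        (trans (+-congʳ (+-congʳ (*-identityˡ L))) (solve 2 (λ l x → (l :- x) :+ x := l) refl L (ε * L))))))

  -- The single term of index 6d of the exponential series already suffices.
  exponential-bound : ∀ {h L z} P → let d = suc P; D = fromℕ d in
    1# ≤ h → 1# ≤ L → 0# ≤ z → D ≤ L → D * D ≤ L →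
    (h * 2# * L * 2# * (2# * L)) * (L * (fromℕ 6 * fromℕ 6)) ^ 3 ≤ z ^ 6 →
    h * 2# * L * (D * (2# * D) ^ d) ≤ Ex z (suc (6 ℕ.* d))
  exponential-bound {h} {L} {z} P 1≤h 1≤L 0≤z D≤L D²≤L hyp = ≤-trans
    (*-cancelʳ-≤ (<-≤-trans 0<1 (1≤fromℕ (ℕ.1≤n! m)))
      (≤-trans (*-mono-≤ 0≤W (fromℕ-nonneg (m !)) W≤ m!≤)
      (≤-trans (≤-reflexive (sym (^-distrib-* Y ((L * (fromℕ 6 * fromℕ 6)) ^ 3) d)))
      (≤-trans (^-monoˡ-≤ d (*-nonneg 0≤Y (^-nonneg 3 0≤36L)) hyp)
        (≤-reflexive (trans (^-* z 6 d) (sym term*m!)))))))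
    (≤-by (Ex z m) (+-comm _ _) (Ex-nonneg m 0≤z))
    where
    d m : ℕ
    d = suc P
    -- With `D² ≤ L` the factorial costs `(36 L)^(3 d)`, so the d-th roots compare a multiple of
    -- `L² L³` with `z^6`, of order `L^6`. At index `2 k d` the exponents are `2 + k` and `2 k`, and
    -- `k = 3` is the first case with a power of `L` to spare.
    m = 6 ℕ.* d
    D W Y : Carrier
    D = fromℕ d
    W = h * 2# * L * (D * (2# * D) ^ d)
    Y = h * 2# * L * 2# * (2# * L)

    0≤L : 0# ≤ L
    0≤L = ≤-trans 0≤1 1≤L
    0≤h : 0# ≤ h
    0≤h = ≤-trans 0≤1 1≤h
    0≤D : 0# ≤ D
    0≤D = fromℕ-nonneg d
    0≤36L : 0# ≤ L * (fromℕ 6 * fromℕ 6)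
    0≤36L = *-nonneg 0≤L (*-nonneg (fromℕ-nonneg 6) (fromℕ-nonneg 6))
    0≤h2L : 0# ≤ h * 2# * L
    0≤h2L = *-nonneg (*-nonneg 0≤h 0≤2#) 0≤L
    0≤Y : 0# ≤ Y
    0≤Y = *-nonneg (*-nonneg 0≤h2L 0≤2#) (*-nonneg 0≤2# 0≤L)
    0≤[2D]^d : 0# ≤ (2# * D) ^ d
    0≤[2D]^d = ^-nonneg d (*-nonneg 0≤2# 0≤D)
    0≤W : 0# ≤ W
    0≤W = *-nonneg 0≤h2L (*-nonneg 0≤D 0≤[2D]^d)

    W≤ : W ≤ Y ^ d
    W≤ = ≤-trans (*-mono-≤ 0≤h2L (*-nonneg 0≤D 0≤[2D]^d)
        (x≤x^suc P (1≤* (1≤* 1≤h 1≤2#) 1≤L))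
        (*-mono-≤ 0≤D 0≤[2D]^d (fromℕ≤2^ d) (^-monoˡ-≤ d (*-nonneg 0≤2# 0≤D) (*-monoʳ-≤ 0≤2# D≤L))))
      (≤-reflexive (trans (sym (*-assoc _ _ _)) (sym (trans (^-distrib-* (h * 2# * L * 2#) (2# * L) d)
        (*-congʳ (^-distrib-* (h * 2# * L) 2# d))))))

    m!≤ : fromℕ (m !) ≤ ((L * (fromℕ 6 * fromℕ 6)) ^ 3) ^ d
    m!≤ = ≤-trans (fromℕ-mono-≤ (n!≤n^n m))
      (≤-trans (≤-reflexive (trans (fromℕ-^ m m) (trans (^-cong m (fromℕ-* 6 d)) (sym (^-* (fromℕ 6 * D) 6 d)))))
      (^-monoˡ-≤ d (^-nonneg 6 (*-nonneg (fromℕ-nonneg 6) 0≤D))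
        (≤-trans (≤-reflexive (solve 2 (λ x d → (x :* d) :^ 6 := (d :* d :* (x :* x)) :^ 3) refl (fromℕ 6) D))
          (^-monoˡ-≤ 3 (*-nonneg (*-nonneg 0≤D 0≤D) 0≤36) (*-monoˡ-≤ 0≤36 D²≤L)))))
      where
      0≤36 : 0# ≤ fromℕ 6 * fromℕ 6
      0≤36 = *-nonneg (fromℕ-nonneg 6) (fromℕ-nonneg 6)

    term*m! : term z m * fromℕ (m !) ≈ z ^ m
    term*m! = trans (*-assoc _ _ _) (trans (*-congˡ (trans (*-comm _ _) (!*1/! m))) (*-identityʳ _))

-- Verification of the numerical hypotheses for large N.

module Main {c ℓ₁ ℓ₂} (g ℓ : Level) (ℝ : CompleteOrderedField c ℓ₁ ℓ₂) where
  open OrderedField ℝ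
  open RealAnalysis ℝ using (IsLog; IsDegreeThreshold; IsProbThreshold)
  open RandomSubset ℝ using (Pr)
  open Exponential ℝ
  open Logarithm ℝ
  open Estimates ℝ

  8# 36# : Carrier
  8#  = 2# * 2# * 2#
  36# = fromℕ 6 * fromℕ 6

  -- The largeness of log N that the proof requires when η = 1 / h and ε ≥ 1 / b.
  K₁ K₂ K₃ : Carrier → Carrier → Carrier
  K₁ h b = (fromℕ 12 * h * 8# * (2# * 2#)) ^ 4
  K₂ h b = 2# * 2# * b
  K₃ h b = h * 8# * 36# ^ 3 * (2# * b) ^ 6

  module _ {ε γ h b η : Carrier} (0<ε : 0# < ε) (0<γ : 0# < γ) (γ<1 : γ < 1#)
           (1≤h : 1# ≤ h) (hη≈1 : h * η ≈ 1#) (0<η : 0# < η) (1≤εb : 1# ≤ ε * b)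
           {N : ℕ} .{{_ : NonZero N}} (1<N : 1# < fromℕ N)
           {L : Carrier} (log : IsLog (fromℕ N) L)
           (2<L : 2# < L) (K₁≤L : K₁ h b ≤ L) (K₂≤L : K₂ h b ≤ L) (K₃≤L : K₃ h b ≤ L)
           (G : Group g ℓ) (order : HasOrder G N) (e : ℕ)
           {dN : Carrier} (threshold : IsDegreeThreshold γ N dN) (d≤dN : fromℕ (suc (suc e)) ≤ dN)
           {p r : Carrier} (0≤p : 0# ≤ p) (p≤1 : p ≤ 1#)
           (prob : IsProbThreshold ε N (suc (suc e)) r) (p≤r : p ≤ r)
           where

    private
      d n P : ℕ
      d = suc (suc e)
      P = suc e
      n = 2 ℕ.* (2 ℕ.* N) ℕ.^ P

      D u M θ β N′ Z C z : Carrier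
      D = fromℕ d
      N′ = fromℕ N
      u = p ^ d
      M = p * N′
      θ = 2# * D
      β = 2# * M + θ
      Z = β ^ P
      -- `R₁` needs the most: `2 D (1 + 2 D) ≤ 6 D² ≤ 6 L D³`, and the threshold `η / 2` there
      -- doubles the 6.
      C = fromℕ 12 * h
      z = ε * 1/2 * L

      degree : fromℕ (d ℕ.* d) ≤ L × L ^ (d ℕ.* d) ≤ N′
      degree = degree-threshold {N = N} {d} 0<γ γ<1 (ℕ.s≤s (ℕ.s≤s ℕ.z≤n)) threshold d≤dN 1<N 2<L log

      1≤L : 1# ≤ L
      1≤L = ≤-trans (1≤fromℕ {2} (ℕ.s≤s ℕ.z≤n)) (<⇒≤ 2<L)
      0<L : 0# < L
      0<L = <-≤-trans 0<1 1≤L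
      0≤L : 0# ≤ L
      0≤L = <⇒≤ 0<L
      0<N : 0# < N′
      0<N = <-trans 0<1 1<N
      0≤N : 0# ≤ N′
      0≤N = <⇒≤ 0<N
      0≤η : 0# ≤ η
      0≤η = <⇒≤ 0<η
      0≤ε : 0# ≤ ε
      0≤ε = <⇒≤ 0<ε
      0≤h : 0# ≤ h
      0≤h = ≤-trans 0≤1 1≤h
      0≤D : 0# ≤ D
      0≤D = fromℕ-nonneg d
      1≤D : 1# ≤ D
      1≤D = 1≤fromℕ {d} (ℕ.s≤s ℕ.z≤n)
      0≤M : 0# ≤ M
      0≤M = *-nonneg 0≤p 0≤N
      0≤u : 0# ≤ u
      0≤u = ^-nonneg d 0≤p
      0≤θ : 0# ≤ θ
      0≤θ = *-nonneg 0≤2# 0≤D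
      0≤β : 0# ≤ β
      0≤β = +-nonneg (*-nonneg 0≤2# 0≤M) 0≤θ
      0≤Z : 0# ≤ Z
      0≤Z = ^-nonneg P 0≤β
      1≤N : 1 ℕ.≤ N
      1≤N = ℕ.>-nonZero⁻¹ N

      D²≤L : D * D ≤ L
      D²≤L = ≤-trans (≤-reflexive (sym (fromℕ-* d d))) (proj₁ degree)

      D≤L : D ≤ L
      D≤L = ≤-trans (≤-resp (*-identityʳ D) refl (*-monoʳ-≤ 0≤D 1≤D)) D²≤L

      nu≤ : fromℕ n * u ≤ (1# - ε) * L
      nu≤ = ≤-trans (≤-reflexive (*-congʳ n≈)) (prob-threshold {N = N} {d} 0≤p p≤r prob 1<N log)
        where
        n≈ : fromℕ n ≈ fromℕ (2 ℕ.^ d) * fromℕ (N ℕ.^ P)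
        n≈ = trans (fromℕ-* 2 ((2 ℕ.* N) ℕ.^ P)) (trans (*-congˡ (trans (fromℕ-^ (2 ℕ.* N) P) (trans (^-cong P (fromℕ-* 2 N)) (^-distrib-* 2# N′ P))))
          (trans (sym (*-assoc 2# (2# ^ P) (N′ ^ P))) (*-cong (sym (fromℕ-^ 2 d)) (sym (fromℕ-^ N P)))))

      nu≤L : fromℕ n * u ≤ L
      nu≤L = ≤-trans nu≤ (≤-by (ε * L) (solve 2 (λ e l → l := (con (ℤ.+ 1) :- e) :* l :+ e :* l) refl ε L) (*-nonneg 0≤ε 0≤L))

      N^P≤n : N ℕ.^ P ℕ.≤ n
      N^P≤n = ℕ.≤-trans (ℕ.^-monoˡ-≤ P (ℕ.m≤n*m N 2)) (ℕ.m≤n*m _ 2)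

      uN^P≤L : u * N′ ^ P ≤ L
      uN^P≤L = ≤-trans (≤-trans (*-monoʳ-≤ 0≤u (≤-trans (≤-reflexive (sym (fromℕ-^ N P))) (fromℕ-mono-≤ N^P≤n))) (≤-reflexive (*-comm _ _))) nu≤L

      M^d≤NL : M ^ d ≤ N′ * L
      M^d≤NL = ≤-trans (≤-reflexive (trans (^-distrib-* p N′ d)
          (solve 3 (λ u n x → u :* (n :* x) := n :* (u :* x)) refl u N′ (N′ ^ P)))) (*-monoʳ-≤ 0≤N uN^P≤L)

      -- `u L² ≤ u N ≤ u N^P ≤ L`, the first step because `L² ≤ L^(d²) ≤ N`; then one factor `L` is
      -- cancelled.
      uL≤1 : u * L ≤ 1#
      uL≤1 = *-cancelʳ-≤ 0<L (≤-trans (≤-reflexive (*-assoc u L L)) (≤-trans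
        (*-monoʳ-≤ 0≤u (≤-trans (≤-trans (≤-reflexive (*-congˡ (sym (*-identityʳ L)))) (^-monoʳ-≤ 1≤L 2≤dd)) (≤-trans (proj₂ degree) N≤N^P)))
        (≤-trans uN^P≤L (≤-reflexive (sym (*-identityˡ L))))))
        where
        N≤N^P : N′ ≤ N′ ^ P
        N≤N^P = ≤-resp (*-identityʳ N′) refl (^-monoʳ-≤ (<⇒≤ 1<N) (ℕ.s≤s (ℕ.z≤n {e})))

        2≤dd : 2 ℕ.≤ d ℕ.* d
        2≤dd = ℕ.≤-trans (ℕ.s≤s (ℕ.s≤s ℕ.z≤n)) (ℕ.m≤m*n d d)

      2u≤1 : 2# * u ≤ 1#
      2u≤1 = ≤-trans (≤-reflexive (*-comm _ _)) (≤-trans (*-monoʳ-≤ 0≤u (<⇒≤ 2<L)) uL≤1)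

      u<1 : u < 1#
      u<1 = [ (λ 0<u → <-≤-trans (<-resp (+-identityˡ u) (solve 1 (λ u → u :+ u := (con (ℤ.+ 1) :+ (con (ℤ.+ 1) :+ con (ℤ.+ 0))) :* u) refl u)
                (+-monoˡ-< u 0<u)) 2u≤1) , (λ u<1 → u<1) ]′ (<-cotrans 0<1 u)

      -- `b` stands in for `1 / ε`: `4 u ≤ ε u (4 b)`, and `K₂ = 4 b` is at most `L`.
      4u≤ε : 2# * 2# * u ≤ ε
      4u≤ε = ≤-trans (≤-resp (*-identityʳ _) refl (*-monoʳ-≤ (*-nonneg (*-nonneg 0≤2# 0≤2#) 0≤u) 1≤εb))
        (≤-trans (≤-reflexive (solve 4 (λ t u e b → t :* t :* u :* (e :* b) := e :* (u :* (t :* t :* b))) refl 2# u ε b))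
        (≤-trans (*-monoʳ-≤ 0≤ε (*-monoʳ-≤ 0≤u K₂≤L))
        (≤-trans (*-monoʳ-≤ 0≤ε uL≤1) (≤-reflexive (*-identityʳ ε)))))

      1≤C : 1# ≤ C
      1≤C = ≤-resp (*-identityˡ 1#) refl (*-mono-≤ 0≤1 0≤1 (1≤fromℕ {12} (ℕ.s≤s ℕ.z≤n)) 1≤h)

      bound : C * L * (D * D * D) * Z ≤ N′
      bound = polynomial-bound P (ℕ.s≤s ℕ.z≤n) 0≤M 1≤L 1≤C M^d≤NL D≤L (proj₂ degree) K₁≤L

      0≤LDDDZ : 0# ≤ L * (D * D * D) * Z
      0≤LDDDZ = *-nonneg (*-nonneg 0≤L (*-nonneg (*-nonneg 0≤D 0≤D) 0≤D)) 0≤Z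

      -- η C = 12.
      bound′ : fromℕ 12 * (L * (D * D * D) * Z) ≤ η * N′
      bound′ = ≤-trans (≤-reflexive (trans (*-congʳ (trans (sym (*-identityʳ _)) (*-congˡ (sym hη≈1))))
        (solve 6 (λ t h e l x z → t :* (h :* e) :* (l :* x :* z) := e :* (t :* h :* l :* x :* z)) refl (fromℕ 12) h η L (D * D * D) Z)))
        (*-monoʳ-≤ 0≤η bound)

      R₁ : 2# * (D * (1# + θ) * Z) ≤ η * 1/2 * N′
      R₁ = ≤-trans (≤-by (fromℕ 6 * (D * D * Z) * (L * D - 1#) + 2# * (D * Z) * (D - 1#))
          (solve 3 (λ l d z → let one = con (ℤ.+ 1); two = one :+ (one :+ con (ℤ.+ 0)); six = one :+ (one :+ (one :+ (one :+ two))) in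
            six :* (l :* (d :* d :* d) :* z) := two :* (d :* (one :+ two :* d) :* z) :+
              (six :* (d :* d :* z) :* (l :* d :- one) :+ two :* (d :* z) :* (d :- one))) refl L D Z)
          (+-nonneg (*-nonneg (*-nonneg (fromℕ-nonneg 6) (*-nonneg (*-nonneg 0≤D 0≤D) 0≤Z))
              (x≤y⇒0≤y-x (≤-resp (*-identityˡ 1#) refl (*-mono-≤ 0≤1 0≤1 1≤L 1≤D))))
            (*-nonneg (*-nonneg 0≤2# (*-nonneg 0≤D 0≤Z)) (x≤y⇒0≤y-x 1≤D))))
        (≤-resp (trans (*-congʳ (*-congʳ (fromℕ-* 6 2))) (trans (solve 4 (λ s t x h → s :* t :* x :* h := s :* x :* (t :* h)) refl (fromℕ 6) 2# _ 1/2)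
                  (trans (*-congˡ 2*1/2) (*-identityʳ _))))
                (solve 3 (λ e n h → e :* n :* h := e :* h :* n) refl η N′ 1/2)
                (*-monoˡ-≤ (<⇒≤ 0<1/2) bound′))

      R₂ : fromℕ n * (u * (D * D * (fromℕ 4 * (p * θ)) * β ^ e)) ≤ η
      R₂ = *-cancelʳ-≤ 0<N (≤-trans (≤-reflexive
          (solve 6 (λ x d p n y z → let one = con (ℤ.+ 1); two = one :+ (one :+ con (ℤ.+ 0)); four = one :+ (one :+ two) in
            x :* (y :* (d :* d :* (four :* (p :* (two :* d))) :* z)) :* n := (x :* y) :* (four :* (d :* d :* d)) :* ((two :* (p :* n)) :* z))
            refl (fromℕ n) D p N′ u (β ^ e)))
        (≤-trans (*-mono-≤ (*-nonneg (*-nonneg (fromℕ-nonneg n) 0≤u) 0≤4DDD) (*-nonneg (*-nonneg 0≤2# 0≤M) (^-nonneg e 0≤β))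
          (*-monoˡ-≤ 0≤4DDD nu≤L) (*-monoˡ-≤ (^-nonneg e 0≤β) (≤-by θ refl 0≤θ)))
        (≤-trans (≤-trans (≤-reflexive (solve 4 (λ l f d z → l :* (f :* d) :* z := f :* (l :* d :* z)) refl L (fromℕ 4) (D * D * D) Z))
          (*-monoˡ-≤ 0≤LDDDZ (fromℕ-mono-≤ {4} {12} (ℕ.m≤m+n 4 8)))) bound′)))
        where
        0≤4DDD : 0# ≤ fromℕ 4 * (D * D * D)
        0≤4DDD = *-nonneg (fromℕ-nonneg 4) (*-nonneg (*-nonneg 0≤D 0≤D) 0≤D)

      -- The left side contains `L^5`. The factors `(ε b)^6 ≥ 1` and `(2 · 1/2)^6 = 1` are inserted
      -- so that `K₃` splits off, and `K₃ ≤ L` supplies the sixth power.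
      exp-hyp : (h * 2# * L * 2# * (2# * L)) * (L * 36#) ^ 3 ≤ z ^ 6
      exp-hyp = ≤-trans (≤-resp (*-identityʳ _) refl (*-monoʳ-≤ 0≤X (1≤^ 6 1≤εb)))
        (≤-trans (≤-reflexive (trans (sym (*-identityʳ _)) (trans (*-congˡ (sym (trans (^-cong 6 2*1/2) (solve 0 (con (ℤ.+ 1) :^ 6 := con (ℤ.+ 1)) refl)))) regroup)))
          (≤-trans (*-monoʳ-≤ (*-nonneg (^-nonneg 6 (*-nonneg 0≤ε (<⇒≤ 0<1/2))) (^-nonneg 5 0≤L)) K₃≤L)
            (≤-reflexive (solve 3 (λ e h l → (e :* h) :^ 6 :* l :^ 5 :* l := (e :* h :* l) :^ 6) refl ε 1/2 L))))
        where
        0≤X : 0# ≤ (h * 2# * L * 2# * (2# * L)) * (L * 36#) ^ 3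
        0≤X = *-nonneg (*-nonneg (*-nonneg (*-nonneg (*-nonneg 0≤h 0≤2#) 0≤L) 0≤2#) (*-nonneg 0≤2# 0≤L))
          (^-nonneg 3 (*-nonneg 0≤L (*-nonneg (fromℕ-nonneg 6) (fromℕ-nonneg 6))))

        regroup : (h * 2# * L * 2# * (2# * L)) * (L * 36#) ^ 3 * (ε * b) ^ 6 * (2# * 1/2) ^ 6 ≈
                  (ε * 1/2) ^ 6 * L ^ 5 * K₃ h b
        regroup = solve 7 (λ h t l q e b i → (h :* t :* l :* t :* (t :* l)) :* (l :* q) :^ 3 :* (e :* b) :^ 6 :* (t :* i) :^ 6
          := (e :* i) :^ 6 :* l :^ 5 :* (h :* (t :* t :* t) :* q :^ 3 :* (t :* b) :^ 6)) refl h 2# L 36# ε b 1/2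

      -- The two sides meet at a partial sum of exp (ε L / 2): it dominates the number of
      -- rearrangements by `exponential-bound` and is dominated by `N (1 - u)ⁿ` by `survival-bound`.
      R₃ : 2# * (fromℕ n * (u * (D * θ ^ d))) ≤ η * (N′ * (1# - u) ^ n)
      R₃ = ≤-trans (≤-reflexive (solve 4 (λ t n u x → t :* (n :* (u :* x)) := (n :* u) :* (t :* x)) refl 2# (fromℕ n) u (D * θ ^ d)))
        (≤-trans (*-monoˡ-≤ (*-nonneg 0≤2# (*-nonneg 0≤D (^-nonneg d 0≤θ))) nu≤L)
        (≤-trans (≤-reflexive (trans (sym (*-identityˡ _)) (trans (*-congʳ (sym hη≈1))
          (solve 5 (λ h e l t x → (h :* e) :* (l :* (t :* x)) := e :* (h :* t :* l :* x)) refl h η L 2# (D * θ ^ d)))))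
        (*-monoʳ-≤ 0≤η (≤-trans (exponential-bound P 1≤h 1≤L (*-nonneg (*-nonneg 0≤ε (<⇒≤ 0<1/2)) 0≤L) D≤L D²≤L exp-hyp)
          (survival-bound n (suc (6 ℕ.* d)) 0≤u 2u≤1 4u≤ε 0≤L (λ m → Ex≤exp m 0≤L log) nu≤)))))

      η/2<η : η * 1/2 < η
      η/2<η = <-respʳ-≈ (trans (sym (*-assoc _ _ _)) (trans (solve 3 (λ e t h → e :* t :* h := e :* (t :* h)) refl η 2# 1/2) (trans (*-congˡ 2*1/2) (*-identityʳ η))))
        (*-monoʳ-< 0<η (<-resp (+-identityˡ 1/2) (solve 1 (λ h → h :+ h := (con (ℤ.+ 1) :+ (con (ℤ.+ 1) :+ con (ℤ.+ 0))) :* h) refl 1/2) (+-monoˡ-< 1/2 0<1/2)))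

      η≤1 : η ≤ 1#
      η≤1 = ≤-resp (*-identityˡ η) hη≈1 (*-monoˡ-≤ 0≤η 1≤h)

    Pr-diameter≤ : Pr p (Cayley.diameter≤? G order d) ≤ fromℕ 5 * η
    Pr-diameter≤ = DiameterBound.diameter-bound ℝ G order p 0≤p p≤1 e
      (*-pos 0<η 0<1/2) η/2<η η≤1 1≤N u<1 R₁ R₂ R₃

theorem2 :
    ∀ {c ℓ₁ ℓ₂ g ℓ : Level} (ℝ : CompleteOrderedField c ℓ₁ ℓ₂) →
    let open CompleteOrderedField ℝ
        open RealAnalysis ℝ
        open RandomSubset ℝ
    in
    ∀ (ε γ : Carrier) → 0# < ε → 0# < γ → γ < 1# →
    ∀ (δ : Carrier) → 0# < δ →
    ∃[ N₀ ] ∀ (N : ℕ) .{{_ : NonZero N}} → N₀ ℕ.≤ N →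
      ∀ (G : Group g ℓ) (order : HasOrder G N) →
      ∀ (d : ℕ) → 2 ℕ.≤ d →
      ∀ (dN : Carrier) → IsDegreeThreshold γ N dN → fromℕ d ≤ dN →
      ∀ (p : Carrier) → 0# ≤ p → p ≤ 1# →
      ∀ (r : Carrier) → IsProbThreshold ε N d r → p ≤ r →
      Pr p (Cayley.diameter≤? G order d) < δ
theorem2 {g = g} {ℓ} ℝ ε γ 0<ε 0<γ γ<1 δ 0<δ = choose (reciprocal 0<δ (fromℕ 5)) (reciprocal 0<ε 1#)
  where
  open OrderedField ℝ
  open RealAnalysis ℝ using (IsLog; IsDegreeThreshold; IsProbThreshold)
  open RandomSubset ℝ using (Pr)
  open Exponential ℝ
  open Logarithm ℝ
  open Main g ℓ ℝ

  reciprocal : ∀ {x} → 0# < x → ∀ k → ∃[ m ] k < x * fromℕ (suc m)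
  reciprocal {x} 0<x k = scale (1/ 0<x)
    where
    scale : ∃[ x′ ] 0# < x′ × x * x′ ≈ 1# → ∃[ m ] k < x * fromℕ (suc m)
    scale (x′ , 0<x′ , xx′≈1) = let (m , kx′<m) = archimedean (k * x′) in m , <-trans
      (<-resp (trans (solve 3 (λ x k y → x :* (k :* y) := k :* (x :* y)) refl x k x′) (trans (*-congˡ xx′≈1) (*-identityʳ k))) refl
        (*-monoʳ-< 0<x kx′<m))
      (*-monoʳ-< 0<x (fromℕ-mono-< (ℕ.n<1+n m)))

  Conclusion : ℕ → Set _
  Conclusion N₀ = ∀ (N : ℕ) .{{_ : NonZero N}} → N₀ ℕ.≤ N →
      ∀ (G : Group g ℓ) (order : HasOrder G N) →
      ∀ (d : ℕ) → 2 ℕ.≤ d →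
      ∀ (dN : Carrier) → IsDegreeThreshold γ N dN → fromℕ d ≤ dN →
      ∀ (p : Carrier) → 0# ≤ p → p ≤ 1# →
      ∀ (r : Carrier) → IsProbThreshold ε N d r → p ≤ r →
      Pr p (Cayley.diameter≤? G order d) < δ

  choose : ∃[ m ] fromℕ 5 < δ * fromℕ (suc m) → ∃[ k ] 1# < ε * fromℕ (suc k) → ∃[ N₀ ] Conclusion N₀
  choose (m , 5<δh) (k , 1<εb) = large (1/ (0<fromℕ[1+n] m)) (archimedean (2# + K₁ h b + K₂ h b + K₃ h b))
    where
    h b : Carrier
    h = fromℕ (suc m)
    b = fromℕ (suc k)

    0≤K₁ : 0# ≤ K₁ h b
    0≤K₁ = ^-nonneg 4 (*-nonneg (*-nonneg (*-nonneg (fromℕ-nonneg 12) (fromℕ-nonneg (suc m)))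
      (*-nonneg (*-nonneg 0≤2# 0≤2#) 0≤2#)) (*-nonneg 0≤2# 0≤2#))
    0≤K₂ : 0# ≤ K₂ h b
    0≤K₂ = *-nonneg (*-nonneg 0≤2# 0≤2#) (fromℕ-nonneg (suc k))
    0≤K₃ : 0# ≤ K₃ h b
    0≤K₃ = *-nonneg (*-nonneg (*-nonneg (fromℕ-nonneg (suc m)) (*-nonneg (*-nonneg 0≤2# 0≤2#) 0≤2#))
      (^-nonneg 3 (*-nonneg (fromℕ-nonneg 6) (fromℕ-nonneg 6)))) (^-nonneg 6 (*-nonneg 0≤2# (fromℕ-nonneg (suc k))))

    large : ∃[ η ] 0# < η × h * η ≈ 1# → ∃[ A ] 2# + K₁ h b + K₂ h b + K₃ h b < fromℕ A → ∃[ N₀ ] Conclusion N₀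
    -- For `N > 4^A` the logarithm is at least `A` by `log-large`, and `A` exceeds the sum of all
    -- the constants that log N has to dominate.
    large (η , 0<η , hη≈1) (A , K<A) = suc (4 ℕ.^ A) , conclude
      where
      5η<δ : fromℕ 5 * η < δ
      5η<δ = <-respʳ-≈ (trans (*-assoc _ _ _) (trans (*-congˡ hη≈1) (*-identityʳ δ))) (*-monoˡ-< 0<η 5<δh)

      conclude : Conclusion (suc (4 ℕ.^ A))
      -- The logarithm `L` is the witness carried by `threshold`; none is constructed. Matching on
      -- `2 ≤ d` exposes `d` as `e + 2`.
      conclude N 4^A<N G order (suc (suc e)) (ℕ.s≤s (ℕ.s≤s ℕ.z≤n)) dN threshold@(L , _ , _ , _ , log , _) d≤dN p 0≤p p≤1 r prob p≤r =
        ≤-<-trans (Pr-diameter≤ {h = h} {b} {η} 0<ε 0<γ γ<1 (1≤fromℕ {suc m} (ℕ.s≤s ℕ.z≤n)) hη≈1 0<η (<⇒≤ 1<εb) 1<N log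
          2<L K₁≤L K₂≤L K₃≤L G order e threshold d≤dN 0≤p p≤1 prob p≤r) 5η<δ
        where
        1<N : 1# < fromℕ N
        1<N = <-≤-trans (<-respˡ-≈ (+-identityʳ 1#) (fromℕ-mono-< (ℕ.n<1+n 1)))
          (fromℕ-mono-≤ (ℕ.≤-trans (ℕ.s≤s (ℕ.m^n>0 4 A)) 4^A<N))

        K<L : 2# + K₁ h b + K₂ h b + K₃ h b < L
        K<L = <-≤-trans K<A (log-large A 4^A<N (log-nonneg 1<N log) log)

        2<L : 2# < L
        2<L = ≤-<-trans (≤-by (K₁ h b + K₂ h b + K₃ h b) (trans (+-congʳ (+-assoc _ _ _)) (+-assoc _ _ _))
          (+-nonneg (+-nonneg 0≤K₁ 0≤K₂) 0≤K₃)) K<L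
        K₁≤L : K₁ h b ≤ L
        K₁≤L = ≤-trans (≤-by (2# + K₂ h b + K₃ h b)
          (solve 4 (λ t x y z → t :+ x :+ y :+ z := x :+ (t :+ y :+ z)) refl 2# (K₁ h b) (K₂ h b) (K₃ h b))
          (+-nonneg (+-nonneg 0≤2# 0≤K₂) 0≤K₃)) (<⇒≤ K<L)
        K₂≤L : K₂ h b ≤ L
        K₂≤L = ≤-trans (≤-by (2# + K₁ h b + K₃ h b)
          (solve 4 (λ t x y z → t :+ x :+ y :+ z := y :+ (t :+ x :+ z)) refl 2# (K₁ h b) (K₂ h b) (K₃ h b))
          (+-nonneg (+-nonneg 0≤2# 0≤K₁) 0≤K₃)) (<⇒≤ K<L)
        K₃≤L : K₃ h b ≤ L
        K₃≤L = ≤-trans (≤-by (2# + K₁ h b + K₂ h b) (+-comm _ _)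
          (+-nonneg (+-nonneg 0≤2# 0≤K₁) 0≤K₂)) (<⇒≤ K<L)
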